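{- Let $n\ge 1$ be an integer and let $\mathcal{P}^{\circ(-1)}=\left[\frac{i!\,j!}{(i+j)!}\right]_{i,j=0}^{n-1}$ be the Hadamard (entrywise) inverse of the $n\times n$ Pascal matrix $\mathcal{P}=\left[\frac{(i+j)!}{i!\,j!}\right]_{i,j=0}^{n-1}$. Then $$\mathrm{Inertia}\left(\mathcal{P}^{\circ(-1)}\right)=\begin{cases}\left(\dfrac n2,\,0,\,\dfrac n2\right) & \text{if } n \text{ is even},\\[2mm] \left(\dfrac{n+1}{2},\,0,\,\dfrac{n-1}{2}\right) & \text{if } n\text{ is odd},\end{cases}$$ and $\mathcal{P}^{\circ(-1)}$ is Birkhoff-James orthogonal to the $n\times n$ identity matrix $I$ in the trace norm if and only if $n$ is even.
   Context: For a real symmetric matrix $A$, let $\pi(A),\xi(A),\nu(A)$ denote the number of positive, zero and negative eigenvalues of $A$, respectively (counted with multiplicity). The inertia of $A$ is the triplet $\mathrm{Inertia}(A)=(\pi(A),\xi(A),\nu(A))$. Let $\|\cdot\|_1$ denote the trace norm (sum of singular values) on the space of $n\times n$ real matrices. For $n\times n$ real matrices $X,Y$, $X$ is said to be Birkhoff-James orthogonal to $Y$ in the trace norm if $\|X+tY\|_1\ge \|X\|_1$ for all $t\in\mathbb{R}$. -}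

module Defs where

open import Algebra.Bundles using (CommutativeRing; Semiring)
open import Algebra.Structures using (IsCommutativeRing)
open import Data.Fin.Base using (Fin; zero; toℕ)
open import Data.Fin.Properties using () renaming (_≟_ to _≟ᶠ_)
open import Data.Nat.Base as ℕ using (ℕ; zero; suc; _!)
open import Data.Product.Base using (_×_; _,_; ∃; ∃₂)
open import Data.Vec.Base using (count)
open import Data.Vec.Functional using (Vector; removeAt; map; tail; toVec; transpose)
open import Function.Base using (_∘_)
open import Level using (0ℓ) renaming (suc to lsuc)
open import Relation.Binary.Core using (Rel)
open import Relation.Binary.Definitions using (Decidable)
open import Relation.Binary.PropositionalEquality.Core using (_≡_)
open import Relation.Binary.Structures using (IsDecTotalOrder)
open import Relation.Nullary.Decidable.Core using (does)
open import Relation.Nullary.Negation.Core using (¬_)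
open import Data.Bool.Base using (if_then_else_)
import Algebra.Definitions.RawSemiring as RawSemiringDefs
import Relation.Binary.Construct.NonStrictToStrict as ToStrict

-- A complete ordered field in the classical sense, i.e. the real line up to
-- isomorphism.  The decidable order and the least upper bound of an arbitrary
-- predicate encode classical analysis: constructive reals do not satisfy them.

record CompleteOrderedField : Set (lsuc 0ℓ) where
  infix  8 _⁻¹
  infix  8 -_
  infixl 7 _*_
  infixl 6 _+_
  infix  4 _≈_ _≤_
  field
    Carrier           : Set
    _≈_ _≤_           : Rel Carrier 0ℓ
    _+_ _*_           : Carrier → Carrier → Carrier
    -_                : Carrier → Carrier
    0# 1#             : Carrier
    isCommutativeRing : IsCommutativeRing _≈_ _+_ _*_ -_ 0# 1#
    0≉1               : ¬ (0# ≈ 1#)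

    -- Total, with an unspecified value at 0#.
    _⁻¹               : Carrier → Carrier
    ⁻¹-inverseʳ       : ∀ x → ¬ (x ≈ 0#) → x * x ⁻¹ ≈ 1#

    isDecTotalOrder   : IsDecTotalOrder _≈_ _≤_
    +-monoˡ-≤         : ∀ z {x y} → x ≤ y → x + z ≤ y + z
    *-nonNegative     : ∀ {x y} → 0# ≤ x → 0# ≤ y → 0# ≤ x * y

  UpperBound : (Carrier → Set) → Carrier → Set
  UpperBound P b = ∀ x → P x → x ≤ b

  field
    supremum : (P : Carrier → Set) → ∃ P → ∃ (UpperBound P) →
               ∃ λ s → UpperBound P s × (∀ b → UpperBound P b → s ≤ b)

  commutativeRing : CommutativeRing 0ℓ 0ℓ
  commutativeRing = record { isCommutativeRing = isCommutativeRing }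

  open CommutativeRing commutativeRing public using (_-_; semiring)
  open IsDecTotalOrder isDecTotalOrder public using (_≟_; _≤?_)
  open ToStrict _≈_ _≤_ public using (_<_)

  _<?_ : Decidable _<_
  _<?_ = ToStrict.<-decidable _≈_ _≤_ _≟_ _≤?_

module RealMatrices (ℝ : CompleteOrderedField) where

  open CompleteOrderedField ℝ
  open RawSemiringDefs (Semiring.rawSemiring semiring)
    using (sum; product; _^_) renaming (_×_ to _×ℝ_)

  fromℕ : ℕ → Carrier
  fromℕ n = n ×ℝ 1#

  Matrix : ℕ → Set
  Matrix n = Vector (Vector Carrier n) n

  identity : ∀ {n} → Matrix n
  identity i j = if does (i ≟ᶠ j) then 1# else 0#

  infixl 6 _+ᴹ_ _-ᴹ_
  infixl 7 _*ᴹ_ _•_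

  _+ᴹ_ _-ᴹ_ _*ᴹ_ : ∀ {n} → Matrix n → Matrix n → Matrix n
  (A +ᴹ B) i j = A i j + B i j
  (A -ᴹ B) i j = A i j - B i j
  (A *ᴹ B) i j = sum λ k → A i k * B k j

  _•_ : ∀ {n} → Carrier → Matrix n → Matrix n
  (c • A) i j = c * A i j

  -- Laplace expansion along the first row.
  det : ∀ {n} → Matrix n → Carrier
  det {zero}  A = 1#
  det {suc n} A = sum λ j →
    (- 1#) ^ toℕ j * A zero j * det (map (λ row → removeAt row j) (tail A))

  -- The entries of λs are the eigenvalues of A listed with algebraic
  -- multiplicity: the characteristic polynomial det (x I - A) equals ∏ (x - λᵢ).
  -- The field is infinite, so equal values for all x means equal polynomials.
  Eigenvalues : ∀ {n} → Matrix n → Vector Carrier n → Set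
  Eigenvalues A λs = ∀ x → det (x • identity -ᴹ A) ≈ product (λ i → x - λs i)

  HasInertia : ∀ {n} → Matrix n → ℕ × ℕ × ℕ → Set
  HasInertia A (π , ξ , ν) = ∃ λ λs → Eigenvalues A λs
    × count (0# <?_) (toVec λs) ≡ π
    × count (0# ≟_)  (toVec λs) ≡ ξ
    × count (_<? 0#) (toVec λs) ≡ ν

  SingularValues : ∀ {n} → Matrix n → Vector Carrier n → Set
  SingularValues A σs =
    (∀ i → 0# ≤ σs i) × Eigenvalues (transpose A *ᴹ A) (λ i → σs i * σs i)

  -- The graph of the function A ↦ ‖A‖₁.
  TraceNorm : ∀ {n} → Matrix n → Carrier → Set
  TraceNorm A s = ∃ λ σs → SingularValues A σs × s ≈ sum σs

  -- ‖X + tY‖₁ ≥ ‖X‖₁ for all t, including that both norms are defined.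
  BirkhoffJamesOrthogonal : ∀ {n} → Matrix n → Matrix n → Set
  BirkhoffJamesOrthogonal X Y = ∀ t → ∃₂ λ a b →
    TraceNorm X a × TraceNorm (X +ᴹ t • Y) b × a ≤ b

  pascal : ∀ n → Matrix n
  pascal n i j =
    fromℕ ((toℕ i ℕ.+ toℕ j) !) * fromℕ (toℕ i ! ℕ.* toℕ j !) ⁻¹

  -- Meaningful for matrices without zero entries.
  hadamardInverse : ∀ {n} → Matrix n → Matrix n
  hadamardInverse A i j = A i j ⁻¹

{-# OPTIONS --safe #-}
module Submission where

open import Algebra.Bundles using (CommutativeRing; Semiring)
import Algebra.Solver.Ring as RingSolver
open import Algebra.Solver.Ring.AlmostCommutativeRing
  using (fromCommutativeRing; _-Raw-AlmostCommutative⟶_)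
open import Data.Fin.Base as Fin using (Fin; zero; suc; toℕ; punchIn)
import Data.Fin.Properties as Fin
open import Data.Integer.Base as ℤ using (ℤ; +_; -[1+_]; _⊖_)
import Data.Integer.Properties as ℤ
open import Data.List.Base as List using (List)
import Data.List.Properties as List
open import Data.List.Relation.Binary.Permutation.Propositional as Perm using (_↭_)
open import Data.List.Relation.Binary.Permutation.Propositional.Properties using (All-resp-↭; ↭-length)
open import Data.List.Relation.Unary.All as All using (All)
import Data.List.Relation.Unary.All.Properties as All
open import Data.Maybe.Base using (Maybe; just; nothing)
open import Data.Nat.Base as ℕ using (ℕ; zero; suc; _!)
open import Data.Nat.Divisibility using (_∣_; divides; ∣1⇒≡1; ∣m+n∣m⇒∣n)
open import Data.Nat.DivMod using (_/_; m*n/n≡m)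
import Data.Nat.Properties as ℕ
open import Data.Product.Base using (_×_; _,_; ∃; ∃₂; proj₁; proj₂)
open import Data.Sum.Base using (_⊎_; inj₁; inj₂)
open import Data.Unit.Base using (⊤; tt)
open import Data.Vec.Base using (count)
open import Data.Vec.Functional using (Vector; removeAt; map; tail; toVec; transpose; _∷_; insertAt)
open import Defs
open import Function.Base using (_∘_; _$_; case_of_)
open import Function.Bundles using (_⇔_; mk⇔)
open import Relation.Binary.Bundles using (Poset)
import Relation.Binary.Construct.NonStrictToStrict as ToStrict
open import Relation.Binary.Definitions using (tri<; tri≈; tri>)
open import Relation.Binary.PropositionalEquality.Core as ≡ using (_≡_; _≢_)
import Relation.Binary.Reasoning.PartialOrder as PartialOrderReasoning
import Relation.Binary.Reasoning.Setoid as SetoidReasoning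
open import Relation.Binary.Structures using (IsDecTotalOrder)
open import Relation.Nullary.Decidable.Core using (Dec; yes; no)
open import Relation.Nullary.Negation.Core using (¬_; contradiction)

-- Up to positive diagonal scaling, the matrix A = [i! j! / (i + j)!] is the Hankel matrix of the
-- moments 1 / k!. The functions k ↦ (k + n - 1)! / (k + m)! are polynomials of degree below n for
-- m < n, so their n-th differences vanish, while for m = n the n-th difference has sign (-1)ⁿ. This
-- gives vectors b₀, b₁, … that are orthogonal for A with bₙ·Abₙ of sign (-1)ⁿ; hence A is positive
-- definite on the span of the even ones and negative definite on the span of the odd ones, and
-- Sylvester's law of inertia fixes the signs of the eigenvalues λᵢ.
--
-- By the spectral theorem ‖A + tI‖₁ = Σ |λᵢ + t|, and |λ| + t sgn λ ≤ |λ + t| with equality for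
-- small t. So A is orthogonal to I exactly when Σ sgn λᵢ = 0.

-- The inertia is defined by a factorisation of the characteristic polynomial, so the eigenvalues
-- have to be produced: the matrix is diagonalised orthogonally, and multiplicativity of the
-- determinant turns Q D Qᵀ into the factorisation. The analytic input is the supremum axiom alone.
-- In place of compactness of the unit sphere stands a dichotomy from Gaussian elimination: a
-- positive semidefinite form either has a kernel vector or dominates a positive multiple of x ∙ x.
--
-- Sylvester's law enters through lower bounds for the numbers of positive and of negative
-- eigenvalues. The two families of bₙ together have as many members as the matrix has rows, which
-- leaves no room for zero eigenvalues and makes both bounds exact.
--
-- `TraceNorm` is a relation. Orthogonality asks for values to be exhibited, but refuting it means
-- comparing arbitrary values, so the norm must be shown to be single-valued. Two lists of
-- eigenvalues are known only to give the same function det (x I - M); a common factor cancels away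
-- from its root, and Lipschitz bounds recover the value at the root.

module _ (ℝ : CompleteOrderedField) where
  open CompleteOrderedField ℝ
  open RealMatrices ℝ
  open CommutativeRing commutativeRing using
    ( setoid; ring; +-cong; +-congˡ; +-congʳ; *-cong; *-congˡ; *-congʳ; -‿cong
    ; +-identityˡ; +-identityʳ; +-comm; +-assoc; *-comm; *-assoc; zeroˡ; zeroʳ
    ; *-identityˡ; *-identityʳ; -‿inverseʳ; distribˡ; distribʳ
    ; refl; sym; trans; reflexive)
  open import Algebra.Definitions.RawSemiring (Semiring.rawSemiring semiring) using (_^_; product)
  open import Algebra.Properties.CommutativeMonoid.Sum (CommutativeRing.*-commutativeMonoid commutativeRing)
    using () renaming (sum-cong-≋ to product-cong-≋; sum-remove to product-remove)
  open import Algebra.Properties.Ring ring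
    using (-0#≈0#; -‿involutive; -‿+-comm; -‿distribˡ-*; -‿distribʳ-*)
  open import Algebra.Properties.Semiring.Mult semiring using (×-homo-+; ×1-homo-*)
  open import Algebra.Properties.Semiring.Mult.TCOptimised semiring
    using () renaming (_×_ to _×′_; 1+× to 1+×′; ×-homo-+ to ×′-homo-+; ×1-homo-* to ×′1-homo-*)
  open import Algebra.Properties.Semiring.Sum semiring
    using (sum; sum-cong-≋; ∑-distrib-+; ∑-comm; sum-remove; *-distribˡ-sum; *-distribʳ-sum)
  module DTO = IsDecTotalOrder isDecTotalOrder
  module ≈-Reasoning = SetoidReasoning setoid

  -- _×′_ makes the solver's constant 1 definitionally equal to 1#.
  fromℤ : ℤ → Carrier
  fromℤ (+ n)    = n ×′ 1#
  fromℤ -[1+ n ] = - (suc n ×′ 1#)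

  private
    fromℤ-⊖ : ∀ m n → fromℤ (m ⊖ n) ≈ m ×′ 1# - n ×′ 1#
    fromℤ-⊖ m zero = sym (trans (+-congˡ -0#≈0#) (+-identityʳ _))
    fromℤ-⊖ zero (suc n) = sym (+-identityˡ _)
    fromℤ-⊖ (suc m) (suc n) = begin
      fromℤ (suc m ⊖ suc n)                    ≡⟨ ≡.cong fromℤ (ℤ.[1+m]⊖[1+n]≡m⊖n m n) ⟩
      fromℤ (m ⊖ n)                            ≈⟨ fromℤ-⊖ m n ⟩
      m ×′ 1# - n ×′ 1#                        ≈⟨ +-congˡ (+-identityˡ _) ⟨
      m ×′ 1# + (0# - n ×′ 1#)                 ≈⟨ +-congˡ (+-congʳ (-‿inverseʳ 1#)) ⟨
      m ×′ 1# + (1# - 1# - n ×′ 1#)            ≈⟨ +-congˡ (+-assoc _ _ _) ⟩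
      m ×′ 1# + (1# + (- 1# - n ×′ 1#))        ≈⟨ +-assoc _ _ _ ⟨
      m ×′ 1# + 1# + (- 1# - n ×′ 1#)          ≈⟨ +-cong (+-comm _ _) (-‿+-comm _ _) ⟩
      1# + m ×′ 1# - (1# + n ×′ 1#)            ≈⟨ +-cong (1+×′ m 1#) (-‿cong (1+×′ n 1#)) ⟨
      suc m ×′ 1# - suc n ×′ 1#                ∎
      where open ≈-Reasoning

    fromℤ-+ : ∀ i j → fromℤ (i ℤ.+ j) ≈ fromℤ i + fromℤ j
    fromℤ-+ (+ m)    (+ n)    = ×′-homo-+ 1# m n
    fromℤ-+ (+ m)    -[1+ n ] = fromℤ-⊖ m (suc n)
    fromℤ-+ -[1+ m ] (+ n)    = trans (fromℤ-⊖ n (suc m)) (+-comm _ _)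
    fromℤ-+ -[1+ m ] -[1+ n ] = trans
      (-‿cong (trans (reflexive (≡.cong (λ k → suc k ×′ 1#) (≡.sym (ℕ.+-suc m n))))
                     (×′-homo-+ 1# (suc m) (suc n))))
      (sym (-‿+-comm _ _))

    fromℤ-neg : ∀ i → fromℤ (ℤ.- i) ≈ - fromℤ i
    fromℤ-neg (+ zero)  = sym -0#≈0#
    fromℤ-neg (+ suc n) = refl
    fromℤ-neg -[1+ n ]  = sym (-‿involutive _)

    fromℤ-*⁺ : ∀ m n → fromℤ (+ m ℤ.* + n) ≈ fromℤ (+ m) * fromℤ (+ n)
    fromℤ-*⁺ m n = trans (reflexive (≡.cong fromℤ (≡.sym (ℤ.pos-* m n)))) (×′1-homo-* m n)

    fromℤ-*ʳ : ∀ m j → fromℤ (+ m ℤ.* j) ≈ fromℤ (+ m) * fromℤ j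
    fromℤ-*ʳ m (+ n)    = fromℤ-*⁺ m n
    fromℤ-*ʳ m -[1+ n ] = begin
      fromℤ (+ m ℤ.* -[1+ n ])       ≡⟨ ≡.cong fromℤ (ℤ.neg-distribʳ-* (+ m) (+ suc n)) ⟨
      fromℤ (ℤ.- (+ m ℤ.* + suc n))  ≈⟨ fromℤ-neg (+ m ℤ.* + suc n) ⟩
      - fromℤ (+ m ℤ.* + suc n)      ≈⟨ -‿cong (fromℤ-*⁺ m (suc n)) ⟩
      - (fromℤ (+ m) * fromℤ (+ suc n)) ≈⟨ -‿distribʳ-* _ _ ⟩
      fromℤ (+ m) * fromℤ -[1+ n ]   ∎
      where open ≈-Reasoning

    fromℤ-* : ∀ i j → fromℤ (i ℤ.* j) ≈ fromℤ i * fromℤ j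
    fromℤ-* (+ m)    j = fromℤ-*ʳ m j
    fromℤ-* -[1+ m ] j = begin
      fromℤ (-[1+ m ] ℤ.* j)         ≡⟨ ≡.cong fromℤ (ℤ.neg-distribˡ-* (+ suc m) j) ⟨
      fromℤ (ℤ.- (+ suc m ℤ.* j))    ≈⟨ fromℤ-neg (+ suc m ℤ.* j) ⟩
      - fromℤ (+ suc m ℤ.* j)        ≈⟨ -‿cong (fromℤ-*ʳ (suc m) j) ⟩
      - (fromℤ (+ suc m) * fromℤ j)  ≈⟨ -‿distribˡ-* _ _ ⟩
      fromℤ -[1+ m ] * fromℤ j       ∎
      where open ≈-Reasoning

    -- Normalisation has to recognise vanishing coefficients such as 1 - 1; equality of integers
    -- computes, whereas `_≈_` of an abstract field does not.
    fromℤ-morphism : ℤ.+-*-rawRing -Raw-AlmostCommutative⟶ fromCommutativeRing commutativeRing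
    fromℤ-morphism = record
      { ⟦_⟧ = fromℤ ; +-homo = fromℤ-+ ; *-homo = fromℤ-* ; -‿homo = fromℤ-neg
      ; 0-homo = refl ; 1-homo = refl }

    fromℤ-≟ : ∀ i j → Maybe (fromℤ i ≈ fromℤ j)
    fromℤ-≟ i j with i ℤ.≟ j
    ... | yes i≡j = just (reflexive (≡.cong fromℤ i≡j))
    ... | no  _   = nothing

  open RingSolver ℤ.+-*-rawRing (fromCommutativeRing commutativeRing) fromℤ-morphism fromℤ-≟ public
    using (solve; _:=_; _:+_; _:*_; _:-_; :-_; con; Polynomial)

  :0 :1 :2 : ∀ {n} → Polynomial n
  :0 = con (+ 0)
  :1 = con (+ 1)
  :2 = con (+ 2)

  2# : Carrier
  2# = 1# + 1#

  -- Ordered field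

  ≤-poset : Poset _ _ _
  ≤-poset = record { isPartialOrder = DTO.isPartialOrder }

  module ≤-Reasoning = PartialOrderReasoning ≤-poset

  ≤-refl : ∀ {x} → x ≤ x
  ≤-refl = DTO.refl

  ≤-by : ∀ {x y} d → 0# ≤ d → y ≈ x + d → x ≤ y
  ≤-by {x} {y} d 0≤d y≈x+d = begin
    x       ≈⟨ +-identityˡ x ⟨
    0# + x  ≤⟨ +-monoˡ-≤ x 0≤d ⟩
    d + x   ≈⟨ +-comm d x ⟩
    x + d   ≈⟨ y≈x+d ⟨
    y       ∎
    where open ≤-Reasoning

  x≤y⇒0≤y-x : ∀ {x y} → x ≤ y → 0# ≤ y - x
  x≤y⇒0≤y-x {x} {y} x≤y = begin
    0#    ≈⟨ -‿inverseʳ x ⟨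
    x - x ≤⟨ +-monoˡ-≤ (- x) x≤y ⟩
    y - x ∎
    where open ≤-Reasoning

  0≤y-x⇒x≤y : ∀ {x y} → 0# ≤ y - x → x ≤ y
  0≤y-x⇒x≤y {x} {y} p = ≤-by (y - x) p (solve 2 (λ x y → y := x :+ (y :- x)) refl x y)

  +-mono-≤ : ∀ {x y u v} → x ≤ y → u ≤ v → x + u ≤ y + v
  +-mono-≤ {x} {y} {u} {v} x≤y u≤v = begin
    x + u ≤⟨ +-monoˡ-≤ u x≤y ⟩
    y + u ≈⟨ +-comm y u ⟩
    u + y ≤⟨ +-monoˡ-≤ y u≤v ⟩
    v + y ≈⟨ +-comm v y ⟩
    y + v ∎
    where open ≤-Reasoning

  +-monoʳ-≤ : ∀ z {x y} → x ≤ y → z + x ≤ z + y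
  +-monoʳ-≤ z x≤y = +-mono-≤ ≤-refl x≤y

  +-nonNegative : ∀ {x y} → 0# ≤ x → 0# ≤ y → 0# ≤ x + y
  +-nonNegative {x} {y} p q = begin
    0#      ≈⟨ +-identityʳ 0# ⟨
    0# + 0# ≤⟨ +-mono-≤ p q ⟩
    x + y   ∎
    where open ≤-Reasoning

  *-monoʳ-≤ : ∀ {z x y} → 0# ≤ z → x ≤ y → z * x ≤ z * y
  *-monoʳ-≤ {z} {x} {y} 0≤z x≤y = ≤-by (z * (y - x)) (*-nonNegative 0≤z (x≤y⇒0≤y-x x≤y))
    (solve 3 (λ x y z → z :* y := z :* x :+ z :* (y :- x)) refl x y z)

  *-monoˡ-≤ : ∀ {z x y} → 0# ≤ z → x ≤ y → x * z ≤ y * z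
  *-monoˡ-≤ {z} {x} {y} 0≤z x≤y = begin
    x * z ≈⟨ *-comm x z ⟩
    z * x ≤⟨ *-monoʳ-≤ 0≤z x≤y ⟩
    z * y ≈⟨ *-comm z y ⟩
    y * z ∎
    where open ≤-Reasoning

  x≤0⇒0≤-x : ∀ {x} → x ≤ 0# → 0# ≤ - x
  x≤0⇒0≤-x {x} x≤0 = ≤-by (0# - x) (x≤y⇒0≤y-x x≤0) (solve 1 (λ x → :- x := :0 :+ (:0 :- x)) refl x)

  0≤-x⇒x≤0 : ∀ {x} → 0# ≤ - x → x ≤ 0#
  0≤-x⇒x≤0 {x} p = ≤-by (- x) p (solve 1 (λ x → :0 := x :+ :- x) refl x)

  0≤x² : ∀ x → 0# ≤ x * x
  0≤x² x with DTO.total 0# x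
  ... | inj₁ 0≤x = *-nonNegative 0≤x 0≤x
  ... | inj₂ x≤0 = begin
    0#          ≤⟨ *-nonNegative (x≤0⇒0≤-x x≤0) (x≤0⇒0≤-x x≤0) ⟩
    - x * - x   ≈⟨ solve 1 (λ x → :- x :* :- x := x :* x) refl x ⟩
    x * x       ∎
    where open ≤-Reasoning

  ≮⇒≥ : ∀ {x y} → ¬ (x < y) → y ≤ x
  ≮⇒≥ = ToStrict.≮⇒≥ _≈_ _≤_ sym DTO._≟_ DTO.reflexive DTO.total

  ≰⇒> : ∀ {x y} → ¬ (x ≤ y) → y < x
  ≰⇒> = ToStrict.≰⇒> _≈_ _≤_ sym DTO.reflexive DTO.total

  <⇒≱ : ∀ {x y} → x < y → ¬ (y ≤ x)
  <⇒≱ = ToStrict.<⇒≱ _≈_ _≤_ DTO.antisym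

  <-respʳ-≈ : ∀ {x y z} → y ≈ z → x < y → x < z
  <-respʳ-≈ y≈z (x≤y , x≉y) = DTO.trans x≤y (DTO.reflexive y≈z) , λ x≈z → x≉y (trans x≈z (sym y≈z))

  <-≤-trans : ∀ {x y z} → x < y → y ≤ z → x < z
  <-≤-trans {x} {y} {z} p q = begin-strict
    x <⟨ p ⟩
    y ≤⟨ q ⟩
    z ∎
    where open ≤-Reasoning

  0≤1 : 0# ≤ 1#
  0≤1 = DTO.trans (0≤x² 1#) (DTO.reflexive (*-identityˡ 1#))

  0<1 : 0# < 1#
  0<1 = 0≤1 , 0≉1

  0<⇒≉0 : ∀ {x} → 0# < x → ¬ (x ≈ 0#)
  0<⇒≉0 (_ , 0≉x) x≈0 = 0≉x (sym x≈0)

  ⁻¹-inverseˡ : ∀ x → ¬ (x ≈ 0#) → x ⁻¹ * x ≈ 1#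
  ⁻¹-inverseˡ x x≉0 = trans (*-comm _ _) (⁻¹-inverseʳ x x≉0)

  *-cancelˡ-≈ : ∀ {z x y} → ¬ (z ≈ 0#) → z * x ≈ z * y → x ≈ y
  *-cancelˡ-≈ {z} {x} {y} z≉0 eq = begin
    x               ≈⟨ *-identityˡ x ⟨
    1# * x          ≈⟨ *-congʳ (⁻¹-inverseˡ z z≉0) ⟨
    z ⁻¹ * z * x    ≈⟨ *-assoc _ _ _ ⟩
    z ⁻¹ * (z * x)  ≈⟨ *-congˡ eq ⟩
    z ⁻¹ * (z * y)  ≈⟨ *-assoc _ _ _ ⟨
    z ⁻¹ * z * y    ≈⟨ *-congʳ (⁻¹-inverseˡ z z≉0) ⟩
    1# * y          ≈⟨ *-identityˡ y ⟩
    y               ∎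
    where open ≈-Reasoning

  xy≈0⇒y≈0 : ∀ {x y} → ¬ (x ≈ 0#) → x * y ≈ 0# → y ≈ 0#
  xy≈0⇒y≈0 {x} x≉0 eq = *-cancelˡ-≈ x≉0 (trans eq (sym (zeroʳ x)))

  *-≉0 : ∀ {x y} → ¬ (x ≈ 0#) → ¬ (y ≈ 0#) → ¬ (x * y ≈ 0#)
  *-≉0 x≉0 y≉0 eq = y≉0 (xy≈0⇒y≈0 x≉0 eq)

  x²≈0⇒x≈0 : ∀ {x} → x * x ≈ 0# → x ≈ 0#
  x²≈0⇒x≈0 {x} eq with x ≟ 0#
  ... | yes x≈0 = x≈0
  ... | no  x≉0 = xy≈0⇒y≈0 x≉0 eq

  *-positive : ∀ {x y} → 0# < x → 0# < y → 0# < x * y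
  *-positive p@(0≤x , _) q@(0≤y , _) = *-nonNegative 0≤x 0≤y , λ eq → *-≉0 (0<⇒≉0 p) (0<⇒≉0 q) (sym eq)

  +-positive : ∀ {x y} → 0# < x → 0# ≤ y → 0# < x + y
  +-positive {x} {y} 0<x 0≤y = <-≤-trans 0<x (≤-by y 0≤y refl)

  x<y⇒0<y-x : ∀ {x y} → x < y → 0# < y - x
  x<y⇒0<y-x {x} {y} (x≤y , x≉y) = x≤y⇒0≤y-x x≤y , λ eq → x≉y (begin
    x           ≈⟨ +-identityʳ x ⟨
    x + 0#      ≈⟨ +-congˡ eq ⟩
    x + (y - x) ≈⟨ solve 2 (λ x y → x :+ (y :- x) := y) refl x y ⟩
    y           ∎)
    where open ≈-Reasoning

  0<y-x⇒x<y : ∀ {x y} → 0# < y - x → x < y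
  0<y-x⇒x<y {x} {y} (0≤y-x , 0≉) = 0≤y-x⇒x≤y 0≤y-x ,
    λ x≈y → 0≉ (sym (trans (+-congˡ (-‿cong x≈y)) (-‿inverseʳ y)))

  x<0⇒0<-x : ∀ {x} → x < 0# → 0# < - x
  x<0⇒0<-x {x} x<0 = <-respʳ-≈ (+-identityˡ (- x)) (x<y⇒0<y-x x<0)

  0<-x⇒x<0 : ∀ {x} → 0# < - x → x < 0#
  0<-x⇒x<0 {x} p = 0<y-x⇒x<y (<-respʳ-≈ (sym (+-identityˡ (- x))) p)

  ⁻¹-positive : ∀ {x} → 0# < x → 0# < x ⁻¹
  ⁻¹-positive {x} 0<x = ≰⇒> λ x⁻¹≤0 → <⇒≱ 0<1 $ begin
    1#         ≈⟨ ⁻¹-inverseʳ x (0<⇒≉0 0<x) ⟨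
    x * x ⁻¹   ≤⟨ *-monoʳ-≤ (proj₁ 0<x) x⁻¹≤0 ⟩
    x * 0#     ≈⟨ zeroʳ x ⟩
    0#         ∎
    where open ≤-Reasoning

  ⁻¹-unique : ∀ {x y} → x * y ≈ 1# → x ⁻¹ ≈ y
  ⁻¹-unique {x} {y} xy≈1 = *-cancelˡ-≈ x≉0 (trans (⁻¹-inverseʳ x x≉0) (sym xy≈1))
    where
    x≉0 : ¬ (x ≈ 0#)
    x≉0 x≈0 = 0≉1 (trans (sym (zeroˡ y)) (trans (*-congʳ (sym x≈0)) xy≈1))

  *-cancelˡ-≤ : ∀ {z x y} → 0# < z → z * x ≤ z * y → x ≤ y
  *-cancelˡ-≤ {z} {x} {y} 0<z p = begin
    x               ≈⟨ *-identityˡ x ⟨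
    1# * x          ≈⟨ *-congʳ (⁻¹-inverseˡ z z≉0) ⟨
    z ⁻¹ * z * x    ≈⟨ *-assoc _ _ _ ⟩
    z ⁻¹ * (z * x)  ≤⟨ *-monoʳ-≤ (proj₁ (⁻¹-positive 0<z)) p ⟩
    z ⁻¹ * (z * y)  ≈⟨ *-assoc _ _ _ ⟨
    z ⁻¹ * z * y    ≈⟨ *-congʳ (⁻¹-inverseˡ z z≉0) ⟩
    1# * y          ≈⟨ *-identityˡ y ⟩
    y               ∎
    where
    open ≤-Reasoning
    z≉0 = 0<⇒≉0 0<z

  x≤y⇒x²≤y² : ∀ {x y} → 0# ≤ x → x ≤ y → x * x ≤ y * y
  x≤y⇒x²≤y² 0≤x x≤y = DTO.trans (*-monoʳ-≤ 0≤x x≤y) (*-monoˡ-≤ (DTO.trans 0≤x x≤y) x≤y)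

  x²≤y²⇒x≤y : ∀ {x y} → 0# ≤ y → x * x ≤ y * y → x ≤ y
  x²≤y²⇒x≤y {x} {y} 0≤y x²≤y² with x ≤? y
  ... | yes x≤y = x≤y
  ... | no  x≰y = contradiction x²≤y² (<⇒≱ y²<x²)
    where
    y<x = ≰⇒> x≰y
    y²<x² : y * y < x * x
    y²<x² = 0<y-x⇒x<y (<-respʳ-≈ (solve 2 (λ x y → (x :- y) :* ((x :- y) :+ (y :+ y)) := x :* x :- y :* y) refl x y)
      (*-positive (x<y⇒0<y-x y<x) (+-positive (x<y⇒0<y-x y<x) (+-nonNegative 0≤y 0≤y))))

  x²≈y²⇒x≈y : ∀ {x y} → 0# ≤ x → 0# ≤ y → x * x ≈ y * y → x ≈ y
  x²≈y²⇒x≈y 0≤x 0≤y eq = DTO.antisym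
    (x²≤y²⇒x≤y 0≤y (DTO.reflexive eq)) (x²≤y²⇒x≤y 0≤x (DTO.reflexive (sym eq)))

  0<2 : 0# < 2#
  0<2 = +-positive 0<1 0≤1

  fromℕ-nonNegative : ∀ n → 0# ≤ fromℕ n
  fromℕ-nonNegative zero    = ≤-refl
  fromℕ-nonNegative (suc n) = +-nonNegative 0≤1 (fromℕ-nonNegative n)

  fromℕ-positive : ∀ n .{{_ : ℕ.NonZero n}} → 0# < fromℕ n
  fromℕ-positive (suc n) = +-positive 0<1 (fromℕ-nonNegative n)

  -- `s` is the supremum of the y with y² ≤ x. If s² fell short of x, some s + ε would still lie in
  -- the set; if it exceeded x, some s - ε would still be an upper bound. Both times ε is the gap δ
  -- divided by a `k` large enough to absorb the terms of the expanded square. Square roots serve to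
  -- normalise eigenvectors.
  ∃-sqrt : ∀ x → 0# ≤ x → ∃ λ s → 0# ≤ s × s * s ≈ x
  ∃-sqrt x 0≤x = s , 0≤s , DTO.antisym s²≤x x≤s²
    where
    P : Carrier → Set
    P y = y * y ≤ x

    bound : UpperBound P (x + 1#)
    bound y y²≤x = x²≤y²⇒x≤y (+-nonNegative 0≤x 0≤1)
      (≤-by (x * x + x + 1# + (x - y * y))
        (+-nonNegative (+-nonNegative (+-nonNegative (0≤x² x) 0≤x) 0≤1) (x≤y⇒0≤y-x y²≤x))
        (solve 2 (λ x y → (x :+ :1) :* (x :+ :1) := y :* y :+ (x :* x :+ x :+ :1 :+ (x :- y :* y))) refl x y))

    sup = supremum P (0# , DTO.trans (DTO.reflexive (zeroˡ 0#)) 0≤x) (x + 1# , bound)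
    s = proj₁ sup
    s-upper = proj₁ (proj₂ sup)
    s-least = proj₂ (proj₂ sup)

    0≤s : 0# ≤ s
    0≤s = s-upper 0# (DTO.trans (DTO.reflexive (zeroˡ 0#)) 0≤x)

    x≤s² : x ≤ s * s
    x≤s² = ≮⇒≥ λ s²<x →
      let δ = x - s * s
          0<δ = x<y⇒0<y-x s²<x
          k = s + s + 1# + δ
          0<k = <-respʳ-≈ (solve 2 (λ s δ → :1 :+ (s :+ s :+ δ) := s :+ s :+ :1 :+ δ) refl s δ)
                  (+-positive 0<1 (+-nonNegative (+-nonNegative 0≤s 0≤s) (proj₁ 0<δ)))
          ι = k ⁻¹
          0<ι = ⁻¹-positive 0<k
          kι≈1 = ⁻¹-inverseʳ k (0<⇒≉0 0<k)
          ε = δ * ι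
          0<ε = *-positive 0<δ 0<ι
          -- k ι = 1 turns δ into k ε, and x - (s + ε)² into ε (1 + δ - ε), where ε ≤ 1
          1-ε : 1# - ε ≈ ι * (s + s + 1#)
          1-ε = trans (+-congʳ (sym kι≈1)) (solve 3 (λ s δ ι →
            (s :+ s :+ :1 :+ δ) :* ι :- δ :* ι := ι :* (s :+ s :+ :1)) refl s δ ι)
          0≤1-ε : 0# ≤ 1# - ε
          0≤1-ε = DTO.trans (*-nonNegative (proj₁ 0<ι) (+-nonNegative (+-nonNegative 0≤s 0≤s) 0≤1))
                            (DTO.reflexive (sym 1-ε))
          δ≈kε : δ ≈ k * ε
          δ≈kε = begin
            δ            ≈⟨ *-identityʳ δ ⟨
            δ * 1#       ≈⟨ *-congˡ kι≈1 ⟨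
            δ * (k * ι)  ≈⟨ solve 3 (λ δ k ι → δ :* (k :* ι) := k :* (δ :* ι)) refl δ k ι ⟩
            k * ε        ∎
          s+ε∈P : (s + ε) * (s + ε) ≤ x
          s+ε∈P = ≤-by (ε * (δ + (1# - ε))) (*-nonNegative (proj₁ 0<ε) (+-nonNegative (proj₁ 0<δ) 0≤1-ε)) (begin
            x                              ≈⟨ solve 2 (λ x s → x := s :* s :+ (x :- s :* s)) refl x s ⟩
            s * s + δ                      ≈⟨ +-congˡ δ≈kε ⟩
            s * s + k * ε                  ≈⟨ solve 3 (λ s δ ε → s :* s :+ (s :+ s :+ :1 :+ δ) :* ε :=
                                                (s :+ ε) :* (s :+ ε) :+ ε :* (δ :+ (:1 :- ε))) refl s δ ε ⟩
            (s + ε) * (s + ε) + ε * (δ + (1# - ε)) ∎)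
      in <⇒≱ (0<y-x⇒x<y (<-respʳ-≈ (solve 2 (λ s ε → ε := s :+ ε :- s) refl s ε) 0<ε)) (s-upper (s + ε) s+ε∈P)
      where open ≈-Reasoning

    s²≤x : s * s ≤ x
    s²≤x = ≮⇒≥ λ x<s² →
      let δ = s * s - x
          0<δ = x<y⇒0<y-x x<s²
          -- Now (s - ε)² = x + δ - 2 s ε + ε², and δ = k ε leaves x + ε + ε². Writing s as s k ι
          -- shows s - ε = ι (s² + s + x), which is nonnegative.
          k = s + s + 1#
          0<k = <-respʳ-≈ (+-comm _ _) (+-positive 0<1 (+-nonNegative 0≤s 0≤s))
          ι = k ⁻¹
          0<ι = ⁻¹-positive 0<k
          kι≈1 = ⁻¹-inverseʳ k (0<⇒≉0 0<k)
          ε = δ * ι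
          0<ε = *-positive 0<δ 0<ι
          s-ε : s - ε ≈ ι * (s * s + s + x)
          s-ε = begin
            s - ε              ≈⟨ +-congʳ (*-identityʳ s) ⟨
            s * 1# - ε         ≈⟨ +-congʳ (*-congˡ kι≈1) ⟨
            s * (k * ι) - ε    ≈⟨ solve 3 (λ s x ι → s :* ((s :+ s :+ :1) :* ι) :- (s :* s :- x) :* ι
                                    := ι :* (s :* s :+ s :+ x)) refl s x ι ⟩
            ι * (s * s + s + x) ∎
          0≤s-ε : 0# ≤ s - ε
          0≤s-ε = DTO.trans (*-nonNegative (proj₁ 0<ι) (+-nonNegative (+-nonNegative (0≤x² s) 0≤s) 0≤x))
                            (DTO.reflexive (sym s-ε))
          δ≈kε : δ ≈ k * ε
          δ≈kε = begin
            δ            ≈⟨ *-identityʳ δ ⟨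
            δ * 1#       ≈⟨ *-congˡ kι≈1 ⟨
            δ * (k * ι)  ≈⟨ solve 3 (λ δ k ι → δ :* (k :* ι) := k :* (δ :* ι)) refl δ k ι ⟩
            k * ε        ∎
          x≤[s-ε]² : x ≤ (s - ε) * (s - ε)
          x≤[s-ε]² = ≤-by (ε + ε * ε) (+-nonNegative (proj₁ 0<ε) (0≤x² ε)) (begin
            (s - ε) * (s - ε)              ≈⟨ solve 3 (λ s ε x → (s :- ε) :* (s :- ε) :=
                                                x :+ (s :* s :- x) :- (s :+ s :+ :1) :* ε :+ (ε :+ ε :* ε)) refl s ε x ⟩
            x + δ - k * ε + (ε + ε * ε)    ≈⟨ +-congʳ (+-congʳ (+-congˡ δ≈kε)) ⟩
            x + k * ε - k * ε + (ε + ε * ε) ≈⟨ solve 4 (λ x k ε r → x :+ k :* ε :- k :* ε :+ r := x :+ r) refl x k ε _ ⟩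
            x + (ε + ε * ε)                ∎)
      in <⇒≱ (0<y-x⇒x<y (<-respʳ-≈ (solve 2 (λ s ε → ε := s :- (s :- ε)) refl s ε) 0<ε))
             (s-least (s - ε) λ y y²≤x → x²≤y²⇒x≤y 0≤s-ε (DTO.trans y²≤x x≤[s-ε]²))
      where open ≈-Reasoning

  -- Vectors, finite sums and dot products

  infix 4 _≈ᵛ_ _≈ᴹ_

  _≈ᵛ_ : ∀ {n} → Vector Carrier n → Vector Carrier n → Set
  u ≈ᵛ v = ∀ i → u i ≈ v i

  _≈ᴹ_ : ∀ {m n} → Vector (Vector Carrier m) n → Vector (Vector Carrier m) n → Set
  A ≈ᴹ B = ∀ i → A i ≈ᵛ B i

  sum-≈0 : ∀ {n} {f : Vector Carrier n} → (∀ i → f i ≈ 0#) → sum f ≈ 0#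
  sum-≈0 {zero}  f≈0 = refl
  sum-≈0 {suc n} f≈0 = trans (+-cong (f≈0 zero) (sum-≈0 (f≈0 ∘ suc))) (+-identityˡ 0#)

  sum-neg : ∀ {n} (f : Vector Carrier n) → sum (λ i → - f i) ≈ - sum f
  sum-neg {zero}  f = sym -0#≈0#
  sum-neg {suc n} f = trans (+-congˡ (sum-neg (f ∘ suc))) (-‿+-comm _ _)

  sum-mono-≤ : ∀ {n} {f g : Vector Carrier n} → (∀ i → f i ≤ g i) → sum f ≤ sum g
  sum-mono-≤ {zero}  f≤g = ≤-refl
  sum-mono-≤ {suc n} f≤g = +-mono-≤ (f≤g zero) (sum-mono-≤ (f≤g ∘ suc))

  sum-nonNegative : ∀ {n} {f : Vector Carrier n} → (∀ i → 0# ≤ f i) → 0# ≤ sum f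
  sum-nonNegative {zero}  0≤f = ≤-refl
  sum-nonNegative {suc n} 0≤f = +-nonNegative (0≤f zero) (sum-nonNegative (0≤f ∘ suc))

  term≤sum : ∀ {n} {f : Vector Carrier n} → (∀ i → 0# ≤ f i) → ∀ i → f i ≤ sum f
  term≤sum {f = f} 0≤f zero    = ≤-by _ (sum-nonNegative (0≤f ∘ suc)) refl
  term≤sum {f = f} 0≤f (suc i) = DTO.trans (term≤sum (0≤f ∘ suc) i) (≤-by (f zero) (0≤f zero) (+-comm _ _))

  identity-sum : ∀ {n} (i : Fin n) (f : Vector Carrier n) → sum (λ j → identity i j * f j) ≈ f i
  identity-sum zero    f = trans (+-cong (*-identityˡ _) (sum-≈0 (λ j → zeroˡ (f (suc j))))) (+-identityʳ _)
  identity-sum (suc i) f = trans (+-cong (zeroˡ _) (identity-sum i (f ∘ suc))) (+-identityˡ _)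

  identity-sym : ∀ {n} (i j : Fin n) → identity i j ≈ identity j i
  identity-sym zero    zero    = refl
  identity-sym zero    (suc j) = refl
  identity-sym (suc i) zero    = refl
  identity-sym (suc i) (suc j) = identity-sym i j

  infixl 7 _∙_ _*ᵛ_

  _∙_ : ∀ {n} → Vector Carrier n → Vector Carrier n → Carrier
  u ∙ v = sum λ i → u i * v i

  infixl 6 _+ᵛ_

  _+ᵛ_ : ∀ {n} → Vector Carrier n → Vector Carrier n → Vector Carrier n
  (u +ᵛ v) i = u i + v i

  _*ᵛ_ : ∀ {n} → Carrier → Vector Carrier n → Vector Carrier n
  (c *ᵛ v) i = c * v i

  0ᵛ : ∀ {n} → Vector Carrier n
  0ᵛ _ = 0#

  ∙-cong : ∀ {n} {u u′ v v′ : Vector Carrier n} → u ≈ᵛ u′ → v ≈ᵛ v′ → u ∙ v ≈ u′ ∙ v′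
  ∙-cong p q = sum-cong-≋ λ i → *-cong (p i) (q i)

  ∙-comm : ∀ {n} (u v : Vector Carrier n) → u ∙ v ≈ v ∙ u
  ∙-comm u v = sum-cong-≋ λ i → *-comm (u i) (v i)

  ∙-distribˡ : ∀ {n} (u v w : Vector Carrier n) → u ∙ (v +ᵛ w) ≈ u ∙ v + u ∙ w
  ∙-distribˡ u v w = trans (sum-cong-≋ λ i → distribˡ (u i) (v i) (w i)) (∑-distrib-+ (λ i → u i * v i) (λ i → u i * w i))

  ∙-distribʳ : ∀ {n} (u v w : Vector Carrier n) → (v +ᵛ w) ∙ u ≈ v ∙ u + w ∙ u
  ∙-distribʳ u v w = trans (sum-cong-≋ λ i → distribʳ (u i) (v i) (w i)) (∑-distrib-+ (λ i → v i * u i) (λ i → w i * u i))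

  ∙-*ˡ : ∀ {n} c (u v : Vector Carrier n) → (c *ᵛ u) ∙ v ≈ c * (u ∙ v)
  ∙-*ˡ c u v = trans (sum-cong-≋ λ i → *-assoc c (u i) (v i)) (sym (*-distribˡ-sum c (λ i → u i * v i)))

  ∙-*ʳ : ∀ {n} c (u v : Vector Carrier n) → u ∙ (c *ᵛ v) ≈ c * (u ∙ v)
  ∙-*ʳ c u v = trans (∙-comm u _) (trans (∙-*ˡ c v u) (*-congˡ (∙-comm v u)))

  ∙-zeroˡ : ∀ {n} {u : Vector Carrier n} v → u ≈ᵛ 0ᵛ → u ∙ v ≈ 0#
  ∙-zeroˡ v u≈0 = sum-≈0 λ i → trans (*-congʳ (u≈0 i)) (zeroˡ (v i))

  ∙-nonNegative : ∀ {n} (v : Vector Carrier n) → 0# ≤ v ∙ v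
  ∙-nonNegative v = sum-nonNegative λ i → 0≤x² (v i)

  ∙≈0⇒≈0 : ∀ {n} {v : Vector Carrier n} → v ∙ v ≈ 0# → v ≈ᵛ 0ᵛ
  ∙≈0⇒≈0 {v = v} eq i = x²≈0⇒x≈0 (DTO.antisym
    (DTO.trans (term≤sum (λ j → 0≤x² (v j)) i) (DTO.reflexive eq)) (0≤x² (v i)))

  ∙-positive : ∀ {n} {v : Vector Carrier n} → ¬ (v ≈ᵛ 0ᵛ) → 0# < v ∙ v
  ∙-positive {v = v} v≉0 = ∙-nonNegative v , λ eq → v≉0 (∙≈0⇒≈0 (sym eq))

  ≈0? : ∀ {n} (v : Vector Carrier n) → v ≈ᵛ 0ᵛ ⊎ (∃ λ i → ¬ (v i ≈ 0#))
  ≈0? {zero}  v = inj₁ λ ()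
  ≈0? {suc n} v with v zero ≟ 0#
  ... | no  v₀≉0 = inj₂ (zero , v₀≉0)
  ... | yes v₀≈0 with ≈0? (v ∘ suc)
  ...   | inj₁ p       = inj₁ λ { zero → v₀≈0 ; (suc i) → p i }
  ...   | inj₂ (i , q) = inj₂ (suc i , q)

  -- Matrices

  *ᴹ-cong : ∀ {n} {A A′ B B′ : Matrix n} → A ≈ᴹ A′ → B ≈ᴹ B′ → A *ᴹ B ≈ᴹ A′ *ᴹ B′
  *ᴹ-cong p q i j = sum-cong-≋ λ k → *-cong (p i k) (q k j)

  *ᴹ-assoc : ∀ {n} (A B C : Matrix n) → (A *ᴹ B) *ᴹ C ≈ᴹ A *ᴹ (B *ᴹ C)
  *ᴹ-assoc A B C i j = begin
    sum (λ k → sum (λ l → A i l * B l k) * C k j)    ≈⟨ (sum-cong-≋ λ k → *-distribʳ-sum (C k j) (λ l → A i l * B l k)) ⟩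
    sum (λ k → sum (λ l → A i l * B l k * C k j))    ≈⟨ ∑-comm (λ k l → A i l * B l k * C k j) ⟩
    sum (λ l → sum (λ k → A i l * B l k * C k j))    ≈⟨ (sum-cong-≋ λ l → sum-cong-≋ λ k → *-assoc (A i l) (B l k) (C k j)) ⟩
    sum (λ l → sum (λ k → A i l * (B l k * C k j)))  ≈⟨ (sum-cong-≋ λ l → sym (*-distribˡ-sum (A i l) (λ k → B l k * C k j))) ⟩
    sum (λ l → A i l * sum (λ k → B l k * C k j))    ∎
    where open ≈-Reasoning

  *ᴹ-identityˡ : ∀ {n} (A : Matrix n) → identity *ᴹ A ≈ᴹ A
  *ᴹ-identityˡ A i j = identity-sum i (λ k → A k j)

  *ᴹ-identityʳ : ∀ {n} (A : Matrix n) → A *ᴹ identity ≈ᴹ A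
  *ᴹ-identityʳ A i j = trans (sum-cong-≋ λ k → trans (*-comm _ _) (*-congʳ (identity-sym k j))) (identity-sum j (A i))

  transpose-*ᴹ : ∀ {n} (A B : Matrix n) → transpose (A *ᴹ B) ≈ᴹ transpose B *ᴹ transpose A
  transpose-*ᴹ A B i j = sum-cong-≋ λ k → *-comm (A j k) (B k i)

  diagonal : ∀ {n} → Vector Carrier n → Matrix n
  diagonal d i j = d i * identity i j

  infixr 7 _·_

  _·_ : ∀ {n} → Matrix n → Vector Carrier n → Vector Carrier n
  (A · x) i = A i ∙ x

  -- Determinants

  Rows : ℕ → ℕ → Set
  Rows m n = Vector (Vector Carrier m) n

  Congruent : ∀ {m n} → (Rows m n → Carrier) → Set
  Congruent F = ∀ {A B} → A ≈ᴹ B → F A ≈ F B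

  record Linear {m} (f : Vector Carrier m → Carrier) : Set where
    field
      +-homo : ∀ u v → f (u +ᵛ v) ≈ f u + f v
      *-homo : ∀ c u → f (c *ᵛ u) ≈ c * f u

  -- Vanishing is required only when the first two of the remaining rows are equal; this recursive
  -- form of alternation suffices and makes every closure property a structural induction.
  data Alternating {m} : ∀ n → (Rows m n → Carrier) → Set where
    alt₀ : ∀ {F} → Alternating zero F
    alt₁ : ∀ {F} → (∀ R → Linear (λ u → F (u ∷ R))) → Alternating (suc zero) F
    alt₂ : ∀ {n F} → (∀ R → Linear (λ u → F (u ∷ R))) →
           (∀ u R → F (u ∷ u ∷ R) ≈ 0#) →
           (∀ u → Alternating (suc n) (λ R → F (u ∷ R))) → Alternating (suc (suc n)) F

  linear₀ : ∀ {m n} {F : Rows m (suc n) → Carrier} → Alternating (suc n) F →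
            ∀ R → Linear (λ u → F (u ∷ R))
  linear₀ (alt₁ lin)     = lin
  linear₀ (alt₂ lin _ _) = lin

  equal₀₁ : ∀ {m n} {F : Rows m (suc (suc n)) → Carrier} → Alternating (suc (suc n)) F →
            ∀ u R → F (u ∷ u ∷ R) ≈ 0#
  equal₀₁ (alt₂ _ eq _) = eq

  alternating-tail : ∀ {m n} {F : Rows m (suc n) → Carrier} → Alternating (suc n) F →
                     ∀ u → Alternating n (λ R → F (u ∷ R))
  alternating-tail (alt₁ _)       u = alt₀
  alternating-tail (alt₂ _ _ alt) u = alt u

  linear-resp : ∀ {m} {f g : Vector Carrier m → Carrier} → (∀ u → f u ≈ g u) → Linear f → Linear g
  linear-resp f≈g lin = record
    { +-homo = λ u v → trans (sym (f≈g _)) (trans (+-homo u v) (+-cong (f≈g u) (f≈g v)))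
    ; *-homo = λ c u → trans (sym (f≈g _)) (trans (*-homo c u) (*-congˡ (f≈g u)))
    } where open Linear lin

  alternating-resp : ∀ {m n} {F G : Rows m n → Carrier} → (∀ A → F A ≈ G A) →
                     Alternating n F → Alternating n G
  alternating-resp F≈G alt₀       = alt₀
  alternating-resp F≈G (alt₁ lin) = alt₁ λ R → linear-resp (λ u → F≈G (u ∷ R)) (lin R)
  alternating-resp F≈G (alt₂ lin eq alt) = alt₂
    (λ R → linear-resp (λ u → F≈G (u ∷ R)) (lin R))
    (λ u R → trans (sym (F≈G _)) (eq u R))
    (λ u → alternating-resp (λ R → F≈G (u ∷ R)) (alt u))

  linear-combination : ∀ {m k} (c : Vector Carrier k) {f : Fin k → Vector Carrier m → Carrier} →
                       (∀ j → Linear (f j)) → Linear (λ u → sum λ j → c j * f j u)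
  linear-combination c {f} lin = record
    { +-homo = λ u v → trans
        (sum-cong-≋ λ j → trans (*-congˡ (Linear.+-homo (lin j) u v)) (distribˡ (c j) _ _)) (∑-distrib-+ (λ j → c j * f j u) (λ j → c j * f j v))
    ; *-homo = λ d u → trans
        (sum-cong-≋ λ j → trans (*-congˡ (Linear.*-homo (lin j) d u))
          (solve 3 (λ c d x → c :* (d :* x) := d :* (c :* x)) refl (c j) d (f j u)))
        (sym (*-distribˡ-sum d (λ j → c j * f j u)))
    }

  alternating-combination : ∀ {m k} n (c : Vector Carrier k) {F : Fin k → Rows m n → Carrier} →
                            (∀ j → Alternating n (F j)) → Alternating n (λ A → sum λ j → c j * F j A)
  alternating-combination zero          c alt = alt₀
  alternating-combination (suc zero)    c alt = alt₁ λ R → linear-combination c (λ j → linear₀ (alt j) R)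
  alternating-combination (suc (suc n)) c {F} alt = alt₂
    (λ R → linear-combination c (λ j → linear₀ (alt j) R))
    (λ u R → sum-≈0 λ j → trans (*-congˡ (equal₀₁ (alt j) u R)) (zeroʳ (c j)))
    (λ u → alternating-combination (suc n) c (λ j → alternating-tail (alt j) u))

  record LinearMap {m m′} (L : Vector Carrier m → Vector Carrier m′) : Set where
    field
      ⟦⟧-cong : ∀ {u v} → u ≈ᵛ v → L u ≈ᵛ L v
      +-homo  : ∀ u v → L (u +ᵛ v) ≈ᵛ L u +ᵛ L v
      *-homo  : ∀ c u → L (c *ᵛ u) ≈ᵛ c *ᵛ L u

  ∷-congʰ : ∀ {m n} {u v : Vector Carrier m} {R : Rows m n} → u ≈ᵛ v → u ∷ R ≈ᴹ v ∷ R
  ∷-congʰ p zero    = p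
  ∷-congʰ p (suc i) = λ _ → refl

  ∷-congᵗ : ∀ {m n} {u : Vector Carrier m} {R S : Rows m n} → R ≈ᴹ S → u ∷ R ≈ᴹ u ∷ S
  ∷-congᵗ p zero    = λ _ → refl
  ∷-congᵗ p (suc i) = p i

  map-∷ : ∀ {m m′ n} (L : Vector Carrier m → Vector Carrier m′) u (R : Rows m n) →
          L u ∷ L ∘ R ≈ᴹ L ∘ (u ∷ R)
  map-∷ L u R zero    = λ _ → refl
  map-∷ L u R (suc i) = λ _ → refl

  module _ {m m′} {L : Vector Carrier m → Vector Carrier m′} (lin : LinearMap L) where
    open LinearMap lin

    linear-∘ : ∀ {n} {F : Rows m′ (suc n) → Carrier} → Congruent F →
               (∀ R → Linear (λ u → F (u ∷ R))) → ∀ R → Linear (λ u → F (L ∘ (u ∷ R)))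
    linear-∘ {F = F} cong linF R = linear-resp (λ u → cong (map-∷ L u R)) (record
      { +-homo = λ u v → trans (cong (∷-congʰ (+-homo u v))) (Linear.+-homo (linF _) _ _)
      ; *-homo = λ c u → trans (cong (∷-congʰ (*-homo c u))) (Linear.*-homo (linF _) _ _)
      })

    alternating-∘ : ∀ {n} {F : Rows m′ n → Carrier} → Congruent F →
                    Alternating n F → Alternating n (λ A → F (L ∘ A))
    alternating-∘ cong alt₀       = alt₀
    alternating-∘ cong (alt₁ lin) = alt₁ (linear-∘ cong lin)
    alternating-∘ {F = F} cong (alt₂ linF eq alt) = alt₂
      (linear-∘ cong linF)
      (λ u R → trans (cong λ { zero i → refl ; (suc zero) i → refl ; (suc (suc j)) i → refl }) (eq (L u) (L ∘ R)))
      (λ u → alternating-resp (λ R → cong (map-∷ L u R))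
               (alternating-∘ (λ p → cong (∷-congᵗ p)) (alt (L u))))

  module _ {m n} {F : Rows m (suc (suc n)) → Carrier} (alt : Alternating (suc (suc n)) F) where
    open ≈-Reasoning
    private
      module L₀ R = Linear (linear₀ alt R)
      module L₁ u R = Linear (linear₀ (alternating-tail alt u) R)
      equal : ∀ u R → F (u ∷ u ∷ R) ≈ 0#
      equal = equal₀₁ alt

    -- Polarisation: expand F at the two equal rows u + v, where it vanishes.
    alternating-swap : ∀ u v R → F (u ∷ v ∷ R) ≈ - F (v ∷ u ∷ R)
    alternating-swap u v R = begin
      F (u ∷ v ∷ R)                              ≈⟨ solve 2 (λ x y → x := (:0 :+ x) :+ (y :+ :0) :- y) refl _ (F (v ∷ u ∷ R)) ⟩
      (0# + F (u ∷ v ∷ R)) + (F (v ∷ u ∷ R) + 0#) - F (v ∷ u ∷ R)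
                                                 ≈⟨ +-congʳ (+-cong (+-congʳ (equal u R)) (+-congˡ (equal v R))) ⟨
      (F (u ∷ u ∷ R) + F (u ∷ v ∷ R)) + (F (v ∷ u ∷ R) + F (v ∷ v ∷ R)) - F (v ∷ u ∷ R)
                                                 ≈⟨ +-congʳ (+-cong (L₁.+-homo u R u v) (L₁.+-homo v R u v)) ⟨
      F (u ∷ u +ᵛ v ∷ R) + F (v ∷ u +ᵛ v ∷ R) - F (v ∷ u ∷ R)
                                                 ≈⟨ +-congʳ (L₀.+-homo (u +ᵛ v ∷ R) u v) ⟨
      F (u +ᵛ v ∷ u +ᵛ v ∷ R) - F (v ∷ u ∷ R)    ≈⟨ +-congʳ (equal (u +ᵛ v) R) ⟩
      0# - F (v ∷ u ∷ R)                         ≈⟨ +-identityˡ _ ⟩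
      - F (v ∷ u ∷ R)                            ∎

  ∷-η : ∀ {m n} (A : Rows m (suc n)) → A zero ∷ A ∘ suc ≈ᴹ A
  ∷-η A zero    = λ _ → refl
  ∷-η A (suc i) = λ _ → refl

  -- Vanishing is available only for the first two rows. So the multiple of `u` is removed from the
  -- row next to it, and `u` is swapped past that row to deal with the rest; a second swap restores
  -- the sign.
  alternating-rowOp : ∀ {m} n {F : Rows m (suc n) → Carrier} → Congruent F → Alternating (suc n) F →
                      ∀ u R (c : Vector Carrier n) → F (u ∷ (λ i → R i +ᵛ c i *ᵛ u)) ≈ F (u ∷ R)
  alternating-rowOp zero    cong alt u R c = cong (∷-congᵗ λ ())
  alternating-rowOp (suc n) {F} cong alt u R c = begin
    F (u ∷ (λ i → R i +ᵛ c i *ᵛ u))            ≈⟨ cong (∷-congᵗ (λ i j → sym (∷-η (λ i → R i +ᵛ c i *ᵛ u) i j))) ⟩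
    F (u ∷ R₀ +ᵛ c₀ *ᵛ u ∷ S′)                 ≈⟨ Linear.+-homo (L₁ S′) R₀ (c₀ *ᵛ u) ⟩
    F (u ∷ R₀ ∷ S′) + F (u ∷ c₀ *ᵛ u ∷ S′)     ≈⟨ +-congˡ (Linear.*-homo (L₁ S′) c₀ u) ⟩
    F (u ∷ R₀ ∷ S′) + c₀ * F (u ∷ u ∷ S′)      ≈⟨ +-congˡ (trans (*-congˡ (equal₀₁ alt u S′)) (zeroʳ c₀)) ⟩
    F (u ∷ R₀ ∷ S′) + 0#                       ≈⟨ +-identityʳ _ ⟩
    F (u ∷ R₀ ∷ S′)                            ≈⟨ alternating-swap alt u R₀ S′ ⟩
    - F (R₀ ∷ u ∷ S′)                          ≈⟨ -‿cong (alternating-rowOp n (λ p → cong (∷-congᵗ p))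
                                                   (alternating-tail alt R₀) u (R ∘ suc) (c ∘ suc)) ⟩
    - F (R₀ ∷ u ∷ R ∘ suc)                     ≈⟨ alternating-swap alt u R₀ (R ∘ suc) ⟨
    F (u ∷ R₀ ∷ R ∘ suc)                       ≈⟨ cong (∷-congᵗ (∷-η R)) ⟩
    F (u ∷ R)                                  ∎
    where
    open ≈-Reasoning
    R₀ = R zero
    c₀ = c zero
    S′ = λ i → R (suc i) +ᵛ c (suc i) *ᵛ u
    L₁ = linear₀ (alternating-tail alt u)

  sign : ∀ {n} → Fin n → Carrier
  sign j = (- 1#) ^ toℕ j

  -- Row j reaches the front by j adjacent transpositions, each costing a factor -1, while the other
  -- rows keep their order.
  alternating-cycle : ∀ {m} n {F : Rows m (suc n) → Carrier} → Congruent F → Alternating (suc n) F →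
                      ∀ A j → F (A j ∷ removeAt A j) ≈ sign j * F A
  alternating-cycle n cong alt A zero = trans (cong (∷-η A)) (sym (*-identityˡ _))
  alternating-cycle (suc n) {F} cong alt A (suc j) = begin
    F (A (suc j) ∷ removeAt A (suc j))                     ≈⟨ cong (∷-congᵗ (λ i k → sym (∷-η (removeAt A (suc j)) i k))) ⟩
    F (A (suc j) ∷ A zero ∷ removeAt (A ∘ suc) j)          ≈⟨ alternating-swap alt _ _ _ ⟩
    - F (A zero ∷ A (suc j) ∷ removeAt (A ∘ suc) j)        ≈⟨ -‿cong (alternating-cycle n (λ p → cong (∷-congᵗ p))
                                                                (alternating-tail alt (A zero)) (A ∘ suc) j) ⟩
    - (sign j * F (A zero ∷ A ∘ suc))                      ≈⟨ -‿cong (*-congˡ (cong (∷-η A))) ⟩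
    - (sign j * F A)                                       ≈⟨ solve 2 (λ s x → :- (s :* x) := :- :1 :* s :* x) refl (sign j) (F A) ⟩
    - 1# * sign j * F A                                    ∎
    where open ≈-Reasoning

  det-cong : ∀ n → Congruent (det {n})
  det-cong zero    A≈B = refl
  det-cong (suc n) A≈B = sum-cong-≋ λ j →
    *-cong (*-congˡ {sign j} (A≈B zero j)) (det-cong n λ i k → A≈B (suc i) (punchIn j k))

  lift : ∀ {m n} → (Fin m → Fin n) → Fin (suc m) → Fin (suc n)
  lift f zero    = zero
  lift f (suc x) = suc (f x)

  -- Deleting two columns other than column 0 leaves column 0 in place. `lift` records this and lets
  -- the induction in `equalRows` run with `Φ ∘ lift`.
  punchIn-lift : ∀ {m} (j : Fin (suc (suc m))) (k : Fin (suc m)) x →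
                 punchIn (suc j) (punchIn (suc k) x) ≡ lift (punchIn j ∘ punchIn k) x
  punchIn-lift j k zero    = ≡.refl
  punchIn-lift j k (suc x) = ≡.refl

  -- Double Laplace expansion along two equal rows: the pairs of columns {0 , k} cancel,
  -- and the pairs without column 0 are covered by induction.
  equalRows : ∀ m (a : Vector Carrier (suc (suc m))) (Φ : (Fin m → Fin (suc (suc m))) → Carrier) →
              (∀ {f g} → (∀ x → f x ≡ g x) → Φ f ≈ Φ g) →
              sum (λ j → sum λ k → sign j * a j * (sign k * a (punchIn j k) * Φ (punchIn j ∘ punchIn k))) ≈ 0#
  equalRows m a Φ Φ-cong = begin
    sum (λ k → h zero k) + sum (λ j → h (suc j) zero + sum (λ k → h (suc j) (suc k)))
      ≈⟨ +-congˡ (∑-distrib-+ (λ j → h (suc j) zero) (λ j → sum (λ k → h (suc j) (suc k)))) ⟩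
    sum (λ k → h zero k) + (sum (λ j → h (suc j) zero) + sum (λ j → sum (λ k → h (suc j) (suc k))))
      ≈⟨ +-assoc _ _ _ ⟨
    sum (λ k → h zero k) + sum (λ j → h (suc j) zero) + sum (λ j → sum (λ k → h (suc j) (suc k)))
      ≈⟨ +-congʳ (∑-distrib-+ (h zero) (λ j → h (suc j) zero)) ⟨
    sum (λ k → h zero k + h (suc k) zero) + sum (λ j → sum (λ k → h (suc j) (suc k)))
      ≈⟨ +-cong (sum-≈0 cancel) (rest m a Φ Φ-cong) ⟩
    0# + 0#
      ≈⟨ +-identityˡ 0# ⟩
    0# ∎
    where
    open ≈-Reasoning
    h : Fin (suc (suc m)) → Fin (suc m) → Carrier
    h j k = sign j * a j * (sign k * a (punchIn j k) * Φ (punchIn j ∘ punchIn k))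

    -- Column k + 1 has index k once column 0 is deleted, so the two orders of expansion differ by a
    -- sign.
    cancel : ∀ k → h zero k + h (suc k) zero ≈ 0#
    cancel k = solve 4 (λ s x y z → :1 :* x :* (s :* y :* z) :+ :- :1 :* s :* y :* (:1 :* x :* z) := :0)
      refl (sign k) (a zero) (a (suc k)) (Φ (suc ∘ punchIn k))

    rest : ∀ m (a : Vector Carrier (suc (suc m))) (Φ : (Fin m → Fin (suc (suc m))) → Carrier) →
           (∀ {f g} → (∀ x → f x ≡ g x) → Φ f ≈ Φ g) →
           sum (λ j → sum λ k → sign (suc j) * a (suc j) * (sign (suc k) * a (suc (punchIn j k)) *
             Φ (punchIn (suc j) ∘ punchIn (suc k)))) ≈ 0#
    rest zero    a Φ Φ-cong = +-identityˡ 0#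
    rest (suc m) a Φ Φ-cong = trans
      (sum-cong-≋ λ j → sum-cong-≋ λ k → trans
        (*-congˡ {sign (suc j) * a (suc j)} (*-congˡ {sign (suc k) * a (suc (punchIn j k))} (Φ-cong (punchIn-lift j k))))
        (solve 5 (λ s t x y z → :- :1 :* s :* x :* (:- :1 :* t :* y :* z) := s :* x :* (t :* y :* z))
          refl (sign j) (sign k) (a (suc j)) (a (suc (punchIn j k))) (Φ (lift (punchIn j ∘ punchIn k)))))
      (equalRows m (a ∘ suc) (Φ ∘ lift) λ f≗g → Φ-cong λ { zero → ≡.refl ; (suc x) → ≡.cong suc (f≗g x) })

  removeAt-linear : ∀ {m} (j : Fin (suc m)) → LinearMap (λ u → removeAt u j)
  removeAt-linear j = record
    { ⟦⟧-cong = λ p i → p (punchIn j i) ; +-homo = λ u v i → refl ; *-homo = λ c u i → refl }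

  det-linear₀ : ∀ n R → Linear (λ u → det {suc n} (u ∷ R))
  det-linear₀ n R = record
    { +-homo = λ u v → trans (sum-cong-≋ λ j → solve 4 (λ s x y d → s :* (x :+ y) :* d := s :* x :* d :+ s :* y :* d)
        refl (sign j) (u j) (v j) (M j)) (∑-distrib-+ (λ j → sign j * u j * M j) (λ j → sign j * v j * M j))
    ; *-homo = λ c u → trans (sum-cong-≋ λ j → solve 4 (λ s c x d → s :* (c :* x) :* d := c :* (s :* x :* d))
        refl (sign j) c (u j) (M j)) (sym (*-distribˡ-sum c (λ j → sign j * u j * M j)))
    }
    where
    M : Vector Carrier (suc n)
    M j = det (map (λ row → removeAt row j) R)

  -- With the first row fixed, the determinant is a linear combination of smaller determinants,
  -- taken after removing a column; this is where closure of `Alternating` under combinations and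
  -- under linear maps of the rows comes in. Vanishing on equal rows is the double expansion in
  -- `equalRows`.
  det-alternating : ∀ n → Alternating n (det {n})
  det-alternating zero          = alt₀
  det-alternating (suc zero)    = alt₁ (det-linear₀ zero)
  det-alternating (suc (suc n)) = alt₂
    (det-linear₀ (suc n))
    (λ u R → trans
      (sum-cong-≋ λ j → *-distribˡ-sum (sign j * u j) (λ k → sign k * u (punchIn j k) * det (λ i l → R i (punchIn j (punchIn k l)))))
      (equalRows n u (λ f → det (λ i l → R i (f l)))
        λ f≗g → det-cong n λ i l → reflexive (≡.cong (R i) (f≗g l))))
    (λ u → alternating-combination (suc n) (λ j → sign j * u j)
      λ j → alternating-∘ (removeAt-linear j) (det-cong (suc n)) (det-alternating (suc n)))

  linear-expansion : ∀ {m} {f : Vector Carrier m → Carrier} → (∀ {u v} → u ≈ᵛ v → f u ≈ f v) → Linear f →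
                     ∀ u → f u ≈ sum λ j → u j * f (identity j)
  linear-expansion {zero} {f} cong lin u = begin
    -- In dimension zero all vectors are equal, so `u` is its own multiple by 0.
    f u         ≈⟨ cong (λ ()) ⟩
    f (0# *ᵛ u) ≈⟨ Linear.*-homo lin 0# u ⟩
    0# * f u    ≈⟨ zeroˡ _ ⟩
    0#          ∎
    where open ≈-Reasoning
  linear-expansion {suc m} {f} cong lin u = begin
    f u                                                     ≈⟨ cong split ⟩
    f (u zero *ᵛ identity zero +ᵛ (0# ∷ u ∘ suc))           ≈⟨ Linear.+-homo lin _ _ ⟩
    f (u zero *ᵛ identity zero) + f (0# ∷ u ∘ suc)          ≈⟨ +-cong (Linear.*-homo lin _ _)
                                                                 (linear-expansion {f = λ w → f (0# ∷ w)} (λ p → cong (0∷-cong p)) lin′ (u ∘ suc)) ⟩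
    u zero * f (identity zero) + sum (λ j → u (suc j) * f (0# ∷ identity j))
      ≈⟨ +-congˡ (sum-cong-≋ λ j → *-congˡ {u (suc j)} (cong λ { zero → refl ; (suc i) → refl })) ⟩
    u zero * f (identity zero) + sum (λ j → u (suc j) * f (identity (suc j))) ∎
    where
    open ≈-Reasoning
    split : u ≈ᵛ u zero *ᵛ identity zero +ᵛ (0# ∷ u ∘ suc)
    split zero    = sym (trans (+-identityʳ _) (*-identityʳ _))
    split (suc i) = sym (trans (+-congʳ (zeroʳ _)) (+-identityˡ _))
    0∷-cong : ∀ {v w : Vector Carrier m} → v ≈ᵛ w → (0# ∷ v) ≈ᵛ (0# ∷ w)
    0∷-cong p zero    = refl
    0∷-cong p (suc i) = p i
    lin′ : Linear (λ w → f (0# ∷ w))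
    lin′ = record
      { +-homo = λ v w → trans (cong λ { zero → sym (+-identityˡ 0#) ; (suc i) → refl }) (Linear.+-homo lin _ _)
      ; *-homo = λ c v → trans (cong λ { zero → sym (zeroʳ c) ; (suc i) → refl }) (Linear.*-homo lin _ _)
      }

  insert₀ : ∀ {m} → Fin (suc m) → Vector Carrier m → Vector Carrier (suc m)
  insert₀ j w = insertAt w j 0#

  insert₀-linear : ∀ {m} (j : Fin (suc m)) → LinearMap (insert₀ j)
  insert₀-linear j = record { ⟦⟧-cong = cong j ; +-homo = add j ; *-homo = scale j }
    where
    cong : ∀ {m} (j : Fin (suc m)) {u v : Vector Carrier m} → u ≈ᵛ v → insert₀ j u ≈ᵛ insert₀ j v
    cong zero    p zero    = refl
    cong zero    p (suc i) = p i
    cong {suc m} (suc j) p zero    = p zero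
    cong {suc m} (suc j) p (suc i) = cong j (p ∘ suc) i
    add : ∀ {m} (j : Fin (suc m)) (u v : Vector Carrier m) → insert₀ j (u +ᵛ v) ≈ᵛ insert₀ j u +ᵛ insert₀ j v
    add zero    u v zero    = sym (+-identityˡ 0#)
    add zero    u v (suc i) = refl
    add {suc m} (suc j) u v zero    = refl
    add {suc m} (suc j) u v (suc i) = add j (u ∘ suc) (v ∘ suc) i
    scale : ∀ {m} (j : Fin (suc m)) c (u : Vector Carrier m) → insert₀ j (c *ᵛ u) ≈ᵛ c *ᵛ insert₀ j u
    scale zero    c u zero    = sym (zeroʳ c)
    scale zero    c u (suc i) = refl
    scale {suc m} (suc j) c u zero    = refl
    scale {suc m} (suc j) c u (suc i) = scale j c (u ∘ suc) i

  -- The right-hand side is a row operation with the row `identity j`, so an alternating function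
  -- with that row on top does not notice when column j is cleared.
  insert₀-removeAt : ∀ {m} (j : Fin (suc m)) (r : Vector Carrier (suc m)) →
                     insert₀ j (removeAt r j) ≈ᵛ r +ᵛ (- r j) *ᵛ identity j
  insert₀-removeAt zero r zero    = solve 1 (λ x → :0 := x :+ :- x :* :1) refl (r zero)
  insert₀-removeAt zero r (suc i) = solve 2 (λ x y → x := x :+ :- y :* :0) refl (r (suc i)) (r zero)
  insert₀-removeAt {suc m} (suc j) r zero    = solve 2 (λ x y → x := x :+ :- y :* :0) refl (r zero) (r (suc j))
  insert₀-removeAt {suc m} (suc j) r (suc i) = insert₀-removeAt j (r ∘ suc) i

  insert₀-identity : ∀ {m} (j : Fin (suc m)) (k : Fin m) → insert₀ j (identity k) ≈ᵛ identity (punchIn j k)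
  insert₀-identity zero k zero    = refl
  insert₀-identity zero k (suc i) = refl
  insert₀-identity {suc m} (suc j) zero    zero    = refl
  insert₀-identity {suc m} (suc j) (suc k) zero    = refl
  insert₀-identity {suc m} (suc j) zero    (suc i) = zeros j i
    where
    zeros : ∀ {m} (j : Fin (suc m)) → insert₀ j 0ᵛ ≈ᵛ 0ᵛ
    zeros zero    zero    = refl
    zeros zero    (suc i) = refl
    zeros {suc m} (suc j) zero    = refl
    zeros {suc m} (suc j) (suc i) = zeros j i
  insert₀-identity {suc m} (suc j) (suc k) (suc i) = insert₀-identity j k i

  -- Clearing column j below the row e_j reduces F to an alternating function of one row less.
  alternating-unique : ∀ n {F : Matrix n → Carrier} → Congruent F → Alternating n F →
                       ∀ A → F A ≈ det A * F identity
  alternating-unique zero {F} cong alt A = trans (cong λ ()) (sym (*-identityˡ _))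
  alternating-unique (suc n) {F} cong alt A = begin
    F A                                         ≈⟨ cong (∷-η A) ⟨
    F (A zero ∷ A ∘ suc)                        ≈⟨ linear-expansion (λ p → cong (∷-congʰ p)) (linear₀ alt (A ∘ suc)) (A zero) ⟩
    sum (λ j → A zero j * F (identity j ∷ A ∘ suc)) ≈⟨ (sum-cong-≋ λ j → *-congˡ {A zero j} (term j)) ⟩
    sum (λ j → A zero j * (det (minor j) * (sign j * F identity)))
                                                ≈⟨ (sum-cong-≋ λ j → solve 4 (λ a d s f → a :* (d :* (s :* f)) := s :* a :* d :* f)
                                                     refl (A zero j) (det (minor j)) (sign j) (F identity)) ⟩
    sum (λ j → sign j * A zero j * det (minor j) * F identity)
                                                ≈⟨ *-distribʳ-sum (F identity) (λ j → sign j * A zero j * det (minor j)) ⟨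
    det A * F identity                          ∎
    where
    open ≈-Reasoning
    minor : Fin (suc n) → Matrix n
    minor j = map (λ row → removeAt row j) (tail A)

    term : ∀ j → F (identity j ∷ A ∘ suc) ≈ det (minor j) * (sign j * F identity)
    term j = begin
      F (identity j ∷ A ∘ suc)                              ≈⟨ alternating-rowOp n cong alt (identity j) (A ∘ suc) (λ i → - A (suc i) j) ⟨
      F (identity j ∷ (λ i → A (suc i) +ᵛ (- A (suc i) j) *ᵛ identity j))
                                                            ≈⟨ cong (∷-congᵗ λ i k → insert₀-removeAt j (A (suc i)) k) ⟨
      F (identity j ∷ insert₀ j ∘ minor j)                  ≈⟨ alternating-unique n
                                                                 {λ B → F (identity j ∷ insert₀ j ∘ B)}
                                                                 (λ p → cong (∷-congᵗ λ i → LinearMap.⟦⟧-cong (insert₀-linear j) (p i)))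
                                                                 (alternating-∘ (insert₀-linear j) (λ p → cong (∷-congᵗ p))
                                                                   (alternating-tail alt (identity j))) (minor j) ⟩
      det (minor j) * F (identity j ∷ insert₀ j ∘ identity) ≈⟨ *-congˡ (cong (∷-congᵗ λ k → insert₀-identity j k)) ⟩
      det (minor j) * F (identity j ∷ removeAt identity j)  ≈⟨ *-congˡ (alternating-cycle n cong alt identity j) ⟩
      det (minor j) * (sign j * F identity)                 ∎

  -- As a function of the rows of `A`, the determinant of the product is alternating, and its value
  -- at the identity is det B; `alternating-unique` gives the factorisation.
  det-*ᴹ : ∀ {n} (A B : Matrix n) → det (A *ᴹ B) ≈ det A * det B
  det-*ᴹ {n} A B = trans
    (alternating-unique n {λ A → det (A *ᴹ B)} (λ p → det-cong n (*ᴹ-cong p (λ _ _ → refl)))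
      (alternating-∘ *B-linear (det-cong n) (det-alternating n)) A)
    (*-congˡ (det-cong n (*ᴹ-identityˡ B)))
    where
    *B-linear : LinearMap (λ u j → sum λ k → u k * B k j)
    *B-linear = record
      { ⟦⟧-cong = λ p j → ∙-cong p (λ _ → refl)
      ; +-homo  = λ u v j → ∙-distribʳ _ u v
      ; *-homo  = λ c u j → ∙-*ˡ c u _
      }

  det-diagonal : ∀ {n} (d : Vector Carrier n) → det (diagonal d) ≈ product d
  det-diagonal {zero}  d = refl
  det-diagonal {suc n} d = begin
    1# * (d zero * 1#) * det (diagonal (d ∘ suc)) + sum (λ j → sign (suc j) * (d zero * 0#) * M j)
      ≈⟨ +-cong (*-cong (solve 1 (λ x → :1 :* (x :* :1) := x) refl (d zero)) (det-diagonal (d ∘ suc)))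
           (sum-≈0 λ j → solve 3 (λ s x r → s :* (x :* :0) :* r := :0) refl (sign (suc j)) (d zero) (M j)) ⟩
    d zero * product (d ∘ suc) + 0# ≈⟨ +-identityʳ _ ⟩
    product d ∎
    where
    open ≈-Reasoning
    M : Vector Carrier n
    M j = det (λ i k → d (suc i) * identity (suc i) (punchIn (suc j) k))

  det-identity : ∀ n → det (identity {n}) ≈ 1#
  det-identity n = begin
    det (identity {n})                ≈⟨ det-cong n (λ i j → *-identityˡ (identity i j)) ⟨
    det (diagonal {n} (λ _ → 1#))     ≈⟨ det-diagonal {n} (λ _ → 1#) ⟩
    product {n} (λ _ → 1#)            ≈⟨ ones n ⟩
    1#                                ∎
    where
    open ≈-Reasoning
    ones : ∀ n → product {n} (λ _ → 1#) ≈ 1#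
    ones zero    = refl
    ones (suc n) = trans (*-identityˡ _) (ones n)

  -- Gaussian elimination

  record Subspace {n} (U : Vector Carrier n → Set) : Set where
    field
      resp : ∀ {u v} → u ≈ᵛ v → U u → U v
      0∈   : U 0ᵛ
      +∈   : ∀ {u v} → U u → U v → U (u +ᵛ v)
      *∈   : ∀ c {u} → U u → U (c *ᵛ u)

  0∷-subspace : ∀ {n} {U : Vector Carrier (suc n) → Set} → Subspace U → Subspace (λ w → U (0# ∷ w))
  0∷-subspace sub = record
    { resp = λ p → resp λ { zero → refl ; (suc i) → p i }
    ; 0∈   = resp (λ { zero → refl ; (suc i) → refl }) 0∈
    ; +∈   = λ p q → resp (λ { zero → +-identityˡ 0# ; (suc i) → refl }) (+∈ p q)
    ; *∈   = λ c p → resp (λ { zero → zeroʳ c ; (suc i) → refl }) (*∈ c p)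
    }
    where open Subspace sub

  identity⊆⇒full : ∀ {n} {U : Vector Carrier n → Set} → Subspace U → (∀ i → U (identity i)) → ∀ v → U v
  identity⊆⇒full {zero}  sub e∈ v = Subspace.resp sub (λ ()) (Subspace.0∈ sub)
  identity⊆⇒full {suc n} {U} sub e∈ v = resp split
    (+∈ (*∈ (v zero) (e∈ zero)) (identity⊆⇒full (0∷-subspace sub)
      (λ i → resp (λ { zero → refl ; (suc j) → refl }) (e∈ (suc i))) (v ∘ suc)))
    where
    open Subspace sub
    split : v zero *ᵛ identity zero +ᵛ (0# ∷ v ∘ suc) ≈ᵛ v
    split zero    = solve 1 (λ x → x :* :1 :+ :0 := x) refl (v zero)
    split (suc i) = solve 2 (λ x y → x :* :0 :+ y := y) refl (v zero) (v (suc i))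

  infix 4 _⊥_

  _⊥_ : ∀ {n} → List (Vector Carrier n) → Vector Carrier n → Set
  rs ⊥ v = All (λ r → r ∙ v ≈ 0#) rs

  pivot : ∀ {n} (rs : List (Vector Carrier (suc n))) →
          All (λ r → r zero ≈ 0#) rs ⊎ ∃₂ λ r rest → ¬ (r zero ≈ 0#) × rs ↭ r List.∷ rest
  pivot List.[] = inj₁ All.[]
  pivot (r List.∷ rs) with r zero ≟ 0#
  ... | no  r₀≉0 = inj₂ (r , rs , r₀≉0 , Perm.↭-refl)
  ... | yes r₀≈0 with pivot rs
  ...   | inj₁ all≈0                   = inj₁ (r₀≈0 All.∷ all≈0)
  ...   | inj₂ (p , rest , p₀≉0 , rs↭) =
          inj₂ (p , r List.∷ rest , p₀≉0 , Perm.trans (Perm.prep r rs↭) (Perm.swap r p Perm.↭-refl))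

  -- U is any property of linear functionals that is inherited by linear combinations.
  kernel-or-spanning : ∀ {n} (rs : List (Vector Carrier n)) {U} → Subspace U → All U rs →
    (∃ λ v → ¬ (v ≈ᵛ 0ᵛ) × rs ⊥ v) ⊎ ((∀ i → U (identity i)) × n ℕ.≤ List.length rs)
  kernel-or-spanning {zero}  rs sub rs⊆U = inj₂ ((λ ()) , ℕ.z≤n)
  kernel-or-spanning {suc n} rs {U} sub rs⊆U with pivot rs
  ... | inj₁ all≈0 = inj₁
    ( identity zero , (λ e≈0 → 0≉1 (sym (e≈0 zero)))
    , All.map (λ {r} r₀≈0 → trans (∙-comm r (identity zero)) (trans (identity-sum zero r) r₀≈0)) all≈0)
  ... | inj₂ (r , rest , r₀≉0 , rs↭) with All-resp-↭ rs↭ rs⊆U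
  ... | r∈U All.∷ rest⊆U = conclude (kernel-or-spanning (List.map (λ s → reduced s ∘ suc) rest)
          (0∷-subspace sub) (All.map⁺ (All.map reduced∈ rest⊆U)))
    where
    open ≈-Reasoning
    open Subspace sub
    ι : Carrier
    ι = r zero ⁻¹

    reduced : Vector Carrier (suc n) → Vector Carrier (suc n)
    reduced s = s +ᵛ (- (s zero * ι)) *ᵛ r

    reduced₀≈0 : ∀ s → reduced s zero ≈ 0#
    reduced₀≈0 s = begin
      s zero + - (s zero * ι) * r zero  ≈⟨ solve 3 (λ s i r → s :+ :- (s :* i) :* r := s :* (:1 :- r :* i)) refl (s zero) ι (r zero) ⟩
      s zero * (1# - r zero * ι)        ≈⟨ *-congˡ (+-congˡ (-‿cong (⁻¹-inverseʳ (r zero) r₀≉0))) ⟩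
      s zero * (1# - 1#)                ≈⟨ solve 1 (λ s → s :* (:1 :- :1) := :0) refl (s zero) ⟩
      0#                                ∎

    reduced∈ : ∀ {s} → U s → U (0# ∷ reduced s ∘ suc)
    reduced∈ {s} s∈U = resp (λ { zero → reduced₀≈0 s ; (suc i) → refl }) (+∈ s∈U (*∈ _ r∈U))

    conclude : _ → (∃ λ v → ¬ (v ≈ᵛ 0ᵛ) × rs ⊥ v) ⊎ ((∀ i → U (identity i)) × suc n ℕ.≤ List.length rs)
    conclude (inj₁ (w , w≉0 , ⊥w)) = inj₁ (v , (λ v≈0 → w≉0 (v≈0 ∘ suc)) ,
        All-resp-↭ (Perm.↭-sym rs↭) (r∙v≈0 All.∷ All.map (λ {s} → s∙v≈0 {s}) (All.map⁻ ⊥w)))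
      where
      v : Vector Carrier (suc n)
      -- Back substitution: the first coordinate is the solution of the pivot equation r ∙ v = 0.
      v = - (ι * ((r ∘ suc) ∙ w)) ∷ w

      r∙v≈0 : r ∙ v ≈ 0#
      r∙v≈0 = begin
        r zero * - (ι * ((r ∘ suc) ∙ w)) + (r ∘ suc) ∙ w  ≈⟨ solve 3 (λ r i t → r :* :- (i :* t) :+ t := t :* (:1 :- r :* i)) refl (r zero) ι ((r ∘ suc) ∙ w) ⟩
        (r ∘ suc) ∙ w * (1# - r zero * ι)                 ≈⟨ *-congˡ (+-congˡ (-‿cong (⁻¹-inverseʳ (r zero) r₀≉0))) ⟩
        (r ∘ suc) ∙ w * (1# - 1#)                         ≈⟨ solve 1 (λ s → s :* (:1 :- :1) := :0) refl ((r ∘ suc) ∙ w) ⟩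
        0#                                                ∎

      s∙v≈0 : ∀ {s} → (reduced s ∘ suc) ∙ w ≈ 0# → s ∙ v ≈ 0#
      s∙v≈0 {s} eq = begin
        s ∙ v                              ≈⟨ solve 2 (λ x y → x := x :+ y :* :0) refl (s ∙ v) k ⟩
        s ∙ v + k * 0#                     ≈⟨ +-congˡ (*-congˡ r∙v≈0) ⟨
        s ∙ v + k * (r ∙ v)                ≈⟨ +-congˡ (∙-*ˡ k r v) ⟨
        s ∙ v + (k *ᵛ r) ∙ v               ≈⟨ ∙-distribʳ v s (k *ᵛ r) ⟨
        reduced s ∙ v                      ≈⟨ +-cong (trans (*-congʳ (reduced₀≈0 s)) (zeroˡ _)) eq ⟩
        0# + 0#                            ≈⟨ +-identityˡ 0# ⟩
        0#                                 ∎
        where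
        k = - (s zero * ι)
    conclude (inj₂ (e∈ , n≤)) = inj₂ ((λ { zero → e₀∈ ; (suc i) → resp (λ { zero → refl ; (suc j) → refl }) (e∈ i) }) ,
        ≡.subst (suc n ℕ.≤_) (≡.sym (≡.trans (↭-length rs↭) (≡.cong suc (≡.sym (List.length-map (λ s → reduced s ∘ suc) rest))))) (ℕ.s≤s n≤))
      where
      e₀∈ : U (identity zero)
      -- The tail of the pivot row, with a 0 in front, lies in U because the later coordinate
      -- vectors do. Subtracting it from `r` leaves r₀ e₀, which is divided by r₀.
      e₀∈ = resp
        (λ { zero    → trans (solve 2 (λ r i → i :* (r :+ :- :1 :* :0) := r :* i) refl (r zero) ι) (⁻¹-inverseʳ (r zero) r₀≉0)
           ; (suc i) → solve 2 (λ r i → i :* (r :+ :- :1 :* r) := :0) refl (r (suc i)) ι })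
        (*∈ ι (+∈ r∈U (*∈ (- 1#) (identity⊆⇒full (0∷-subspace sub) e∈ (r ∘ suc)))))

  -- Apply the dichotomy with U the property that always holds; its second alternative would require
  -- at least n functionals.
  kernel-nontrivial : ∀ {n} (rs : List (Vector Carrier n)) → List.length rs ℕ.< n →
                      ∃ λ v → ¬ (v ≈ᵛ 0ᵛ) × rs ⊥ v
  kernel-nontrivial rs len<n with kernel-or-spanning rs {λ _ → ⊤} full (All.universal (λ _ → tt) rs)
    where
    full : Subspace (λ _ → ⊤)
    full = record { resp = λ _ _ → tt ; 0∈ = tt ; +∈ = λ _ _ → tt ; *∈ = λ _ _ → tt }
  ... | inj₁ kernel     = kernel
  ... | inj₂ (_ , n≤len) = contradiction n≤len (ℕ.<⇒≱ len<n)

  -- Spectral theorem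

  Symmetric : ∀ {n} → Matrix n → Set
  Symmetric A = ∀ i j → A i j ≈ A j i

  form : ∀ {n} → Matrix n → Vector Carrier n → Carrier
  form A x = x ∙ (A · x)

  ·-+ : ∀ {n} (A : Matrix n) x y → A · (x +ᵛ y) ≈ᵛ A · x +ᵛ A · y
  ·-+ A x y i = ∙-distribˡ (A i) x y

  ·-* : ∀ {n} (A : Matrix n) c x → A · (c *ᵛ x) ≈ᵛ c *ᵛ (A · x)
  ·-* A c x i = ∙-*ʳ c (A i) x

  bilinear-sym : ∀ {n} {A : Matrix n} → Symmetric A → ∀ x y → x ∙ (A · y) ≈ y ∙ (A · x)
  bilinear-sym {A = A} A-sym x y = begin
    sum (λ i → x i * sum (λ j → A i j * y j))   ≈⟨ (sum-cong-≋ λ i → *-distribˡ-sum (x i) (λ j → A i j * y j)) ⟩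
    sum (λ i → sum (λ j → x i * (A i j * y j))) ≈⟨ ∑-comm (λ i j → x i * (A i j * y j)) ⟩
    sum (λ j → sum (λ i → x i * (A i j * y j))) ≈⟨ (sum-cong-≋ λ j → sum-cong-≋ λ i → trans
                                                     (solve 3 (λ x a y → x :* (a :* y) := y :* (a :* x)) refl (x i) (A i j) (y j))
                                                     (*-congˡ (*-congʳ (A-sym i j)))) ⟩
    sum (λ j → sum (λ i → y j * (A j i * x i))) ≈⟨ (sum-cong-≋ λ j → *-distribˡ-sum (y j) (λ i → A j i * x i)) ⟨
    sum (λ j → y j * sum (λ i → A j i * x i))   ∎
    where open ≈-Reasoning

  form-+* : ∀ {n} {A : Matrix n} → Symmetric A → ∀ x t y →
            form A (x +ᵛ t *ᵛ y) ≈ form A x + 2# * t * (y ∙ (A · x)) + t * t * form A y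
  form-+* {A = A} A-sym x t y = begin
    (x +ᵛ t *ᵛ y) ∙ (A · (x +ᵛ t *ᵛ y))
      ≈⟨ ∙-cong {u = x +ᵛ t *ᵛ y} (λ _ → refl) (λ i → trans (·-+ A x (t *ᵛ y) i) (+-congˡ (·-* A t y i))) ⟩
    (x +ᵛ t *ᵛ y) ∙ (A · x +ᵛ t *ᵛ (A · y))
      ≈⟨ trans (∙-distribʳ _ x (t *ᵛ y)) (+-cong (∙-distribˡ x _ _) (trans (∙-*ˡ t y _) (*-congˡ (∙-distribˡ y _ _)))) ⟩
    (x ∙ (A · x) + x ∙ (t *ᵛ (A · y))) + t * (y ∙ (A · x) + y ∙ (t *ᵛ (A · y)))
      ≈⟨ +-cong (+-congˡ (trans (∙-*ʳ t x _) (*-congˡ (bilinear-sym A-sym x y)))) (*-congˡ (+-congˡ (∙-*ʳ t y _))) ⟩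
    (form A x + t * (y ∙ (A · x))) + t * (y ∙ (A · x) + t * form A y)
      ≈⟨ solve 4 (λ t b p q → (p :+ t :* b) :+ t :* (b :+ t :* q) := p :+ (:1 :+ :1) :* t :* b :+ t :* t :* q)
           refl t (y ∙ (A · x)) (form A x) (form A y) ⟩
    form A x + 2# * t * (y ∙ (A · x)) + t * t * form A y ∎
    where open ≈-Reasoning

  -- A weak Cauchy–Schwarz inequality: minimise the form over the line x + t eᵢ.
  psd-row-bound : ∀ {n} {M : Matrix n} → Symmetric M → (∀ x → 0# ≤ form M x) →
                  ∀ i → ∃ λ C → 0# ≤ C × (∀ x → (M i ∙ x) * (M i ∙ x) ≤ C * form M x)
  psd-row-bound {M = M} M-sym psd i = D , proj₁ 0<D , bound
    where
    e = identity i
    m = form M e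
    -- `m` may be 0; the added 1 makes D invertible. With b = M i ∙ x and β = b / D one has D form M
    -- x = b² + D form M (x - β e) + D β², and the last two terms are nonnegative.
    D = m + 1#
    0<D : 0# < D
    0<D = <-respʳ-≈ (+-comm 1# m) (+-positive 0<1 (psd e))

    bound : ∀ x → (M i ∙ x) * (M i ∙ x) ≤ D * form M x
    bound x = ≤-by (D * form M (x +ᵛ (- β) *ᵛ e) + D * (β * β))
      (+-nonNegative (*-nonNegative (proj₁ 0<D) (psd _)) (*-nonNegative (proj₁ 0<D) (0≤x² β))) (begin
        D * q                                         ≈⟨ solve 3 (λ m q β →
            (m :+ :1) :* q := (m :+ :1) :* β :* ((m :+ :1) :* β) :+
              ((m :+ :1) :* (q :+ :2 :* (:- β) :* ((m :+ :1) :* β) :+ (:- β) :* (:- β) :* m) :+ (m :+ :1) :* (β :* β))) refl m q β ⟩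
        D * β * (D * β) + (D * (q + 2# * - β * (D * β) + - β * - β * m) + D * (β * β))
          ≈⟨ +-cong (*-cong Dβ≈b Dβ≈b) (+-congʳ (*-congˡ (+-congʳ (+-congˡ (*-congˡ Dβ≈b))))) ⟩
        b * b + (D * (q + 2# * - β * b + - β * - β * m) + D * (β * β))
          ≈⟨ +-congˡ (+-congʳ (*-congˡ (trans (form-+* M-sym x (- β) e) (+-congʳ (+-congˡ (*-congˡ (identity-sum i (M · x)))))))) ⟨
        b * b + (D * form M (x +ᵛ (- β) *ᵛ e) + D * (β * β)) ∎)
      where
      open ≈-Reasoning
      b = M i ∙ x
      q = form M x
      β = b * D ⁻¹
      Dβ≈b : D * β ≈ b
      Dβ≈b = trans (solve 3 (λ D b ι → D :* (b :* ι) := b :* (D :* ι)) refl D b (D ⁻¹))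
        (trans (*-congˡ (⁻¹-inverseʳ D (0<⇒≉0 0<D))) (*-identityʳ b))

  2t≤u⇒t≤u : ∀ {t u} → 0# ≤ u → 2# * t ≤ u → t ≤ u
  2t≤u⇒t≤u {t} {u} 0≤u 2t≤u with DTO.total 0# t
  ... | inj₁ 0≤t = DTO.trans (≤-by t 0≤t (solve 1 (λ t → :2 :* t := t :+ t) refl t)) 2t≤u
  ... | inj₂ t≤0 = DTO.trans t≤0 0≤u

  -- For coordinates s, t of x and an entry a, 2 s a t ≤ s² + a² t² ≤ (a² + 1) (x ∙ x). These crude
  -- constants are enough, as any upper bound of the Rayleigh quotients will do for the supremum to
  -- exist.
  form-bounded : ∀ {n} (A : Matrix n) → ∃ λ b → ∀ x → form A x ≤ b * (x ∙ x)
  form-bounded A = sum (λ i → sum λ j → c i j) , λ x → begin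
    sum (λ i → x i * sum (λ j → A i j * x j))   ≈⟨ (sum-cong-≋ λ i → *-distribˡ-sum (x i) (λ j → A i j * x j)) ⟩
    sum (λ i → sum (λ j → x i * (A i j * x j))) ≤⟨ (sum-mono-≤ λ i → sum-mono-≤ λ j → term x i j) ⟩
    sum (λ i → sum (λ j → c i j * (x ∙ x)))     ≈⟨ (sum-cong-≋ λ i → *-distribʳ-sum (x ∙ x) (c i)) ⟨
    sum (λ i → sum (c i) * (x ∙ x))             ≈⟨ *-distribʳ-sum (x ∙ x) (λ i → sum (c i)) ⟨
    sum (λ i → sum (c i)) * (x ∙ x)             ∎
    where
    open ≤-Reasoning
    c : ∀ i j → Carrier
    c i j = A i j * A i j + 1#

    term : ∀ x i j → x i * (A i j * x j) ≤ c i j * (x ∙ x)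
    term x i j = 2t≤u⇒t≤u (*-nonNegative (+-nonNegative (0≤x² a) 0≤1) (∙-nonNegative x))
      (≤-by ((x i - a * x j) * (x i - a * x j) + a * a * (S - x j * x j) + (S - x i * x i))
        (+-nonNegative (+-nonNegative (0≤x² _) (*-nonNegative (0≤x² a) (x≤y⇒0≤y-x (term≤sum (λ k → 0≤x² (x k)) j))))
          (x≤y⇒0≤y-x (term≤sum (λ k → 0≤x² (x k)) i)))
        (solve 4 (λ a x y S → (a :* a :+ :1) :* S := :2 :* (x :* (a :* y)) :+
           ((x :- a :* y) :* (x :- a :* y) :+ a :* a :* (S :- y :* y) :+ (S :- x :* x))) refl a (x i) (x j) S))
      where
      a = A i j
      S = x ∙ x

  -- From (u + v)² + (u - v)² = 2 (u² + v²). Bounds on squares take the place of absolute values,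
  -- with q a quadratic form in `kernel-or-coercive` and q = 1 in the Lipschitz estimates.
  square-sum-bound : ∀ {u v C D q} → u * u ≤ C * q → v * v ≤ D * q → (u + v) * (u + v) ≤ 2# * (C + D) * q
  square-sum-bound {u} {v} {C} {D} {q} p r = begin
    (u + v) * (u + v)         ≤⟨ ≤-by _ (0≤x² (u - v)) (solve 2 (λ u v →
                                   :2 :* (u :* u :+ v :* v) := (u :+ v) :* (u :+ v) :+ (u :- v) :* (u :- v)) refl u v) ⟩
    2# * (u * u + v * v)      ≤⟨ *-monoʳ-≤ (proj₁ 0<2) (+-mono-≤ p r) ⟩
    2# * (C * q + D * q)      ≈⟨ solve 3 (λ C D q → :2 :* (C :* q :+ D :* q) := :2 :* (C :+ D) :* q) refl C D q ⟩
    2# * (C + D) * q          ∎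
    where open ≤-Reasoning

  square-scale-bound : ∀ c {u C q} → u * u ≤ C * q → c * u * (c * u) ≤ c * c * C * q
  square-scale-bound c {u} {C} {q} p = begin
    c * u * (c * u)  ≈⟨ solve 2 (λ c u → c :* u :* (c :* u) := c :* c :* (u :* u)) refl c u ⟩
    c * c * (u * u)  ≤⟨ *-monoʳ-≤ (0≤x² c) p ⟩
    c * c * (C * q)  ≈⟨ *-assoc _ _ _ ⟨
    c * c * C * q    ∎
    where open ≤-Reasoning

  ≤-respˡ-≈ : ∀ {x y z} → x ≈ y → y ≤ z → x ≤ z
  ≤-respˡ-≈ x≈y y≤z = DTO.trans (DTO.reflexive x≈y) y≤z

  -- Let `U` contain the functionals whose square is bounded by a multiple of the form. The rows of
  -- M belong to it by `psd-row-bound`. If they have no common kernel vector, they span, so the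
  -- coordinate functionals belong to `U` as well, and adding up their bounds controls x ∙ x.
  kernel-or-coercive : ∀ {n} {M : Matrix n} → Symmetric M → (∀ x → 0# ≤ form M x) →
    (∃ λ v → ¬ (v ≈ᵛ 0ᵛ) × M · v ≈ᵛ 0ᵛ) ⊎ (∃ λ C → 0# < C × (∀ x → x ∙ x ≤ C * form M x))
  kernel-or-coercive {n} {M} M-sym psd = conclude
    (kernel-or-spanning (List.tabulate M) U-subspace (All.tabulate⁺ (psd-row-bound M-sym psd)))
    where
    U : Vector Carrier n → Set
    U w = ∃ λ C → 0# ≤ C × (∀ x → (w ∙ x) * (w ∙ x) ≤ C * form M x)

    U-subspace : Subspace U
    U-subspace = record
      { resp = λ {u} {v} p (C , 0≤C , b) → C , 0≤C , λ x →
          ≤-respˡ-≈ (*-cong (∙-cong {u = v} {u′ = u} (sym ∘ p) (λ _ → refl)) (∙-cong {u = v} {u′ = u} (sym ∘ p) (λ _ → refl))) (b x)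
      ; 0∈ = 0# , ≤-refl , λ x → DTO.reflexive
          (trans (*-congʳ (∙-zeroˡ {u = 0ᵛ} x (λ _ → refl))) (trans (zeroˡ (0ᵛ ∙ x)) (sym (zeroˡ (form M x)))))
      ; +∈ = λ {u} {v} (C , 0≤C , b) (D , 0≤D , d) →
          2# * (C + D) , *-nonNegative (proj₁ 0<2) (+-nonNegative 0≤C 0≤D) , λ x →
            ≤-respˡ-≈ (*-cong (∙-distribʳ x u v) (∙-distribʳ x u v)) (square-sum-bound (b x) (d x))
      ; *∈ = λ c {u} (C , 0≤C , b) → c * c * C , *-nonNegative (0≤x² c) 0≤C , λ x →
            ≤-respˡ-≈ (*-cong (∙-*ˡ c u x) (∙-*ˡ c u x)) (square-scale-bound c (b x))
      }

    conclude : (∃ λ v → ¬ (v ≈ᵛ 0ᵛ) × List.tabulate M ⊥ v) ⊎ ((∀ i → U (identity i)) × n ℕ.≤ List.length (List.tabulate M)) →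
      (∃ λ v → ¬ (v ≈ᵛ 0ᵛ) × M · v ≈ᵛ 0ᵛ) ⊎ (∃ λ C → 0# < C × (∀ x → x ∙ x ≤ C * form M x))
    conclude (inj₁ (v , v≉0 , ⊥v)) = inj₁ (v , v≉0 , All.tabulate⁻ ⊥v)
    -- The extra 1 keeps the constant positive even if all bounds are 0; its inverse is taken in
    -- `supremum-eigenvector`.
    conclude (inj₂ (e∈ , _)) = inj₂ (1# + sum c , +-positive 0<1 (sum-nonNegative λ i → proj₁ (proj₂ (e∈ i))) , coercive)
      where
      c : Vector Carrier n
      c i = proj₁ (e∈ i)

      coercive : ∀ x → x ∙ x ≤ (1# + sum c) * form M x
      coercive x = begin
        sum (λ i → x i * x i)               ≈⟨ (sum-cong-≋ λ i → *-cong (identity-sum i x) (identity-sum i x)) ⟨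
        sum (λ i → identity i ∙ x * (identity i ∙ x)) ≤⟨ (sum-mono-≤ λ i → proj₂ (proj₂ (e∈ i)) x) ⟩
        sum (λ i → c i * form M x)          ≈⟨ *-distribʳ-sum (form M x) c ⟨
        sum c * form M x                    ≤⟨ ≤-by (form M x) (psd x) (solve 2 (λ s q → (:1 :+ s) :* q := s :* q :+ q) refl (sum c) (form M x)) ⟩
        (1# + sum c) * form M x             ∎
        where open ≤-Reasoning

  shift-row : ∀ {n} (A : Matrix n) l x i → (l • identity -ᴹ A) i ∙ x ≈ l * x i - A i ∙ x
  shift-row A l x i = begin
    sum (λ j → (l * identity i j - A i j) * x j)
      ≈⟨ (sum-cong-≋ λ j → solve 4 (λ l e a x → (l :* e :- a) :* x := l :* (e :* x) :+ :- (a :* x)) refl l (identity i j) (A i j) (x j)) ⟩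
    sum (λ j → l * (identity i j * x j) + - (A i j * x j))
      ≈⟨ ∑-distrib-+ (λ j → l * (identity i j * x j)) (λ j → - (A i j * x j)) ⟩
    sum (λ j → l * (identity i j * x j)) + sum (λ j → - (A i j * x j))
      ≈⟨ +-cong (trans (sym (*-distribˡ-sum l (λ j → identity i j * x j))) (*-congˡ (identity-sum i x))) (sum-neg (λ j → A i j * x j)) ⟩
    l * x i - A i ∙ x ∎
    where open ≈-Reasoning

  shift-form : ∀ {n} (A : Matrix n) l x → form (l • identity -ᴹ A) x ≈ l * (x ∙ x) - form A x
  shift-form A l x = begin
    sum (λ i → x i * ((l • identity -ᴹ A) i ∙ x))
      ≈⟨ (sum-cong-≋ λ i → trans (*-congˡ (shift-row A l x i))
           (solve 3 (λ x l a → x :* (l :* x :- a) := l :* (x :* x) :+ :- (x :* a)) refl (x i) l (A i ∙ x))) ⟩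
    sum (λ i → l * (x i * x i) + - (x i * (A i ∙ x)))
      ≈⟨ ∑-distrib-+ (λ i → l * (x i * x i)) (λ i → - (x i * (A i ∙ x))) ⟩
    sum (λ i → l * (x i * x i)) + sum (λ i → - (x i * (A i ∙ x)))
      ≈⟨ +-cong (sym (*-distribˡ-sum l (λ i → x i * x i))) (sum-neg (λ i → x i * (A i ∙ x))) ⟩
    l * (x ∙ x) - form A x ∎
    where open ≈-Reasoning

  form-zero : ∀ {n} (A : Matrix n) {x} → x ≈ᵛ 0ᵛ → form A x ≈ 0#
  form-zero A {x} x≈0 = ∙-zeroˡ (A · x) x≈0

  -- The supremum l of the Rayleigh quotient is an eigenvalue: if l I - A, which is positive
  -- semidefinite, had no kernel, it would dominate a positive multiple of x ∙ x, and l would not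
  -- be the least upper bound.
  module _ {n} (A : Matrix (suc n)) where
    RayleighQuotient : Carrier → Set
    RayleighQuotient c = ∃ λ x → 0# < x ∙ x × form A x ≈ c * (x ∙ x)

    rayleigh-upper : ∀ {b} → (∀ x → form A x ≤ b * (x ∙ x)) → UpperBound RayleighQuotient b
    rayleigh-upper {b} form≤ c (x , 0<x² , eq) = *-cancelˡ-≤ 0<x² (begin
      (x ∙ x) * c  ≈⟨ *-comm _ _ ⟩
      c * (x ∙ x)  ≈⟨ eq ⟨
      form A x     ≤⟨ form≤ x ⟩
      b * (x ∙ x)  ≈⟨ *-comm _ _ ⟩
      (x ∙ x) * b  ∎)
      where open ≤-Reasoning

    rayleigh-quotient : ∀ x → 0# < x ∙ x → form A x ≈ form A x * (x ∙ x) ⁻¹ * (x ∙ x)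
    rayleigh-quotient x 0<x² = begin
      form A x                            ≈⟨ *-identityʳ _ ⟨
      form A x * 1#                       ≈⟨ *-congˡ (⁻¹-inverseˡ (x ∙ x) (0<⇒≉0 0<x²)) ⟨
      form A x * ((x ∙ x) ⁻¹ * (x ∙ x))   ≈⟨ *-assoc _ _ _ ⟨
      form A x * (x ∙ x) ⁻¹ * (x ∙ x)     ∎
      where open ≈-Reasoning

    supremum-eigenvector : Symmetric A → ∀ l → UpperBound RayleighQuotient l →
      (∀ b → UpperBound RayleighQuotient b → l ≤ b) → ∃ λ v → ¬ (v ≈ᵛ 0ᵛ) × A · v ≈ᵛ l *ᵛ v
    supremum-eigenvector A-sym l l-upper l-least = conclude (kernel-or-coercive M-sym M-psd)
      where
      M : Matrix (suc n)
      M = l • identity -ᴹ A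

      M-sym : Symmetric M
      M-sym i j = +-cong (*-congˡ (identity-sym i j)) (-‿cong (A-sym i j))

      form≤l : ∀ x → 0# < x ∙ x → form A x ≤ l * (x ∙ x)
      form≤l x 0<x² = begin
        form A x                          ≈⟨ rayleigh-quotient x 0<x² ⟩
        form A x * (x ∙ x) ⁻¹ * (x ∙ x)   ≤⟨ *-monoˡ-≤ (∙-nonNegative x) (l-upper _ (x , 0<x² , rayleigh-quotient x 0<x²)) ⟩
        l * (x ∙ x)                       ∎
        where open ≤-Reasoning

      M-psd : ∀ x → 0# ≤ form M x
      M-psd x = case ≈0? x of λ where
        (inj₁ x≈0)         → DTO.reflexive (sym (form-zero M x≈0))
        (inj₂ (i , xᵢ≉0))  → DTO.trans (x≤y⇒0≤y-x (form≤l x (∙-positive {v = x} λ x≈0 → xᵢ≉0 (x≈0 i)))) (DTO.reflexive (sym (shift-form A l x)))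

      conclude : (∃ λ v → ¬ (v ≈ᵛ 0ᵛ) × M · v ≈ᵛ 0ᵛ) ⊎ (∃ λ C → 0# < C × (∀ x → x ∙ x ≤ C * form M x)) →
                 ∃ λ v → ¬ (v ≈ᵛ 0ᵛ) × A · v ≈ᵛ l *ᵛ v
      conclude (inj₁ (v , v≉0 , Mv≈0)) = v , v≉0 , λ i → begin
        A i ∙ v                          ≈⟨ solve 2 (λ a b → a := b :- (b :- a)) refl (A i ∙ v) (l * v i) ⟩
        l * v i - (l * v i - A i ∙ v)    ≈⟨ +-congˡ (-‿cong (trans (sym (shift-row A l v i)) (Mv≈0 i))) ⟩
        l * v i - 0#                     ≈⟨ solve 1 (λ x → x :- :0 := x) refl (l * v i) ⟩
        l * v i                          ∎
        where open ≈-Reasoning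
      conclude (inj₂ (C , 0<C , coercive)) = contradiction (l-least (l - ι) (rayleigh-upper form≤)) (<⇒≱ l-ι<l)
        where
        ι = C ⁻¹
        0<ι = ⁻¹-positive 0<C

        form≤ : ∀ x → form A x ≤ (l - ι) * (x ∙ x)
        form≤ x = ≤-by (ι * (C * form M x - x ∙ x)) (*-nonNegative (proj₁ 0<ι) (x≤y⇒0≤y-x (coercive x))) (begin
          (l - ι) * (x ∙ x)                               ≈⟨ solve 4 (λ l ι S a → (l :- ι) :* S := a :+ (:1 :* (l :* S :- a) :- ι :* S)) refl l ι (x ∙ x) (form A x) ⟩
          form A x + (1# * (l * (x ∙ x) - form A x) - ι * (x ∙ x)) ≈⟨ +-congˡ (+-congʳ (*-cong (sym (⁻¹-inverseʳ C (0<⇒≉0 0<C))) (sym (shift-form A l x)))) ⟩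
          form A x + (C * ι * form M x - ι * (x ∙ x))     ≈⟨ +-congˡ (solve 4 (λ C ι q S → C :* ι :* q :- ι :* S := ι :* (C :* q :- S)) refl C ι (form M x) (x ∙ x)) ⟩
          form A x + ι * (C * form M x - x ∙ x)           ∎)
          where open ≈-Reasoning

        l-ι<l : l - ι < l
        l-ι<l = 0<y-x⇒x<y (<-respʳ-≈ (solve 2 (λ l ι → ι := l :- (l :- ι)) refl l ι) 0<ι)

    ∃-eigenvector : Symmetric A → ∃₂ λ l v → ¬ (v ≈ᵛ 0ᵛ) × A · v ≈ᵛ l *ᵛ v
    ∃-eigenvector A-sym =
      let l , l-upper , l-least = supremum RayleighQuotient
            (form A e₀ * (e₀ ∙ e₀) ⁻¹ , e₀ , 0<e₀² , rayleigh-quotient e₀ 0<e₀²)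
            (proj₁ (form-bounded A) , rayleigh-upper (proj₂ (form-bounded A)))
      in l , supremum-eigenvector A-sym l l-upper l-least
      where
      e₀ : Vector Carrier (suc n)
      e₀ = identity zero

      0<e₀² : 0# < e₀ ∙ e₀
      0<e₀² = ∙-positive {v = e₀} λ e≈0 → 0≉1 (sym (e≈0 zero))

  -- The sign of the first coordinate is free, as -u is an eigenvector along with u. Making it
  -- nonpositive gives 1 - u₀ ≥ 1, and this is the number that `Householder` divides by.
  ∃-unit-eigenvector : ∀ {n} (A : Matrix (suc n)) → Symmetric A →
                       ∃₂ λ l u → u ∙ u ≈ 1# × u zero ≤ 0# × A · u ≈ᵛ l *ᵛ u
  ∃-unit-eigenvector {n} A A-sym =
    let l , v , v≉0 , Av≈lv = ∃-eigenvector A A-sym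
        s , 0≤s , s²≈v² = ∃-sqrt (v ∙ v) (∙-nonNegative v)
    in l , normalize l v s (∙-positive v≉0) s²≈v² Av≈lv
    where
    eigen-* : ∀ {l v} c → A · v ≈ᵛ l *ᵛ v → A · (c *ᵛ v) ≈ᵛ l *ᵛ (c *ᵛ v)
    eigen-* {l} {v} c eq i = begin
      A i ∙ (c *ᵛ v)  ≈⟨ ∙-*ʳ c (A i) v ⟩
      c * (A i ∙ v)   ≈⟨ *-congˡ (eq i) ⟩
      c * (l * v i)   ≈⟨ solve 3 (λ c l v → c :* (l :* v) := l :* (c :* v)) refl c l (v i) ⟩
      l * (c * v i)   ∎
      where open ≈-Reasoning

    normalize : ∀ l v s → 0# < v ∙ v → s * s ≈ v ∙ v → A · v ≈ᵛ l *ᵛ v →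
                ∃ λ u → u ∙ u ≈ 1# × u zero ≤ 0# × A · u ≈ᵛ l *ᵛ u
    normalize l v s 0<v² s²≈v² Av≈lv = case DTO.total (s ⁻¹ * v zero) 0# of λ where
        (inj₁ u₀≤0) → s ⁻¹ *ᵛ v , norm (s ⁻¹) refl , u₀≤0 , eigen-* (s ⁻¹) Av≈lv
        (inj₂ 0≤u₀) → (- (s ⁻¹)) *ᵛ v , norm (- (s ⁻¹)) (solve 1 (λ c → :- c :* :- c := c :* c) refl (s ⁻¹)) ,
          0≤-x⇒x≤0 (DTO.trans 0≤u₀ (DTO.reflexive (solve 2 (λ c v → c :* v := :- (:- c :* v)) refl (s ⁻¹) (v zero)))) ,
          eigen-* (- (s ⁻¹)) Av≈lv
      where
      s≉0 : ¬ (s ≈ 0#)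
      s≉0 s≈0 = 0<⇒≉0 0<v² (trans (sym s²≈v²) (trans (*-congʳ s≈0) (zeroˡ s)))

      norm : ∀ c → c * c ≈ s ⁻¹ * s ⁻¹ → (c *ᵛ v) ∙ (c *ᵛ v) ≈ 1#
      norm c c²≈ = begin
        (c *ᵛ v) ∙ (c *ᵛ v)          ≈⟨ trans (∙-*ˡ c v (c *ᵛ v)) (*-congˡ (∙-*ʳ c v v)) ⟩
        c * (c * (v ∙ v))            ≈⟨ *-assoc _ _ _ ⟨
        c * c * (v ∙ v)              ≈⟨ *-cong c²≈ (sym s²≈v²) ⟩
        s ⁻¹ * s ⁻¹ * (s * s)        ≈⟨ solve 2 (λ i s → i :* i :* (s :* s) := i :* s :* (i :* s)) refl (s ⁻¹) s ⟩
        s ⁻¹ * s * (s ⁻¹ * s)        ≈⟨ *-cong (⁻¹-inverseˡ s s≉0) (⁻¹-inverseˡ s s≉0) ⟩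
        1# * 1#                      ≈⟨ *-identityˡ 1# ⟩
        1#                           ∎
        where open ≈-Reasoning

  -- Householder deflation and orthogonal diagonalisation

  ≈ᴹ-refl : ∀ {n} {A : Matrix n} → A ≈ᴹ A
  ≈ᴹ-refl i j = refl

  ≈ᴹ-trans : ∀ {n} {A B C : Matrix n} → A ≈ᴹ B → B ≈ᴹ C → A ≈ᴹ C
  ≈ᴹ-trans p q i j = trans (p i j) (q i j)

  ≈ᴹ-sym : ∀ {n} {A B : Matrix n} → A ≈ᴹ B → B ≈ᴹ A
  ≈ᴹ-sym p i j = sym (p i j)

  *ᴹ-congˡ : ∀ {n} (A : Matrix n) {B C} → B ≈ᴹ C → A *ᴹ B ≈ᴹ A *ᴹ C
  *ᴹ-congˡ A = *ᴹ-cong {A = A} ≈ᴹ-refl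

  *ᴹ-congʳ : ∀ {n} (A : Matrix n) {B C} → B ≈ᴹ C → B *ᴹ A ≈ᴹ C *ᴹ A
  *ᴹ-congʳ A B≈C = *ᴹ-cong {B = A} B≈C ≈ᴹ-refl

  -- The Householder reflection exchanging the unit vectors e₀ and u.
  module Householder {n} (u : Vector Carrier (suc n)) (u²≈1 : u ∙ u ≈ 1#) (u₀≤0 : u zero ≤ 0#) where
    private
      w : Vector Carrier (suc n)
      w i = u i - identity zero i

      c : Carrier
      c = 1# - u zero

      c≉0 : ¬ (c ≈ 0#)
      c≉0 = 0<⇒≉0 (+-positive 0<1 (x≤0⇒0≤-x u₀≤0))

      ι : Carrier
      ι = c ⁻¹

    -- The usual factor 2 / (w ∙ w) of the reflection along `w` equals ι, because w ∙ w = 2 c when u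
    -- is a unit vector.
    H : Matrix (suc n)
    H i j = identity i j - ι * (w i * w j)

    H-symmetric : Symmetric H
    H-symmetric i j = +-cong (identity-sym i j) (-‿cong (*-congˡ (*-comm _ _)))

    private
      w² : w ∙ w ≈ 2# * c
      w² = begin
        sum (λ i → (u i - e i) * (u i - e i))             ≈⟨ (sum-cong-≋ λ i → solve 2 (λ u e →
                                                               (u :- e) :* (u :- e) := u :* u :+ e :* (e :- :2 :* u)) refl (u i) (e i)) ⟩
        sum (λ i → u i * u i + e i * (e i - 2# * u i))    ≈⟨ ∑-distrib-+ (λ i → u i * u i) (λ i → e i * (e i - 2# * u i)) ⟩
        u ∙ u + sum (λ i → e i * (e i - 2# * u i))        ≈⟨ +-cong u²≈1 (identity-sum zero (λ i → e i - 2# * u i)) ⟩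
        1# + (1# - 2# * u zero)                           ≈⟨ solve 1 (λ u → :1 :+ (:1 :- :2 :* u) := :2 :* (:1 :- u)) refl (u zero) ⟩
        2# * c                                            ∎
        where
        open ≈-Reasoning
        e = identity {suc n} zero

      H-w : ∀ j → sum (λ k → w k * H k j) ≈ - w j
      H-w j = begin
        sum (λ k → w k * (identity k j - ι * (w k * w j)))
          ≈⟨ (sum-cong-≋ λ k → trans (solve 4 (λ x e i y → x :* (e :- i :* (x :* y)) := e :* x :+ :- (i :* y) :* (x :* x)) refl (w k) (identity k j) ι (w j))
               (+-congʳ (*-congʳ (identity-sym k j)))) ⟩
        sum (λ k → identity j k * w k + - (ι * w j) * (w k * w k))
          ≈⟨ ∑-distrib-+ (λ k → identity j k * w k) (λ k → - (ι * w j) * (w k * w k)) ⟩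
        sum (λ k → identity j k * w k) + sum (λ k → - (ι * w j) * (w k * w k))
          ≈⟨ +-cong (identity-sum j w) (sym (*-distribˡ-sum (- (ι * w j)) (λ k → w k * w k))) ⟩
        w j + - (ι * w j) * (w ∙ w)        ≈⟨ +-congˡ (*-congˡ w²) ⟩
        w j + - (ι * w j) * (2# * c)       ≈⟨ solve 3 (λ x i c → x :+ :- (i :* x) :* (:2 :* c) := x :* (:1 :- :2 :* (i :* c))) refl (w j) ι c ⟩
        w j * (1# - 2# * (ι * c))          ≈⟨ *-congˡ (+-congˡ (-‿cong (*-congˡ (⁻¹-inverseˡ c c≉0)))) ⟩
        w j * (1# - 2# * 1#)               ≈⟨ solve 1 (λ x → x :* (:1 :- :2 :* :1) := :- x) refl (w j) ⟩
        - w j                              ∎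
        where open ≈-Reasoning

    H-involutive : H *ᴹ H ≈ᴹ identity
    H-involutive i j = begin
      sum (λ k → (identity i k - ι * (w i * w k)) * H k j)
        ≈⟨ (sum-cong-≋ λ k → solve 5 (λ e i x y h → (e :- i :* (x :* y)) :* h := e :* h :+ :- (i :* x) :* (y :* h)) refl (identity i k) ι (w i) (w k) (H k j)) ⟩
      sum (λ k → identity i k * H k j + - (ι * w i) * (w k * H k j))
        ≈⟨ ∑-distrib-+ (λ k → identity i k * H k j) (λ k → - (ι * w i) * (w k * H k j)) ⟩
      sum (λ k → identity i k * H k j) + sum (λ k → - (ι * w i) * (w k * H k j))
        ≈⟨ +-cong (identity-sum i (λ k → H k j)) (sym (*-distribˡ-sum (- (ι * w i)) (λ k → w k * H k j))) ⟩
      H i j + - (ι * w i) * sum (λ k → w k * H k j)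
        ≈⟨ +-congˡ (*-congˡ (H-w j)) ⟩
      identity i j - ι * (w i * w j) + - (ι * w i) * - w j
        ≈⟨ solve 4 (λ e i x y → e :- i :* (x :* y) :+ :- (i :* x) :* :- y := e) refl (identity i j) ι (w i) (w j) ⟩
      identity i j ∎
      where open ≈-Reasoning

    H-column₀ : ∀ i → H i zero ≈ u i
    H-column₀ i = begin
      identity i zero - ι * (w i * (u zero - 1#))
        ≈⟨ +-congʳ (identity-sym i zero) ⟩
      identity zero i - ι * (w i * (u zero - 1#))
        ≈⟨ solve 4 (λ e i x y → e :- i :* (x :* (y :- :1)) := e :+ x :* (i :* (:1 :- y))) refl (identity zero i) ι (w i) (u zero) ⟩
      identity zero i + w i * (ι * c)
        ≈⟨ +-congˡ (*-congˡ (⁻¹-inverseˡ c c≉0)) ⟩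
      identity zero i + (u i - identity zero i) * 1#
        ≈⟨ solve 2 (λ e u → e :+ (u :- e) :* :1 := u) refl (identity zero i) (u i) ⟩
      u i ∎
      where open ≈-Reasoning

  _⊕_ : ∀ {n} → Carrier → Matrix n → Matrix (suc n)
  (a ⊕ B) zero    zero    = a
  (a ⊕ B) zero    (suc j) = 0#
  (a ⊕ B) (suc i) zero    = 0#
  (a ⊕ B) (suc i) (suc j) = B i j

  ⊕-* : ∀ {n} a b (A B : Matrix n) → (a ⊕ A) *ᴹ (b ⊕ B) ≈ᴹ (a * b) ⊕ (A *ᴹ B)
  ⊕-* {n} a b A B zero    zero    = trans (+-congˡ (sum-≈0 {n = n} {f = λ k → 0# * 0#} λ k → zeroˡ 0#)) (+-identityʳ _)
  ⊕-* a b A B zero    (suc j) = trans (+-cong (zeroʳ a) (sum-≈0 λ k → zeroˡ (B k j))) (+-identityʳ 0#)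
  ⊕-* a b A B (suc i) zero    = trans (+-cong (zeroˡ b) (sum-≈0 λ k → zeroʳ (A i k))) (+-identityʳ 0#)
  ⊕-* a b A B (suc i) (suc j) = trans (+-congʳ (zeroˡ 0#)) (+-identityˡ _)

  ⊕-cong : ∀ {n} {a b} {A B : Matrix n} → a ≈ b → A ≈ᴹ B → a ⊕ A ≈ᴹ b ⊕ B
  ⊕-cong p q zero    zero    = p
  ⊕-cong p q zero    (suc j) = refl
  ⊕-cong p q (suc i) zero    = refl
  ⊕-cong p q (suc i) (suc j) = q i j

  ⊕-transpose : ∀ {n} a (A : Matrix n) → transpose (a ⊕ A) ≈ᴹ a ⊕ transpose A
  ⊕-transpose a A zero    zero    = refl
  ⊕-transpose a A zero    (suc j) = refl
  ⊕-transpose a A (suc i) zero    = refl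
  ⊕-transpose a A (suc i) (suc j) = refl

  ⊕-identity : ∀ {n} → 1# ⊕ identity {n} ≈ᴹ identity
  ⊕-identity zero    zero    = refl
  ⊕-identity zero    (suc j) = refl
  ⊕-identity (suc i) zero    = refl
  ⊕-identity (suc i) (suc j) = refl

  ⊕-diagonal : ∀ {n} a (d : Vector Carrier n) → a ⊕ diagonal d ≈ᴹ diagonal (a ∷ d)
  ⊕-diagonal a d zero    zero    = sym (*-identityʳ a)
  ⊕-diagonal a d zero    (suc j) = sym (zeroʳ a)
  ⊕-diagonal a d (suc i) zero    = sym (zeroʳ (d i))
  ⊕-diagonal a d (suc i) (suc j) = refl

  record Orthogonal {n} (Q : Matrix n) : Set where
    field
      QQᵀ≈I : Q *ᴹ transpose Q ≈ᴹ identity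
      QᵀQ≈I : transpose Q *ᴹ Q ≈ᴹ identity

  record Diagonalizes {n} (Q : Matrix n) (d : Vector Carrier n) (A : Matrix n) : Set where
    constructor diagonalizes
    field
      A≈QDQᵀ : A ≈ᴹ Q *ᴹ diagonal d *ᴹ transpose Q

  *ᴹ-conjugate : ∀ {n} (A B C : Matrix n) →
                 A *ᴹ B *ᴹ C *ᴹ transpose (A *ᴹ B) ≈ᴹ A *ᴹ (B *ᴹ C *ᴹ transpose B) *ᴹ transpose A
  *ᴹ-conjugate A B C =
    ≈ᴹ-trans (*ᴹ-cong (*ᴹ-assoc A B C) (transpose-*ᴹ A B))
    (≈ᴹ-trans (≈ᴹ-sym (*ᴹ-assoc (A *ᴹ (B *ᴹ C)) (transpose B) (transpose A)))
    (*ᴹ-congʳ (transpose A) (*ᴹ-assoc A (B *ᴹ C) (transpose B))))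

  *ᴹ-cancel : ∀ {n} {A B A′ B′ : Matrix n} → B *ᴹ B′ ≈ᴹ identity → A *ᴹ A′ ≈ᴹ identity →
              A *ᴹ B *ᴹ (B′ *ᴹ A′) ≈ᴹ identity
  *ᴹ-cancel {A = A} {B} {A′} {B′} BB′ AA′ =
    ≈ᴹ-trans (≈ᴹ-sym (*ᴹ-assoc (A *ᴹ B) B′ A′))
    (≈ᴹ-trans (*ᴹ-congʳ A′ (≈ᴹ-trans (*ᴹ-assoc A B B′) (≈ᴹ-trans (*ᴹ-congˡ A BB′) (*ᴹ-identityʳ A)))) AA′)

  orthogonal-* : ∀ {n} {P Q : Matrix n} → Orthogonal P → Orthogonal Q → Orthogonal (P *ᴹ Q)
  orthogonal-* {P = P} {Q} p q = record
    { QQᵀ≈I = ≈ᴹ-trans (*ᴹ-congˡ (P *ᴹ Q) (transpose-*ᴹ P Q)) (*ᴹ-cancel (QQᵀ≈I q) (QQᵀ≈I p))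
    ; QᵀQ≈I = ≈ᴹ-trans (*ᴹ-congʳ (P *ᴹ Q) (transpose-*ᴹ P Q)) (*ᴹ-cancel (QᵀQ≈I p) (QᵀQ≈I q))
    }
    where open Orthogonal

  orthogonal-⊕ : ∀ {n} {Q : Matrix n} → Orthogonal Q → Orthogonal (1# ⊕ Q)
  orthogonal-⊕ {Q = Q} q = record
    { QQᵀ≈I = ≈ᴹ-trans (*ᴹ-congˡ (1# ⊕ Q) (⊕-transpose 1# Q)) (≈ᴹ-trans (⊕-* 1# 1# Q (transpose Q))
               (≈ᴹ-trans (⊕-cong (*-identityˡ 1#) (QQᵀ≈I q)) ⊕-identity))
    ; QᵀQ≈I = ≈ᴹ-trans (*ᴹ-congʳ (1# ⊕ Q) (⊕-transpose 1# Q)) (≈ᴹ-trans (⊕-* 1# 1# (transpose Q) Q)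
               (≈ᴹ-trans (⊕-cong (*-identityˡ 1#) (QᵀQ≈I q)) ⊕-identity))
    }
    where open Orthogonal

  diagonalizes-⊕ : ∀ {n} {Q : Matrix n} {d A} l → Diagonalizes Q d A → Diagonalizes (1# ⊕ Q) (l ∷ d) (l ⊕ A)
  diagonalizes-⊕ {Q = Q} {d} l (diagonalizes eq) = diagonalizes
    (≈ᴹ-trans (⊕-cong (sym (trans (*-identityʳ _) (*-identityˡ l))) eq)
    (≈ᴹ-trans (≈ᴹ-sym (⊕-* (1# * l) 1# (Q *ᴹ diagonal d) (transpose Q)))
    (*ᴹ-cong (≈ᴹ-trans (≈ᴹ-sym (⊕-* 1# l Q (diagonal d))) (*ᴹ-congˡ (1# ⊕ Q) (⊕-diagonal l d))) (≈ᴹ-sym (⊕-transpose 1# Q)))))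

  diagonalizes-conjugate : ∀ {n} {P Q : Matrix n} {d A B} → A ≈ᴹ P *ᴹ B *ᴹ transpose P →
                           Diagonalizes Q d B → Diagonalizes (P *ᴹ Q) d A
  diagonalizes-conjugate {P = P} {Q} {d} A≈ (diagonalizes B≈) = diagonalizes
    (≈ᴹ-trans A≈ (≈ᴹ-trans (*ᴹ-congʳ (transpose P) (*ᴹ-congˡ P B≈)) (≈ᴹ-sym (*ᴹ-conjugate P Q (diagonal d)))))

  symmetric-conjugate : ∀ {n} {A H : Matrix n} → Symmetric A → Symmetric H → Symmetric (H *ᴹ (A *ᴹ H))
  symmetric-conjugate {A = A} {H} A-sym H-sym i j = begin
    (H *ᴹ (A *ᴹ H)) i j                      ≈⟨ *ᴹ-cong H-sym (*ᴹ-cong A-sym H-sym) i j ⟩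
    (transpose H *ᴹ (transpose A *ᴹ transpose H)) i j  ≈⟨ *ᴹ-congˡ (transpose H) (transpose-*ᴹ H A) i j ⟨
    (transpose H *ᴹ transpose (H *ᴹ A)) i j  ≈⟨ transpose-*ᴹ (H *ᴹ A) H i j ⟨
    ((H *ᴹ A) *ᴹ H) j i                      ≈⟨ *ᴹ-assoc H A H j i ⟩
    (H *ᴹ (A *ᴹ H)) j i                      ∎
    where open ≈-Reasoning

  -- Let H be the reflection with H e₀ = u for a unit eigenvector u. Then H A H e₀ = H A u = l H u =
  -- l e₀, so the conjugated matrix has first column l e₀; symmetry clears its first row, and the
  -- induction diagonalises the remaining block.
  diagonalize : ∀ {n} (A : Matrix n) → Symmetric A → ∃₂ λ Q d → Orthogonal Q × Diagonalizes Q d A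
  diagonalize {zero}  A A-sym = identity , 0ᵛ , record { QQᵀ≈I = λ () ; QᵀQ≈I = λ () } , diagonalizes λ ()
  diagonalize {suc n} A A-sym =
    let l , u , u²≈1 , u₀≤0 , Au≈lu = ∃-unit-eigenvector A A-sym
    in deflate l u u²≈1 u₀≤0 Au≈lu
    where
    deflate : ∀ l u → u ∙ u ≈ 1# → u zero ≤ 0# → A · u ≈ᵛ l *ᵛ u → ∃₂ λ Q d → Orthogonal Q × Diagonalizes Q d A
    deflate l u u²≈1 u₀≤0 Au≈lu =
      let Q , d , Q-orthogonal , Q-diag = diagonalize (λ i j → B (suc i) (suc j)) (λ i j → B-sym (suc i) (suc j))
      in H *ᴹ (1# ⊕ Q) , l ∷ d , orthogonal-* H-orthogonal (orthogonal-⊕ Q-orthogonal) ,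
         diagonalizes-conjugate {P = H} {B = l ⊕ (λ i j → B (suc i) (suc j))} A≈HBH (diagonalizes-⊕ l Q-diag)
      where
      open Householder u u²≈1 u₀≤0

      B : Matrix (suc n)
      B = H *ᴹ (A *ᴹ H)

      B-sym : Symmetric B
      B-sym = symmetric-conjugate A-sym H-symmetric

      H-orthogonal : Orthogonal H
      H-orthogonal = record
        { QQᵀ≈I = ≈ᴹ-trans (*ᴹ-congˡ H {transpose H} (λ i j → H-symmetric j i)) H-involutive
        ; QᵀQ≈I = ≈ᴹ-trans (*ᴹ-congʳ H {transpose H} (λ i j → H-symmetric j i)) H-involutive
        }

      B-column₀ : ∀ i → B i zero ≈ l * identity i zero
      B-column₀ i = begin
        sum (λ k → H i k * sum (λ m → A k m * H m zero)) ≈⟨ (sum-cong-≋ λ k → *-congˡ {H i k} (trans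
                                                              (sum-cong-≋ λ m → *-congˡ {A k m} (H-column₀ m)) (Au≈lu k))) ⟩
        sum (λ k → H i k * (l * u k))                    ≈⟨ (sum-cong-≋ λ k → trans (solve 3 (λ h l u → h :* (l :* u) := l :* (h :* u)) refl (H i k) l (u k))
                                                              (*-congˡ (*-congˡ (sym (H-column₀ k))))) ⟩
        sum (λ k → l * (H i k * H k zero))               ≈⟨ *-distribˡ-sum l (λ k → H i k * H k zero) ⟨
        l * (H *ᴹ H) i zero                              ≈⟨ *-congˡ (H-involutive i zero) ⟩
        l * identity i zero                              ∎
        where open ≈-Reasoning

      B≈⊕ : B ≈ᴹ l ⊕ (λ i j → B (suc i) (suc j))
      B≈⊕ zero    zero    = trans (B-column₀ zero) (*-identityʳ l)
      B≈⊕ zero    (suc j) = trans (B-sym zero (suc j)) (trans (B-column₀ (suc j)) (zeroʳ l))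
      B≈⊕ (suc i) zero    = trans (B-column₀ (suc i)) (zeroʳ l)
      B≈⊕ (suc i) (suc j) = refl

      HBH≈A : H *ᴹ B *ᴹ H ≈ᴹ A
      HBH≈A = ≈ᴹ-trans (*ᴹ-congʳ H (≈ᴹ-trans (≈ᴹ-sym (*ᴹ-assoc H H (A *ᴹ H)))
                                  (≈ᴹ-trans (*ᴹ-congʳ (A *ᴹ H) H-involutive) (*ᴹ-identityˡ (A *ᴹ H)))))
               (≈ᴹ-trans (*ᴹ-assoc A H H) (≈ᴹ-trans (*ᴹ-congˡ A H-involutive) (*ᴹ-identityʳ A)))

      A≈HBH : A ≈ᴹ H *ᴹ (l ⊕ (λ i j → B (suc i) (suc j))) *ᴹ transpose H
      A≈HBH = ≈ᴹ-trans (≈ᴹ-sym HBH≈A) (*ᴹ-cong (*ᴹ-congˡ H B≈⊕) H-symmetric)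

  -- Eigenvalues and trace norm

  conjugate-entry : ∀ {n} (Q : Matrix n) d i j →
                    (Q *ᴹ diagonal d *ᴹ transpose Q) i j ≈ sum λ k → d k * (Q i k * Q j k)
  conjugate-entry Q d i j = sum-cong-≋ λ k → trans (*-congʳ (begin
    sum (λ m → Q i m * (d m * identity m k))  ≈⟨ (sum-cong-≋ λ m → trans (*-congˡ {Q i m} (*-congˡ {d m} (identity-sym m k)))
                                                   (solve 3 (λ q d e → q :* (d :* e) := e :* (d :* q)) refl (Q i m) (d m) (identity k m))) ⟩
    sum (λ m → identity k m * (d m * Q i m))  ≈⟨ identity-sum k (λ m → d m * Q i m) ⟩
    d k * Q i k                               ∎)) (*-assoc _ _ _)
    where open ≈-Reasoning

  diagonalizes-entry : ∀ {n} {Q : Matrix n} {d A} → Diagonalizes Q d A → ∀ i j → A i j ≈ sum λ k → d k * (Q i k * Q j k)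
  diagonalizes-entry {Q = Q} {d} (diagonalizes eq) i j = trans (eq i j) (conjugate-entry Q d i j)

  entry-diagonalizes : ∀ {n} {Q : Matrix n} {d A} → (∀ i j → A i j ≈ sum λ k → d k * (Q i k * Q j k)) → Diagonalizes Q d A
  entry-diagonalizes {Q = Q} {d} eq = diagonalizes λ i j → trans (eq i j) (sym (conjugate-entry Q d i j))

  module _ {n} {Q : Matrix n} {d A} (Q-orthogonal : Orthogonal Q) (Q-diag : Diagonalizes Q d A) where
    open Orthogonal Q-orthogonal

    diagonalizes-symmetric : Symmetric A
    diagonalizes-symmetric i j = trans (diagonalizes-entry Q-diag i j)
      (trans (sum-cong-≋ λ k → *-congˡ (*-comm (Q i k) (Q j k))) (sym (diagonalizes-entry Q-diag j i)))

    -- Orthogonality writes I as Q Qᵀ, so I and A are diagonal in the same basis. The case s = -1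
    -- gives the characteristic matrix x I - A, the case s = 1 the shifts A + t I.
    diagonalizes-affine : ∀ x s → Diagonalizes Q (λ k → x + s * d k) (λ i j → x * identity i j + s * A i j)
    diagonalizes-affine x s = entry-diagonalizes λ i j → begin
      x * identity i j + s * A i j
        ≈⟨ +-cong (*-congˡ (sym (QQᵀ≈I i j))) (*-congˡ (diagonalizes-entry Q-diag i j)) ⟩
      x * sum (λ k → Q i k * Q j k) + s * sum (λ k → d k * (Q i k * Q j k))
        ≈⟨ +-cong (*-distribˡ-sum x (λ k → Q i k * Q j k)) (*-distribˡ-sum s (λ k → d k * (Q i k * Q j k))) ⟩
      sum (λ k → x * (Q i k * Q j k)) + sum (λ k → s * (d k * (Q i k * Q j k)))
        ≈⟨ ∑-distrib-+ (λ k → x * (Q i k * Q j k)) (λ k → s * (d k * (Q i k * Q j k))) ⟨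
      sum (λ k → x * (Q i k * Q j k) + s * (d k * (Q i k * Q j k)))
        ≈⟨ (sum-cong-≋ λ k → solve 4 (λ x s d q → x :* q :+ s :* (d :* q) := (x :+ s :* d) :* q) refl x s (d k) (Q i k * Q j k)) ⟩
      sum (λ k → (x + s * d k) * (Q i k * Q j k)) ∎
      where open ≈-Reasoning

    diagonalizes-eigenvalues : Eigenvalues A d
    diagonalizes-eigenvalues x = begin
      det (x • identity -ᴹ A)
        ≈⟨ det-cong n (λ i j → trans (+-congˡ (sym (solve 1 (λ a → :- :1 :* a := :- a) refl (A i j))))
             (Diagonalizes.A≈QDQᵀ (diagonalizes-affine x (- 1#)) i j)) ⟩
      det (Q *ᴹ diagonal (λ k → x + - 1# * d k) *ᴹ transpose Q)
        ≈⟨ det-*ᴹ (Q *ᴹ diagonal (λ k → x + - 1# * d k)) (transpose Q) ⟩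
      det (Q *ᴹ diagonal (λ k → x + - 1# * d k)) * det (transpose Q)
        ≈⟨ *-congʳ (det-*ᴹ Q (diagonal (λ k → x + - 1# * d k))) ⟩
      det Q * det (diagonal (λ k → x + - 1# * d k)) * det (transpose Q)
        ≈⟨ solve 3 (λ q p r → q :* p :* r := q :* r :* p) refl (det Q) (det (diagonal (λ k → x + - 1# * d k))) (det (transpose Q)) ⟩
      det Q * det (transpose Q) * det (diagonal (λ k → x + - 1# * d k))
        ≈⟨ *-cong (trans (sym (det-*ᴹ Q (transpose Q))) (trans (det-cong n QQᵀ≈I) (det-identity n)))
             (trans (det-diagonal (λ k → x + - 1# * d k)) (product-cong-≋ λ k → +-congˡ (solve 1 (λ a → :- :1 :* a := :- a) refl (d k)))) ⟩
      1# * product (λ k → x - d k)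
        ≈⟨ *-identityˡ _ ⟩
      product (λ k → x - d k) ∎
      where open ≈-Reasoning

    -- A is symmetric, so Aᵀ A = A² = Q D² Qᵀ; this makes the absolute values of the `d k` singular
    -- values of A.
    diagonalizes-gram : Diagonalizes Q (λ k → d k * d k) (transpose A *ᴹ A)
    diagonalizes-gram = diagonalizes
      (≈ᴹ-trans (*ᴹ-cong (≈ᴹ-trans {B = A} (λ i j → diagonalizes-symmetric j i) A≈QDQᵀ) A≈QDQᵀ)
      (≈ᴹ-trans (≈ᴹ-sym (*ᴹ-assoc (Q *ᴹ D *ᴹ transpose Q) (Q *ᴹ D) (transpose Q)))
      (*ᴹ-congʳ (transpose Q)
        (≈ᴹ-trans (*ᴹ-assoc (Q *ᴹ D) (transpose Q) (Q *ᴹ D))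
        (≈ᴹ-trans (*ᴹ-congˡ (Q *ᴹ D) (≈ᴹ-trans (≈ᴹ-sym (*ᴹ-assoc (transpose Q) Q D)) (≈ᴹ-trans (*ᴹ-congʳ D QᵀQ≈I) (*ᴹ-identityˡ D))))
        (≈ᴹ-trans (*ᴹ-assoc Q D D) (*ᴹ-congˡ Q D²)))))))
      where
      open Diagonalizes Q-diag
      D : Matrix n
      D = diagonal d
      D² : D *ᴹ D ≈ᴹ diagonal (λ k → d k * d k)
      D² i j = begin
        sum (λ k → d i * identity i k * (d k * identity k j))   ≈⟨ (sum-cong-≋ λ k →
            solve 4 (λ d e c f → d :* e :* (c :* f) := e :* (d :* c :* f)) refl (d i) (identity i k) (d k) (identity k j)) ⟩
        sum (λ k → identity i k * (d i * d k * identity k j))   ≈⟨ identity-sum i (λ k → d i * d k * identity k j) ⟩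
        d i * d i * identity i j                                ∎
        where open ≈-Reasoning

    diagonalizes-form : ∀ x → form A x ≈ sum λ k → d k * ((transpose Q · x) k * (transpose Q · x) k)
    diagonalizes-form x = begin
      sum (λ i → x i * sum (λ j → A i j * x j))
        ≈⟨ (sum-cong-≋ λ i → *-congˡ {x i} (sum-cong-≋ λ j → *-congʳ {x j} (diagonalizes-entry Q-diag i j))) ⟩
      sum (λ i → x i * sum (λ j → sum (λ k → d k * (Q i k * Q j k)) * x j))
        ≈⟨ (sum-cong-≋ λ i → *-congˡ {x i} (sum-cong-≋ λ j → *-distribʳ-sum (x j) (λ k → d k * (Q i k * Q j k)))) ⟩
      sum (λ i → x i * sum (λ j → sum (λ k → d k * (Q i k * Q j k) * x j)))
        ≈⟨ (sum-cong-≋ λ i → *-congˡ {x i} (∑-comm (λ j k → d k * (Q i k * Q j k) * x j))) ⟩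
      sum (λ i → x i * sum (λ k → sum (λ j → d k * (Q i k * Q j k) * x j)))
        ≈⟨ (sum-cong-≋ λ i → *-congˡ {x i} (sum-cong-≋ λ k → trans
             (sum-cong-≋ λ j → solve 4 (λ d q r x → d :* (q :* r) :* x := d :* q :* (r :* x)) refl (d k) (Q i k) (Q j k) (x j))
             (sym (*-distribˡ-sum (d k * Q i k) (λ j → Q j k * x j))))) ⟩
      sum (λ i → x i * sum (λ k → d k * Q i k * y k))
        ≈⟨ (sum-cong-≋ λ i → *-distribˡ-sum (x i) (λ k → d k * Q i k * y k)) ⟩
      sum (λ i → sum (λ k → x i * (d k * Q i k * y k)))
        ≈⟨ ∑-comm (λ i k → x i * (d k * Q i k * y k)) ⟩
      sum (λ k → sum (λ i → x i * (d k * Q i k * y k)))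
        ≈⟨ (sum-cong-≋ λ k → trans
             (sum-cong-≋ λ i → solve 4 (λ x d q y → x :* (d :* q :* y) := d :* y :* (q :* x)) refl (x i) (d k) (Q i k) (y k))
             (sym (*-distribˡ-sum (d k * y k) (λ i → Q i k * x i)))) ⟩
      sum (λ k → d k * y k * y k)
        ≈⟨ (sum-cong-≋ λ k → *-assoc (d k) (y k) (y k)) ⟩
      sum (λ k → d k * (y k * y k)) ∎
      where
      open ≈-Reasoning
      y = transpose Q · x

  abs : Carrier → Carrier
  abs x with DTO.total 0# x
  ... | inj₁ _ = x
  ... | inj₂ _ = - x

  abs-nonNegative : ∀ x → 0# ≤ abs x
  abs-nonNegative x with DTO.total 0# x
  ... | inj₁ 0≤x = 0≤x
  ... | inj₂ x≤0 = x≤0⇒0≤-x x≤0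

  abs-square : ∀ x → abs x * abs x ≈ x * x
  abs-square x with DTO.total 0# x
  ... | inj₁ _ = refl
  ... | inj₂ _ = solve 1 (λ x → :- x :* :- x := x :* x) refl x

  0≤x⇒abs≈x : ∀ {x} → 0# ≤ x → abs x ≈ x
  0≤x⇒abs≈x {x} 0≤x with DTO.total 0# x
  ... | inj₁ _   = refl
  ... | inj₂ x≤0 = trans (-‿cong x≈0) (trans -0#≈0# (sym x≈0))
    where x≈0 = DTO.antisym x≤0 0≤x

  -- At 0 the branch of `abs` depends on what totality of the order returns, so the two sides are
  -- compared through their squares.
  abs-neg : ∀ x → abs (- x) ≈ abs x
  abs-neg x = x²≈y²⇒x≈y (abs-nonNegative (- x)) (abs-nonNegative x)
    (trans (abs-square (- x)) (trans (solve 1 (λ x → :- x :* :- x := x :* x) refl x) (sym (abs-square x))))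

  x≤0⇒abs≈-x : ∀ {x} → x ≤ 0# → abs x ≈ - x
  x≤0⇒abs≈-x {x} x≤0 = trans (sym (abs-neg x)) (0≤x⇒abs≈x (x≤0⇒0≤-x x≤0))

  x≤abs : ∀ x → x ≤ abs x
  x≤abs x with DTO.total 0# x
  ... | inj₁ _   = ≤-refl
  ... | inj₂ x≤0 = DTO.trans x≤0 (x≤0⇒0≤-x x≤0)

  -x≤abs : ∀ x → - x ≤ abs x
  -x≤abs x = DTO.trans (x≤abs (- x)) (DTO.reflexive (abs-neg x))

  diagonalizes-traceNorm : ∀ {n} {Q : Matrix n} {d A} → Orthogonal Q → Diagonalizes Q d A →
                           TraceNorm A (sum (λ i → abs (d i)))
  diagonalizes-traceNorm {d = d} Q-orthogonal Q-diag =
    (λ i → abs (d i)) ,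
    ((λ i → abs-nonNegative (d i)) ,
     λ x → trans (diagonalizes-eigenvalues Q-orthogonal (diagonalizes-gram Q-orthogonal Q-diag) x)
             (product-cong-≋ λ k → +-congˡ (-‿cong (sym (abs-square (d k)))))) ,
    refl

  -- The bound on the square of the difference quotient is written K * 1# to fit square-sum-bound.
  LipschitzAt : Carrier → (Carrier → Carrier) → Set
  LipschitzAt a f = ∃ λ K → 0# ≤ K × (∀ h → 0# ≤ h → h ≤ 1# → ∃ λ k → f (a + h) ≈ f a + h * k × k * k ≤ K * 1#)

  -- Product rule: the factor β + h turns p + h k into β p + h (p + (β + h) k). The constant `E`
  -- bounds (β + h)² for 0 ≤ h ≤ 1.
  lipschitz-product : ∀ {n} a (b : Vector Carrier n) → LipschitzAt a (λ x → product (λ i → x - b i))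
  lipschitz-product {zero} a b = 0# , ≤-refl , λ h _ _ →
    0# , solve 1 (λ h → :1 := :1 :+ h :* :0) refl h , DTO.reflexive (solve 0 (:0 :* :0 := :0 :* :1) refl)
  lipschitz-product {suc n} a b =
    let K , 0≤K , lip = lipschitz-product a (b ∘ suc)
        E = 2# * (β * β + 1#)
        0≤E = *-nonNegative (proj₁ 0<2) (+-nonNegative (0≤x² β) 0≤1)
    in 2# * (p * p + E * K) , *-nonNegative (proj₁ 0<2) (+-nonNegative (0≤x² p) (*-nonNegative 0≤E 0≤K)) ,
       λ h 0≤h h≤1 →
         let k , eq , k²≤K = lip h 0≤h h≤1
         in p + (β + h) * k ,
            trans (*-congˡ eq) (solve 5 (λ a h b p k → (a :+ h :- b) :* (p :+ h :* k) :=
              (a :- b) :* p :+ h :* (p :+ (a :- b :+ h) :* k)) refl a h (b zero) p k) ,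
            square-sum-bound (DTO.reflexive (sym (*-identityʳ (p * p))))
              (begin
                (β + h) * k * ((β + h) * k)          ≤⟨ square-scale-bound (β + h) k²≤K ⟩
                (β + h) * (β + h) * K * 1#           ≤⟨ *-monoˡ-≤ 0≤1 (*-monoˡ-≤ 0≤K (begin
                  (β + h) * (β + h)   ≤⟨ square-sum-bound {β} {h} {β * β} {1#} {1#} (DTO.reflexive (sym (*-identityʳ (β * β))))
                                           (x≤y⇒x²≤y² 0≤h h≤1) ⟩
                  E * 1#              ≈⟨ *-identityʳ E ⟩
                  E                   ∎)) ⟩
                E * K * 1#                           ∎)
    where
    open ≤-Reasoning
    p = product (λ i → a - b (suc i))
    β = a - b zero

  -- Comparing f and g at a + h gives (f a - g a)² ≤ h C for all 0 < h ≤ 1, which forces the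
  -- difference to be 0.
  lipschitz-limit : ∀ {a f g} → LipschitzAt a f → LipschitzAt a g → (∀ x → ¬ (x ≈ a) → f x ≈ g x) → f a ≈ g a
  lipschitz-limit {a} {f} {g} (K , 0≤K , lip-f) (L , 0≤L , lip-g) f≈g = conclude (δ ≟ 0#)
    where
    δ = f a - g a
    C = 2# * (L + K) + 1#

    0<C : 0# < C
    0<C = <-respʳ-≈ (+-comm _ _) (+-positive 0<1 (*-nonNegative (proj₁ 0<2) (+-nonNegative 0≤L 0≤K)))

    small : ∀ h → 0# < h → h ≤ 1# → δ * δ ≤ h * C
    small h 0<h h≤1 =
      let k , f-eq , k²≤K = lip-f h (proj₁ 0<h) h≤1
          l , g-eq , l²≤L = lip-g h (proj₁ 0<h) h≤1
          δ≈ : δ ≈ h * (l + - k)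
          δ≈ = begin-equality
            f a - g a                                    ≈⟨ solve 4 (λ f g u v → f :- g := (f :+ u) :- (g :+ v) :+ (v :- u)) refl (f a) (g a) (h * k) (h * l) ⟩
            f a + h * k - (g a + h * l) + (h * l - h * k) ≈⟨ +-congʳ (+-cong (sym f-eq) (-‿cong (sym g-eq))) ⟩
            f (a + h) - g (a + h) + (h * l - h * k)      ≈⟨ +-congʳ (+-congʳ (f≈g (a + h) (a+h≉a h 0<h))) ⟩
            g (a + h) - g (a + h) + (h * l - h * k)      ≈⟨ solve 4 (λ g h l k → g :- g :+ (h :* l :- h :* k) := h :* (l :+ :- k)) refl (g (a + h)) h l k ⟩
            h * (l + - k)                                ∎
      in begin
        δ * δ                              ≈⟨ *-cong δ≈ δ≈ ⟩
        h * (l + - k) * (h * (l + - k))    ≤⟨ square-scale-bound h (square-sum-bound {l} {(- k)} {L} {K} {1#} l²≤L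
                                                (≤-respˡ-≈ (solve 1 (λ k → :- k :* :- k := k :* k) refl k) k²≤K)) ⟩
        h * h * (2# * (L + K)) * 1#        ≤⟨ *-monoˡ-≤ 0≤1 (≤-by (h * h) (0≤x² h) (solve 2 (λ h m → h :* h :* (m :+ :1) := h :* h :* m :+ h :* h) refl h (2# * (L + K)))) ⟩
        h * h * C * 1#                     ≈⟨ solve 2 (λ h c → h :* h :* c :* :1 := h :* (h :* c)) refl h C ⟩
        h * (h * C)                        ≤⟨ *-monoʳ-≤ (proj₁ 0<h) (*-monoˡ-≤ (proj₁ 0<C) h≤1) ⟩
        h * (1# * C)                       ≈⟨ *-congˡ (*-identityˡ C) ⟩
        h * C                              ∎
      where
      open ≤-Reasoning
      a+h≉a : ∀ h → 0# < h → ¬ (a + h ≈ a)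
      a+h≉a h 0<h eq = 0<⇒≉0 0<h (trans (solve 2 (λ a h → h := a :+ h :- a) refl a h) (trans (+-congʳ eq) (-‿inverseʳ a)))

    conclude : _ → f a ≈ g a
    conclude (yes δ≈0) = trans (solve 2 (λ f g → f := f :- g :+ g) refl (f a) (g a)) (trans (+-congʳ δ≈0) (+-identityˡ (g a)))
    conclude (no  δ≉0) = contradiction (small h 0<h h≤1) (<⇒≱ hC<δ²)
      where
      D = δ * δ
      0<D : 0# < D
      0<D = 0≤x² δ , *-≉0 δ≉0 δ≉0 ∘ sym
      0<D+C = +-positive 0<D (proj₁ 0<C)
      ι = (D + C) ⁻¹
      0<ι = ⁻¹-positive 0<D+C
      ι-eq = ⁻¹-inverseˡ (D + C) (0<⇒≉0 0<D+C)
      -- With h = D / (D + C) one has h ≤ 1 and D - h C = D h > 0, against D ≤ h C.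
      h = D * ι
      0<h = *-positive 0<D 0<ι
      h≤1 : h ≤ 1#
      h≤1 = ≤-by (ι * C) (*-nonNegative (proj₁ 0<ι) (proj₁ 0<C))
        (trans (sym ι-eq) (solve 3 (λ ι d c → ι :* (d :+ c) := d :* ι :+ ι :* c) refl ι D C))
      hC<δ² : h * C < D
      hC<δ² = 0<y-x⇒x<y (<-respʳ-≈ (sym (trans (+-congʳ (trans (sym (*-identityʳ D)) (*-congˡ (sym ι-eq))))
        (solve 3 (λ ι d c → d :* (ι :* (d :+ c)) :- d :* ι :* c := d :* (d :* ι)) refl ι D C))) (*-positive 0<D 0<h))

  product≈0 : ∀ {n} (f : Vector Carrier n) → product f ≈ 0# → ∃ λ i → f i ≈ 0#
  product≈0 {zero}  f eq = contradiction (sym eq) 0≉1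
  product≈0 {suc n} f eq = case f zero ≟ 0# of λ where
    (yes f₀≈0) → zero , f₀≈0
    (no  f₀≉0) → let i , fᵢ≈0 = product≈0 (f ∘ suc) (xy≈0⇒y≈0 f₀≉0 eq) in suc i , fᵢ≈0

  -- At x = σ₀² the left product vanishes, so some τⱼ² equals σ₀², and τⱼ = σ₀ by nonnegativity. The
  -- common factor cancels for every other x, and `lipschitz-limit` supplies the excluded point, so
  -- the induction can continue with one root less.
  roots-sum : ∀ {n} (σ τ : Vector Carrier n) → (∀ i → 0# ≤ σ i) → (∀ i → 0# ≤ τ i) →
              (∀ x → product (λ i → x - σ i * σ i) ≈ product (λ i → x - τ i * τ i)) → sum σ ≈ sum τ
  roots-sum {zero}  σ τ 0≤σ 0≤τ eq = refl
  roots-sum {suc n} σ τ 0≤σ 0≤τ eq = cancel (product≈0 (λ i → a - τ i * τ i)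
      (trans (sym (eq a)) (trans (*-congʳ (-‿inverseʳ a)) (zeroˡ (product (λ i → a - σ (suc i) * σ (suc i)))))))
    where
    a = σ zero * σ zero
    f = λ x → product (λ i → x - σ (suc i) * σ (suc i))

    cancel : (∃ λ j → a - τ j * τ j ≈ 0#) → sum σ ≈ sum τ
    cancel (j , a-τⱼ²≈0) = begin
      σ zero + sum (σ ∘ suc)        ≈⟨ +-cong σ₀≈τⱼ (roots-sum (σ ∘ suc) (removeAt τ j) (0≤σ ∘ suc) (λ i → 0≤τ (punchIn j i)) f≈g) ⟩
      τ j + sum (removeAt τ j)      ≈⟨ sum-remove τ ⟨
      sum τ                         ∎
      where
      open ≈-Reasoning
      g = λ x → product (λ i → x - removeAt τ j i * removeAt τ j i)

      a≈τⱼ² : a ≈ τ j * τ j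
      a≈τⱼ² = trans (solve 2 (λ a b → a := a :- b :+ b) refl a (τ j * τ j)) (trans (+-congʳ a-τⱼ²≈0) (+-identityˡ _))

      σ₀≈τⱼ : σ zero ≈ τ j
      σ₀≈τⱼ = x²≈y²⇒x≈y (0≤σ zero) (0≤τ j) a≈τⱼ²

      f≈g-away : ∀ x → ¬ (x ≈ a) → f x ≈ g x
      f≈g-away x x≉a = *-cancelˡ-≈ (λ x-a≈0 → x≉a (trans (solve 2 (λ x a → x := x :- a :+ a) refl x a) (trans (+-congʳ x-a≈0) (+-identityˡ a)))) (begin
        (x - a) * f x                      ≈⟨ eq x ⟩
        product (λ i → x - τ i * τ i)      ≈⟨ product-remove {i = j} (λ i → x - τ i * τ i) ⟩
        (x - τ j * τ j) * g x              ≈⟨ *-congʳ (+-congˡ (-‿cong a≈τⱼ²)) ⟨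
        (x - a) * g x                      ∎)

      f≈g : ∀ x → f x ≈ g x
      f≈g x = case x ≟ a of λ where
        (no  x≉a) → f≈g-away x x≉a
        (yes x≈a) → begin
          f x   ≈⟨ (product-cong-≋ λ i → +-congʳ { - (σ (suc i) * σ (suc i))} x≈a) ⟩
          f a   ≈⟨ lipschitz-limit (lipschitz-product a (λ i → σ (suc i) * σ (suc i))) (lipschitz-product a (λ i → removeAt τ j i * removeAt τ j i)) f≈g-away ⟩
          g a   ≈⟨ (product-cong-≋ λ i → +-congʳ { - (removeAt τ j i * removeAt τ j i)} x≈a) ⟨
          g x   ∎

  traceNorm-unique : ∀ {n} {A : Matrix n} {s t} → TraceNorm A s → TraceNorm A t → s ≈ t
  traceNorm-unique (σ , (0≤σ , σ-eig) , s≈) (τ , (0≤τ , τ-eig) , t≈) =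
    trans s≈ (trans (roots-sum σ τ 0≤σ 0≤τ λ x → trans (sym (σ-eig x)) (τ-eig x)) (sym t≈))

  -- Sylvester's law of inertia

  -- Turns a count of eigenvalues into a number of linear conditions, so that `kernel-nontrivial`
  -- applies when there are fewer of them than coefficients.
  select : ∀ {n k} {P : Carrier → Set} (P? : ∀ x → Dec (P x)) (d : Vector Carrier n) (q : Fin n → Vector Carrier k) →
           ∃ λ rs → List.length rs ≡ count P? (toVec d) × (∀ v → rs ⊥ v → ∀ i → P (d i) → q i ∙ v ≈ 0#)
  select {zero}  P? d q = List.[] , ≡.refl , λ v _ ()
  select {suc n} P? d q with P? (d zero) | select P? (d ∘ suc) (q ∘ suc)
  ... | yes _  | rs , len , ok = q zero List.∷ rs , ≡.cong suc len , λ where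
          v (q₀⊥v All.∷ _) zero    _ → q₀⊥v
          v (_ All.∷ rs⊥v) (suc i) p → ok v rs⊥v i p
  ... | no ¬p₀ | rs , len , ok = rs , len , λ where
          v _    zero    p → contradiction p ¬p₀
          v rs⊥v (suc i) p → ok v rs⊥v i p

  combination : ∀ {n k} → Vector Carrier k → (Fin k → Vector Carrier n) → Vector Carrier n
  combination c p i = sum λ j → c j * p j i

  ∙-combination : ∀ {n k} (u : Vector Carrier n) (c : Vector Carrier k) p →
                  u ∙ combination c p ≈ (λ j → u ∙ p j) ∙ c
  ∙-combination u c p = begin
    sum (λ i → u i * sum (λ j → c j * p j i))    ≈⟨ (sum-cong-≋ λ i → *-distribˡ-sum (u i) (λ j → c j * p j i)) ⟩
    sum (λ i → sum (λ j → u i * (c j * p j i)))  ≈⟨ ∑-comm (λ i j → u i * (c j * p j i)) ⟩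
    sum (λ j → sum (λ i → u i * (c j * p j i)))  ≈⟨ (sum-cong-≋ λ j → trans
                                                      (sum-cong-≋ λ i → solve 3 (λ u c p → u :* (c :* p) := u :* p :* c) refl (u i) (c j) (p j i))
                                                      (sym (*-distribʳ-sum (c j) (λ i → u i * p j i)))) ⟩
    sum (λ j → (u ∙ p j) * c j)                  ∎
    where open ≈-Reasoning

  -- Otherwise some nonzero combination of the p j is orthogonal to all eigenvectors with eigenvalue
  -- in P, and s A is nonnegative there. Both halves of the law arise, from s = 1 and s = -1.
  inertia-bound : ∀ {n k} {Q : Matrix n} {d A} → Orthogonal Q → Diagonalizes Q d A →
    ∀ s {P : Carrier → Set} (P? : ∀ x → Dec (P x)) → (∀ x → ¬ P x → 0# ≤ s * x) →
    (p : Fin k → Vector Carrier n) →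
    (∀ c → ¬ (c ≈ᵛ 0ᵛ) → s * form A (combination c p) < 0#) →
    k ℕ.≤ count P? (toVec d)
  inertia-bound {n} {k} {Q} {d} {A} Q-orthogonal Q-diag s {P} P? ¬P⇒0≤ p negative =
    ℕ.≮⇒≥ λ count<k →
      let rs , len , ok = select P? d (λ i j → transpose Q i ∙ p j)
          c , c≉0 , rs⊥c = kernel-nontrivial rs (≡.subst (ℕ._< k) (≡.sym len) count<k)
      in <⇒≱ (negative c c≉0) (nonNegative c (λ i dᵢ∈P → trans (∙-combination (transpose Q i) c p) (ok c rs⊥c i dᵢ∈P)))
    where
    nonNegative : ∀ c → (∀ i → P (d i) → transpose Q i ∙ combination c p ≈ 0#) → 0# ≤ s * form A (combination c p)
    nonNegative c ⊥c = begin
      0#                                       ≤⟨ sum-nonNegative term ⟩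
      sum (λ i → s * (d i * (y i * y i)))      ≈⟨ *-distribˡ-sum s (λ i → d i * (y i * y i)) ⟨
      s * sum (λ i → d i * (y i * y i))        ≈⟨ *-congˡ (diagonalizes-form Q-orthogonal Q-diag (combination c p)) ⟨
      s * form A (combination c p)             ∎
      where
      open ≤-Reasoning
      y : Vector Carrier n
      y = transpose Q · combination c p
      term : ∀ i → 0# ≤ s * (d i * (y i * y i))
      term i = case P? (d i) of λ where
        (yes dᵢ∈P) → DTO.reflexive (sym (trans (*-congˡ {s} (*-congˡ {d i} (*-congʳ {y i} (⊥c i dᵢ∈P))))
          (solve 3 (λ s d y → s :* (d :* (:0 :* y)) := :0) refl s (d i) (y i))))
        (no  dᵢ∉P) → DTO.trans (*-nonNegative (¬P⇒0≤ (d i) dᵢ∉P) (0≤x² (y i))) (DTO.reflexive (*-assoc s (d i) (y i * y i)))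

  -- Orthogonality removes the mixed terms and leaves the sum of the (c j)² form A (p j). After
  -- multiplication by `s` no term is positive, and any term with c j ≠ 0 is negative.
  negative-combination : ∀ {n k} (A : Matrix n) (p : Fin k → Vector Carrier n) s →
    (∀ i j → ¬ (i ≡ j) → p i ∙ (A · p j) ≈ 0#) → (∀ i → s * form A (p i) < 0#) →
    ∀ c → ¬ (c ≈ᵛ 0ᵛ) → s * form A (combination c p) < 0#
  negative-combination {k = k} A p s orthogonal negative c c≉0 = 0<-x⇒x<0 (<-respʳ-≈ (sym (begin
      - (s * form A (combination c p))             ≈⟨ -‿cong (*-congˡ form≈) ⟩
      - (s * sum (λ j → c j * c j * f j))          ≈⟨ -‿cong (*-distribˡ-sum s (λ j → c j * c j * f j)) ⟩
      - sum (λ j → s * (c j * c j * f j))          ≈⟨ sum-neg (λ j → s * (c j * c j * f j)) ⟨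
      sum (λ j → - (s * (c j * c j * f j)))        ≈⟨ (sum-cong-≋ λ j → solve 3 (λ s c f → :- (s :* (c :* c :* f)) := c :* c :* :- (s :* f)) refl s (c j) (f j)) ⟩
      sum (λ j → c j * c j * - (s * f j))          ∎)) positive)
    where
    open ≈-Reasoning
    f : Vector Carrier k
    f j = form A (p j)

    positive : 0# < sum (λ j → c j * c j * - (s * f j))
    positive = case ≈0? c of λ where
      (inj₁ c≈0)       → contradiction c≈0 c≉0
      (inj₂ (j , cⱼ≉0)) → <-≤-trans (*-positive (0≤x² (c j) , *-≉0 cⱼ≉0 cⱼ≉0 ∘ sym) (x<0⇒0<-x (negative j)))
        (term≤sum {f = λ j → c j * c j * - (s * f j)} (λ j → *-nonNegative (0≤x² (c j)) (proj₁ (x<0⇒0<-x (negative j)))) j)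

    row : ∀ i → combination c p ∙ (A · p i) ≈ c i * f i
    row i = begin
      combination c p ∙ (A · p i)           ≈⟨ ∙-comm (combination c p) (A · p i) ⟩
      (A · p i) ∙ combination c p           ≈⟨ ∙-combination (A · p i) c p ⟩
      sum (λ j → ((A · p i) ∙ p j) * c j)   ≈⟨ (sum-cong-≋ λ j → trans (*-congʳ (trans (∙-comm (A · p i) (p j)) (offDiagonal i j))) (*-assoc _ _ _)) ⟩
      sum (λ j → identity i j * (f i * c j)) ≈⟨ identity-sum i (λ j → f i * c j) ⟩
      f i * c i                             ≈⟨ *-comm _ _ ⟩
      c i * f i                             ∎
      where
      offDiagonal : ∀ i j → p j ∙ (A · p i) ≈ identity i j * f i
      offDiagonal i j with i Fin.≟ j
      ... | yes ≡.refl = sym (*-identityˡ (f i))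
      ... | no  i≢j    = trans (orthogonal j i (i≢j ∘ ≡.sym)) (sym (zeroˡ (f i)))

    form≈ : form A (combination c p) ≈ sum (λ j → c j * c j * f j)
    form≈ = begin
      combination c p ∙ (A · combination c p)         ≈⟨ ∙-cong {u = combination c p} (λ _ → refl) (λ i → trans (∙-combination (A i) c p)
                                                           (∙-comm (λ j → A i ∙ p j) c)) ⟩
      combination c p ∙ combination c (λ j → A · p j) ≈⟨ ∙-combination (combination c p) c (λ j → A · p j) ⟩
      sum (λ j → (combination c p ∙ (A · p j)) * c j) ≈⟨ (sum-cong-≋ λ j → trans (*-congʳ (row j))
                                                           (solve 2 (λ c f → c :* f :* c := c :* c :* f) refl (c j) (f j))) ⟩
      sum (λ j → c j * c j * f j)                     ∎

  count-partition : ∀ {P Q R : Carrier → Set} (P? : ∀ x → Dec (P x)) (Q? : ∀ x → Dec (Q x)) (R? : ∀ x → Dec (R x)) →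
    (∀ {x} → P x → ¬ Q x) → (∀ {x} → P x → ¬ R x) → (∀ {x} → Q x → ¬ R x) → (∀ {x} → ¬ P x → ¬ Q x → R x) →
    ∀ {n} (d : Vector Carrier n) → count P? (toVec d) ℕ.+ count Q? (toVec d) ℕ.+ count R? (toVec d) ≡ n
  count-partition P? Q? R? p q r e {zero}  d = ≡.refl
  count-partition P? Q? R? p q r e {suc n} d
    with P? (d zero) | Q? (d zero) | R? (d zero) | count-partition P? Q? R? p q r e (d ∘ suc)
  ... | yes _ | no  _ | no  _ | eq = ≡.cong suc eq
  ... | no  _ | yes _ | no  _ | eq = ≡.trans (≡.cong (ℕ._+ count R? (toVec (d ∘ suc))) (ℕ.+-suc (count P? (toVec (d ∘ suc))) _)) (≡.cong suc eq)
  ... | no  _ | no  _ | yes _ | eq = ≡.trans (ℕ.+-suc _ _) (≡.cong suc eq)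
  ... | yes x | yes y | _     | _  = contradiction y (p x)
  ... | yes x | _     | yes z | _  = contradiction z (q x)
  ... | _     | yes y | yes z | _  = contradiction z (r y)
  ... | no  x | no  y | no  z | _  = contradiction (e x y) z

  count-trichotomy : ∀ {n} (d : Vector Carrier n) →
    count (0# <?_) (toVec d) ℕ.+ count (0# ≟_) (toVec d) ℕ.+ count (_<? 0#) (toVec d) ≡ n
  count-trichotomy = count-partition (0# <?_) (0# ≟_) (_<? 0#)
    proj₂ (λ 0<x x<0 → <⇒≱ 0<x (proj₁ x<0)) (λ 0≈x x<0 → proj₂ x<0 (sym 0≈x))
    (λ 0≮x 0≉x → ≮⇒≥ 0≮x , 0≉x ∘ sym)

  -- Finite differences

  difference : ℕ → (ℕ → Carrier) → Carrier
  difference zero    g = g zero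
  difference (suc n) g = difference n (λ k → g (suc k) - g k)

  difference-cong : ∀ n {f g} → (∀ k → f k ≈ g k) → difference n f ≈ difference n g
  difference-cong zero    eq = eq zero
  difference-cong (suc n) eq = difference-cong n λ k → +-cong (eq (suc k)) (-‿cong (eq k))

  difference-* : ∀ n c g → difference n (λ k → c * g k) ≈ c * difference n g
  difference-* zero    c g = refl
  difference-* (suc n) c g = trans
    (difference-cong n λ k → solve 3 (λ c x y → c :* x :- c :* y := c :* (x :- y)) refl c (g (suc k)) (g k))
    (difference-* n c (λ k → g (suc k) - g k))

  -- weight n k = (-1)ⁿ⁻ᵏ (n choose k)
  weight : ℕ → ℕ → Carrier
  weight zero    zero    = 1#
  weight zero    (suc k) = 0#
  weight (suc n) zero    = - weight n zero
  weight (suc n) (suc k) = weight n k - weight n (suc k)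

  weight-above : ∀ {n k} → n ℕ.< k → weight n k ≈ 0#
  weight-above {zero}  {suc k} _           = refl
  weight-above {suc n} {suc k} (ℕ.s≤s n<k) = trans
    (+-cong (weight-above n<k) (-‿cong (weight-above (ℕ.m<n⇒m<1+n n<k)))) (-‿inverseʳ 0#)

  weight-diagonal : ∀ n → weight n n ≈ 1#
  weight-diagonal zero    = refl
  weight-diagonal (suc n) = trans (+-cong (weight-diagonal n) (-‿cong (weight-above (ℕ.n<1+n n))))
    (solve 0 (:1 :- :0 := :1) refl)

  -- Pascal's rule for the weights mirrors the passage from g to g (k + 1) - g k. The length N is
  -- arbitrary above n, because `weight n` vanishes beyond n.
  sum-weight : ∀ n {N} → n ℕ.< N → ∀ g → sum {N} (λ k → weight n (toℕ k) * g (toℕ k)) ≈ difference n g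
  sum-weight zero    {suc N} _ g = trans
    (+-cong (*-identityˡ (g zero)) (sum-≈0 {N} λ k → zeroˡ (g (suc (toℕ k))))) (+-identityʳ (g zero))
  sum-weight (suc n) {suc N} (ℕ.s≤s n<N) g = begin
    - weight n zero * g zero + sum {N} (λ k → (weight n (toℕ k) - weight n (suc (toℕ k))) * g (suc (toℕ k)))
      ≈⟨ +-congˡ (sum-cong-≋ {N} λ k → solve 3 (λ x y g → (x :- y) :* g := x :* g :+ :- (y :* g)) refl
           (weight n (toℕ k)) (weight n (suc (toℕ k))) (g (suc (toℕ k)))) ⟩
    - weight n zero * g zero + sum {N} (λ k → shifted k + - tailed k)
      ≈⟨ +-congˡ (trans (∑-distrib-+ shifted (λ k → - tailed k)) (+-congˡ (sum-neg tailed))) ⟩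
    - weight n zero * g zero + (sum shifted - sum tailed)
      ≈⟨ solve 4 (λ w g s t → :- w :* g :+ (s :- t) := s :- (w :* g :+ t)) refl (weight n zero) (g zero) (sum shifted) (sum tailed) ⟩
    sum shifted - sum {suc N} (λ k → weight n (toℕ k) * g (toℕ k))
      ≈⟨ +-congˡ (-‿cong (trans (sum-weight n (ℕ.m<n⇒m<1+n n<N) g) (sym (sum-weight n n<N g)))) ⟩
    sum shifted - sum plain
      ≈⟨ trans (∑-distrib-+ shifted (λ k → - plain k)) (+-congˡ (sum-neg plain)) ⟨
    sum (λ k → shifted k + - plain k)
      ≈⟨ (sum-cong-≋ {N} λ k → solve 3 (λ w x y → w :* x :+ :- (w :* y) := w :* (x :- y)) refl (weight n (toℕ k)) (g (suc (toℕ k))) (g (toℕ k))) ⟩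
    sum {N} (λ k → weight n (toℕ k) * (g (suc (toℕ k)) - g (toℕ k)))
      ≈⟨ sum-weight n n<N (λ k → g (suc k) - g k) ⟩
    difference (suc n) g ∎
    where
    open ≈-Reasoning
    shifted tailed plain : Vector Carrier N
    shifted k = weight n (toℕ k) * g (suc (toℕ k))
    tailed  k = weight n (suc (toℕ k)) * g (suc (toℕ k))
    plain   k = weight n (toℕ k) * g (toℕ k)

  -- Ratios of factorials

  fact : ℕ → Carrier
  fact k = fromℕ (k !)

  fact-positive : ∀ k → 0# < fact k
  fact-positive k = fromℕ-positive (k !) {{ℕ._!≢0 k}}

  fact-≉0 : ∀ k → ¬ (fact k ≈ 0#)
  fact-≉0 k = 0<⇒≉0 (fact-positive k)

  fact-suc : ∀ k → fact (suc k) ≈ fromℕ (suc k) * fact k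
  fact-suc k = ×1-homo-* (suc k) (k !)

  fact⁻¹ : ℕ → Carrier
  fact⁻¹ k = fact k ⁻¹

  fact⁻¹-positive : ∀ k → 0# < fact⁻¹ k
  fact⁻¹-positive k = ⁻¹-positive (fact-positive k)

  fact⁻¹-suc : ∀ k → fact⁻¹ k ≈ fromℕ (suc k) * fact⁻¹ (suc k)
  fact⁻¹-suc k = ⁻¹-unique (begin
    fact k * (fromℕ (suc k) * fact⁻¹ (suc k))  ≈⟨ solve 3 (λ f n i → f :* (n :* i) := n :* f :* i) refl (fact k) (fromℕ (suc k)) (fact⁻¹ (suc k)) ⟩
    fromℕ (suc k) * fact k * fact⁻¹ (suc k)    ≈⟨ *-congʳ (fact-suc k) ⟨
    fact (suc k) * fact⁻¹ (suc k)              ≈⟨ ⁻¹-inverseʳ _ (fact-≉0 (suc k)) ⟩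
    1#                                         ∎)
    where open ≈-Reasoning

  ratio : ℕ → ℕ → ℕ → Carrier
  ratio p m k = fact (k ℕ.+ p) * fact⁻¹ (k ℕ.+ m)

  -- The discrete power rule: with (k + p)! / (k + m + 1)! taken out, what remains is (k + p + 1) -
  -- (k + m + 1) = p - m. A difference thus keeps p and raises m by 1.
  ratio-difference : ∀ p m k → ratio p m (suc k) - ratio p m k ≈ (fromℕ p - fromℕ m) * ratio p (suc m) k
  ratio-difference p m k = begin
    fact (suc (k ℕ.+ p)) * i - fact (k ℕ.+ p) * fact⁻¹ (k ℕ.+ m)
      ≈⟨ +-cong (*-congʳ (fact-suc (k ℕ.+ p))) (-‿cong (*-congˡ (fact⁻¹-suc (k ℕ.+ m)))) ⟩
    (1# + fromℕ (k ℕ.+ p)) * f * i - f * ((1# + fromℕ (k ℕ.+ m)) * i)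
      ≈⟨ +-cong (*-congʳ (*-congʳ (+-congˡ (×-homo-+ 1# k p)))) (-‿cong (*-congˡ (*-congʳ (+-congˡ (×-homo-+ 1# k m))))) ⟩
    (1# + (fromℕ k + fromℕ p)) * f * i - f * ((1# + (fromℕ k + fromℕ m)) * i)
      ≈⟨ solve 5 (λ k p m f i → (:1 :+ (k :+ p)) :* f :* i :- f :* ((:1 :+ (k :+ m)) :* i) := (p :- m) :* (f :* i)) refl
           (fromℕ k) (fromℕ p) (fromℕ m) f i ⟩
    (fromℕ p - fromℕ m) * (f * i)
      ≡⟨ ≡.cong (λ x → (fromℕ p - fromℕ m) * (f * fact⁻¹ x)) (ℕ.+-suc k m) ⟨
    (fromℕ p - fromℕ m) * ratio p (suc m) k ∎
    where
    open ≈-Reasoning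
    f = fact (k ℕ.+ p)
    i = fact⁻¹ (suc (k ℕ.+ m))

  difference-ratio : ∀ n p m → difference (suc n) (ratio p m) ≈ (fromℕ p - fromℕ m) * difference n (ratio p (suc m))
  difference-ratio n p m = trans (difference-cong n (ratio-difference p m)) (difference-* n _ (ratio p (suc m)))

  -- ratio (j + m) m is a polynomial of degree j.
  difference-ratio-≈0 : ∀ {n} j m → j ℕ.< n → difference n (ratio (j ℕ.+ m) m) ≈ 0#
  difference-ratio-≈0 {suc n} zero m _ = trans (difference-ratio n m m) (trans (*-congʳ (-‿inverseʳ (fromℕ m))) (zeroˡ _))
  difference-ratio-≈0 {suc n} (suc j) m (ℕ.s≤s j<n) = trans (difference-ratio n (suc j ℕ.+ m) m)
    (trans (*-congˡ (≡.subst (λ p → difference n (ratio p (suc m)) ≈ 0#) (ℕ.+-suc j m) (difference-ratio-≈0 j (suc m) j<n)))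
           (zeroʳ (fromℕ (suc j ℕ.+ m) - fromℕ m)))

  -- The second index m = suc j + p exceeds p, so each difference contributes the negative factor p
  -- - m and raises m further. After n differences a positive ratio remains.
  difference-ratio-sign : ∀ n p j → 0# < (- 1#) ^ n * difference n (ratio p (suc j ℕ.+ p))
  difference-ratio-sign zero    p j = <-respʳ-≈ (sym (*-identityˡ _)) (*-positive (fact-positive p) (fact⁻¹-positive (suc j ℕ.+ p)))
  difference-ratio-sign (suc n) p j = <-respʳ-≈ (sym (begin
    - 1# * (- 1#) ^ n * difference (suc n) (ratio p (suc j ℕ.+ p))
      ≈⟨ *-congˡ (trans (difference-ratio n p (suc j ℕ.+ p)) (*-congʳ (+-congˡ (-‿cong (×-homo-+ 1# (suc j) p))))) ⟩
    - 1# * (- 1#) ^ n * ((fromℕ p - (fromℕ (suc j) + fromℕ p)) * difference n (ratio p (suc (suc j) ℕ.+ p)))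
      ≈⟨ solve 4 (λ e p j d → :- :1 :* e :* ((p :- (j :+ p)) :* d) := j :* (e :* d)) refl
           ((- 1#) ^ n) (fromℕ p) (fromℕ (suc j)) (difference n (ratio p (suc (suc j) ℕ.+ p))) ⟩
    fromℕ (suc j) * ((- 1#) ^ n * difference n (ratio p (suc (suc j) ℕ.+ p))) ∎))
    (*-positive (fromℕ-positive (suc j)) (difference-ratio-sign n p (suc j)))
    where open ≈-Reasoning

  -- The Hadamard inverse of the Pascal matrix

  pascal⁻¹ : ∀ n → Matrix n
  pascal⁻¹ n = hadamardInverse (pascal n)

  pascal⁻¹-entry : ∀ {n} (i j : Fin n) → pascal⁻¹ n i j ≈ fact (toℕ i) * fact (toℕ j) * fact⁻¹ (toℕ j ℕ.+ toℕ i)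
  pascal⁻¹-entry i j = ⁻¹-unique (begin
    fact (a ℕ.+ b) * q ⁻¹ * (fact a * fact b * fact⁻¹ (b ℕ.+ a))
      ≡⟨ ≡.cong (λ k → fact (a ℕ.+ b) * q ⁻¹ * (fact a * fact b * fact⁻¹ k)) (ℕ.+-comm b a) ⟩
    fact (a ℕ.+ b) * q ⁻¹ * (fact a * fact b * fact⁻¹ (a ℕ.+ b))
      ≈⟨ *-congˡ (*-congʳ (×1-homo-* (a !) (b !))) ⟨
    fact (a ℕ.+ b) * q ⁻¹ * (q * fact⁻¹ (a ℕ.+ b))
      ≈⟨ solve 4 (λ x i q y → x :* i :* (q :* y) := q :* i :* (x :* y)) refl (fact (a ℕ.+ b)) (q ⁻¹) q (fact⁻¹ (a ℕ.+ b)) ⟩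
    q * q ⁻¹ * (fact (a ℕ.+ b) * fact⁻¹ (a ℕ.+ b))
      ≈⟨ *-cong (⁻¹-inverseʳ q q≉0) (⁻¹-inverseʳ _ (fact-≉0 (a ℕ.+ b))) ⟩
    1# * 1#
      ≈⟨ *-identityˡ 1# ⟩
    1# ∎)
    where
    open ≈-Reasoning
    a = toℕ i
    b = toℕ j
    q = fromℕ (a ! ℕ.* b !)
    q≉0 : ¬ (q ≈ 0#)
    q≉0 q≈0 = *-≉0 (fact-≉0 a) (fact-≉0 b) (trans (sym (×1-homo-* (a !) (b !))) q≈0)

  pascal⁻¹-symmetric : ∀ n → Symmetric (pascal⁻¹ n)
  pascal⁻¹-symmetric n i j = trans (pascal⁻¹-entry i j) (trans
    (*-cong (*-comm (fact (toℕ i)) (fact (toℕ j))) (reflexive (≡.cong fact⁻¹ (ℕ.+-comm (toℕ j) (toℕ i)))))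
    (sym (pascal⁻¹-entry j i)))

  -- The coefficients, up to scaling, of the polynomials orthogonal for the moments 1 / k!
  -- (generalised Bessel polynomials). For n = 0 the truncated predecessor is harmless: weight 0 k
  -- vanishes for k > 0.
  bessel : ∀ {N} → ℕ → Vector Carrier N
  bessel n k = weight n (toℕ k) * (fact (toℕ k ℕ.+ ℕ.pred n) * fact⁻¹ (toℕ k))

  -- The factor 1 / k! in `bessel` cancels the k! of the matrix entry m! k! / (k + m)!, the other
  -- factorial completes 1 / (k + m)! to a `ratio`, and the weights take its n-th difference.
  pascal⁻¹-bessel : ∀ {N n} → n ℕ.< N → ∀ m →
                    (pascal⁻¹ N · bessel n) m ≈ fact (toℕ m) * difference n (ratio (ℕ.pred n) (toℕ m))
  pascal⁻¹-bessel {N} {n} n<N m = begin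
    sum (λ k → pascal⁻¹ N m k * bessel n k)
      ≈⟨ (sum-cong-≋ λ k → trans (*-congʳ {bessel n k} (pascal⁻¹-entry m k)) (term k)) ⟩
    sum {N} (λ k → fact (toℕ m) * (weight n (toℕ k) * ratio (ℕ.pred n) (toℕ m) (toℕ k)))
      ≈⟨ *-distribˡ-sum {N} (fact (toℕ m)) (λ k → weight n (toℕ k) * ratio (ℕ.pred n) (toℕ m) (toℕ k)) ⟨
    fact (toℕ m) * sum {N} (λ k → weight n (toℕ k) * ratio (ℕ.pred n) (toℕ m) (toℕ k))
      ≈⟨ *-congˡ (sum-weight n n<N (ratio (ℕ.pred n) (toℕ m))) ⟩
    fact (toℕ m) * difference n (ratio (ℕ.pred n) (toℕ m)) ∎
    where
    open ≈-Reasoning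
    term : ∀ k → fact (toℕ m) * fact (toℕ k) * fact⁻¹ (toℕ k ℕ.+ toℕ m) * bessel n k ≈
                 fact (toℕ m) * (weight n (toℕ k) * ratio (ℕ.pred n) (toℕ m) (toℕ k))
    term k = begin
      a * b * c * (w * (d * b⁻¹))      ≈⟨ *-congˡ (*-assoc w d b⁻¹) ⟨
      a * b * c * (w * d * b⁻¹)        ≈⟨ solve 5 (λ a b c e i → a :* b :* c :* (e :* i) := b :* i :* (a :* (e :* c))) refl a b c (w * d) b⁻¹ ⟩
      b * b⁻¹ * (a * (w * d * c))      ≈⟨ *-cong (⁻¹-inverseʳ b (fact-≉0 (toℕ k))) (*-congˡ (*-assoc w d c)) ⟩
      1# * (a * (w * (d * c)))         ≈⟨ *-identityˡ _ ⟩
      a * (w * (d * c))                ∎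
      where
      a = fact (toℕ m)
      b = fact (toℕ k)
      b⁻¹ = fact⁻¹ (toℕ k)
      c = fact⁻¹ (toℕ k ℕ.+ toℕ m)
      d = fact (toℕ k ℕ.+ ℕ.pred n)
      w = weight n (toℕ k)

  bessel-above : ∀ {N n} (m : Fin N) → n ℕ.< toℕ m → bessel n m ≈ 0#
  bessel-above m n<m = trans (*-congʳ (weight-above n<m)) (zeroˡ _)

  pascal⁻¹-bessel-below : ∀ {N n} → n ℕ.< N → ∀ (m : Fin N) → toℕ m ℕ.< n → (pascal⁻¹ N · bessel n) m ≈ 0#
  pascal⁻¹-bessel-below {n = suc n} n<N m (ℕ.s≤s m≤n) = trans (pascal⁻¹-bessel n<N m) (trans
    (*-congˡ (≡.subst (λ p → difference (suc n) (ratio p (toℕ m)) ≈ 0#) (ℕ.m∸n+n≡m m≤n)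
      (difference-ratio-≈0 (n ℕ.∸ toℕ m) (toℕ m) (ℕ.s≤s (ℕ.m∸n≤m n (toℕ m))))))
    (zeroʳ (fact (toℕ m))))

  -- Triangularity: `bessel l` is supported on the indices up to l, while the matrix applied to
  -- `bessel n` vanishes at all indices below n.
  bessel-orthogonal-< : ∀ {N l n} → l ℕ.< n → n ℕ.< N → bessel l ∙ (pascal⁻¹ N · bessel n) ≈ 0#
  bessel-orthogonal-< {N} {l} {n} l<n n<N = sum-≈0 {N} term
    where
    zero-at : ∀ m → toℕ m ℕ.< n → bessel l m * (pascal⁻¹ N · bessel n) m ≈ 0#
    zero-at m m<n = trans (*-congˡ (pascal⁻¹-bessel-below n<N m m<n)) (zeroʳ (bessel l m))

    term : ∀ m → bessel l m * (pascal⁻¹ N · bessel n) m ≈ 0#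
    term m = case ℕ.<-cmp l (toℕ m) of λ where
      (tri< l<m _ _) → trans (*-congʳ (bessel-above m l<m)) (zeroˡ ((pascal⁻¹ N · bessel n) m))
      (tri≈ _ l≡m _) → zero-at m (≡.subst (ℕ._< n) l≡m l<n)
      (tri> _ _ m<l) → zero-at m (ℕ.<-trans m<l l<n)

  bessel-orthogonal : ∀ {N l n} → l ≢ n → l ℕ.< N → n ℕ.< N → bessel l ∙ (pascal⁻¹ N · bessel n) ≈ 0#
  bessel-orthogonal {N} {l} {n} l≢n l<N n<N = case ℕ.<-cmp l n of λ where
    (tri< l<n _ _) → bessel-orthogonal-< l<n n<N
    (tri≈ _ l≡n _) → contradiction l≡n l≢n
    (tri> _ _ n<l) → trans (bilinear-sym (pascal⁻¹-symmetric N) (bessel l) (bessel n)) (bessel-orthogonal-< n<l l<N)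

  -- Below index n the image vector vanishes, above it `bessel n` does, so only the term of index n
  -- contributes to the form; its sign is that of the n-th difference.
  bessel-sign : ∀ {N n} → n ℕ.< N → 0# < (- 1#) ^ n * form (pascal⁻¹ N) (bessel n)
  bessel-sign {N} {n} n<N = <-respʳ-≈ (sym (*-distribˡ-sum s f)) (<-≤-trans (f-diagonal m toℕm≡n) (term≤sum {f = λ k → s * f k} f-nonNegative m))
    where
    s = (- 1#) ^ n
    f : Vector Carrier N
    f m = bessel n m * (pascal⁻¹ N · bessel n) m

    m : Fin N
    m = Fin.fromℕ< n<N

    toℕm≡n : toℕ m ≡ n
    toℕm≡n = Fin.toℕ-fromℕ< n<N

    sign-diagonal : ∀ n → 0# < (- 1#) ^ n * difference n (ratio (ℕ.pred n) n)
    -- For n = 0 the predecessor is 0 and the ratio is 0! / 0!. For larger n the second index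
    -- exceeds the first by one, which is the case j = 0 of `difference-ratio-sign`.
    sign-diagonal zero    = <-respʳ-≈ (sym (*-identityˡ _)) (*-positive (fact-positive 0) (fact⁻¹-positive 0))
    sign-diagonal (suc n) = difference-ratio-sign (suc n) n 0

    f-diagonal : ∀ k → toℕ k ≡ n → 0# < s * f k
    f-diagonal k ≡.refl = <-respʳ-≈ (sym (begin
      s * (w * v * (pascal⁻¹ N · bessel n) k)   ≈⟨ *-congˡ (*-cong (*-congʳ (weight-diagonal n)) (pascal⁻¹-bessel n<N k)) ⟩
      s * (1# * v * (fact n * δ))               ≈⟨ solve 4 (λ s v f d → s :* (:1 :* v :* (f :* d)) := v :* f :* (s :* d)) refl s v (fact n) δ ⟩
      v * fact n * (s * δ)                      ∎))
      (*-positive (*-positive (*-positive (fact-positive (n ℕ.+ ℕ.pred n)) (fact⁻¹-positive n)) (fact-positive n)) (sign-diagonal n))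
      where
      open ≈-Reasoning
      w = weight n n
      v = fact (n ℕ.+ ℕ.pred n) * fact⁻¹ n
      δ = difference n (ratio (ℕ.pred n) n)

    f-nonNegative : ∀ k → 0# ≤ s * f k
    f-nonNegative k = case ℕ.<-cmp n (toℕ k) of λ where
      (tri< n<k _ _) → DTO.reflexive (sym (trans (*-congˡ (trans (*-congʳ (bessel-above k n<k)) (zeroˡ _))) (zeroʳ s)))
      (tri≈ _ n≡k _) → proj₁ (f-diagonal k (≡.sym n≡k))
      (tri> _ _ k<n) → DTO.reflexive (sym (trans (*-congˡ (trans (*-congˡ (pascal⁻¹-bessel-below n<N k k<n)) (zeroʳ _))) (zeroʳ s)))

  -- `φ` lists the even or the odd indices, on which the signs in `bessel-sign` agree, and `s` is
  -- the opposite sign. So s A is negative on each vector of the family, and orthogonality extends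
  -- this to the nonzero combinations.
  bessel-definite : ∀ {N a} s (φ : ℕ → ℕ) → (∀ {i j} → φ i ≡ φ j → i ≡ j) → (∀ j → s ≈ - ((- 1#) ^ φ j)) →
    (∀ {j} → j ℕ.< a → φ j ℕ.< N) →
    ∀ (c : Vector Carrier a) → ¬ (c ≈ᵛ 0ᵛ) → s * form (pascal⁻¹ N) (combination c (λ j → bessel (φ (toℕ j)))) < 0#
  bessel-definite {N} s φ φ-injective s≈ φ<N = negative-combination (pascal⁻¹ N) (λ j → bessel (φ (toℕ j))) s
    (λ i j i≢j → bessel-orthogonal (λ eq → i≢j (Fin.toℕ-injective (φ-injective eq))) (φ<N (Fin.toℕ<n i)) (φ<N (Fin.toℕ<n j)))
    (λ j → 0<-x⇒x<0 (<-respʳ-≈ (sym (trans (-‿cong (*-congʳ (s≈ (toℕ j))))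
      (solve 2 (λ e f → :- (:- e :* f) := e :* f) refl ((- 1#) ^ φ (toℕ j)) (form (pascal⁻¹ N) (bessel (φ (toℕ j)))))))
      (bessel-sign (φ<N (Fin.toℕ<n j)))))

  -1^even : ∀ j → (- 1#) ^ (j ℕ.+ j) ≈ 1#
  -1^even zero    = refl
  -1^even (suc j) = trans (reflexive (≡.cong ((- 1#) ^_) (≡.cong suc (ℕ.+-suc j j))))
    (trans (solve 1 (λ x → :- :1 :* (:- :1 :* x) := x) refl ((- 1#) ^ (j ℕ.+ j))) (-1^even j))

  double-injective : ∀ {i j} → i ℕ.+ i ≡ j ℕ.+ j → i ≡ j
  double-injective {zero}  {zero}  eq = ≡.refl
  double-injective {suc i} {suc j} eq = ≡.cong suc (double-injective
    (ℕ.suc-injective (≡.trans (≡.sym (ℕ.+-suc i i)) (≡.trans (ℕ.suc-injective eq) (ℕ.+-suc j j)))))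

  -- No slack: the lower bounds already add up to the total. In this way the one-sided estimates of
  -- `inertia-bound` determine all three counts.
  counts-tight : ∀ {a b p z q} → a ℕ.≤ p → b ℕ.≤ q → p ℕ.+ z ℕ.+ q ≡ a ℕ.+ b → p ≡ a × z ≡ 0 × q ≡ b
  counts-tight {a} {b} {p} {z} {q} a≤p b≤q eq = p≡a , z≡0 , q≡b
    where
    p≤p+z : p ℕ.≤ p ℕ.+ z
    p≤p+z = ℕ.m≤m+n p z
    p+z≤a : p ℕ.+ z ℕ.≤ a
    p+z≤a = ℕ.+-cancelʳ-≤ b (p ℕ.+ z) a (ℕ.≤-trans (ℕ.+-monoʳ-≤ (p ℕ.+ z) b≤q) (ℕ.≤-reflexive eq))
    p≡a : p ≡ a
    p≡a = ℕ.≤-antisym (ℕ.≤-trans p≤p+z p+z≤a) a≤p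
    z≡0 : z ≡ 0
    z≡0 = ℕ.n≤0⇒n≡0 (ℕ.+-cancelˡ-≤ p z 0 (ℕ.≤-trans (ℕ.≤-trans p+z≤a a≤p) (ℕ.≤-reflexive (≡.sym (ℕ.+-identityʳ p)))))
    q≡b : q ≡ b
    q≡b = ℕ.≤-antisym (ℕ.+-cancelˡ-≤ a q b (ℕ.≤-trans (ℕ.+-monoˡ-≤ q (ℕ.≤-trans a≤p p≤p+z)) (ℕ.≤-reflexive eq))) b≤q

  Signature : ∀ {n} → Vector Carrier n → ℕ → ℕ → ℕ → Set
  Signature d π ξ ν = count (0# <?_) (toVec d) ≡ π × count (0# ≟_) (toVec d) ≡ ξ × count (_<? 0#) (toVec d) ≡ ν

  -- By the last two hypotheses the first `a` even and the first `b` odd numbers are valid indices.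
  -- A is positive on the span of the even family, so `inertia-bound` with s = -1 bounds the number
  -- of positive eigenvalues from below; the odd family with s = 1 does the same for the negative
  -- ones.
  pascal⁻¹-signature : ∀ {a b} {Q} {d} → Orthogonal Q → Diagonalizes Q d (pascal⁻¹ (a ℕ.+ b)) →
    (∀ {j} → j ℕ.< a → j ℕ.+ j ℕ.< a ℕ.+ b) → (∀ {j} → j ℕ.< b → suc (j ℕ.+ j) ℕ.< a ℕ.+ b) →
    Signature d a 0 b
  pascal⁻¹-signature {d = d} Q-orthogonal Q-diag evens odds = counts-tight
    (inertia-bound Q-orthogonal Q-diag (- 1#) (0# <?_)
      (λ x 0≮x → DTO.trans (x≤0⇒0≤-x (≮⇒≥ 0≮x)) (DTO.reflexive (solve 1 (λ x → :- x := :- :1 :* x) refl x)))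
      (λ j → bessel (toℕ j ℕ.+ toℕ j))
      (bessel-definite (- 1#) (λ j → j ℕ.+ j) double-injective (λ j → -‿cong (sym (-1^even j))) evens))
    (inertia-bound Q-orthogonal Q-diag 1# (_<? 0#)
      (λ x x≮0 → DTO.trans (≮⇒≥ x≮0) (DTO.reflexive (sym (*-identityˡ x))))
      (λ j → bessel (suc (toℕ j ℕ.+ toℕ j)))
      (bessel-definite 1# (λ j → suc (j ℕ.+ j)) (double-injective ∘ ℕ.suc-injective)
        (λ j → trans (solve 0 (:1 := :- (:- :1 :* :1)) refl) (-‿cong (*-congˡ (sym (-1^even j))))) odds))
    (count-trichotomy d)

  -- Birkhoff–James orthogonality to the identity

  -- The sign is read off from the same two decisions that the inertia counts, which makes the sum
  -- of the signs the difference of the two counts.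
  decSign : {P Q : Set} → Dec P → Dec Q → Carrier
  decSign (yes _) _       = 1#
  decSign (no _)  (yes _) = - 1#
  decSign (no _)  (no _)  = 0#

  sum-decSign : ∀ {n} {P Q : Carrier → Set} (P? : ∀ x → Dec (P x)) (Q? : ∀ x → Dec (Q x)) → (∀ {x} → P x → ¬ Q x) →
    ∀ (d : Vector Carrier n) → sum (λ i → decSign (P? (d i)) (Q? (d i))) + fromℕ (count Q? (toVec d)) ≈ fromℕ (count P? (toVec d))
  sum-decSign {zero}  P? Q? disjoint d = +-identityˡ 0#
  sum-decSign {suc n} P? Q? disjoint d with P? (d zero) | Q? (d zero) | sum-decSign P? Q? disjoint (d ∘ suc)
  ... | yes p | yes q | _  = contradiction q (disjoint p)
  ... | yes _ | no _  | eq = trans (+-assoc _ _ _) (+-congˡ eq)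
  ... | no _  | yes _ | eq = trans (solve 2 (λ s q → :- :1 :+ s :+ (:1 :+ q) := s :+ q) refl _ _) eq
  ... | no _  | no _  | eq = trans (+-congʳ (+-identityˡ _)) eq

  sgn : Carrier → Carrier
  sgn x = decSign (0# <? x) (x <? 0#)

  -- `sgn x` is a subgradient of the absolute value at x: |x + t| is at least each of x + t, -(x +
  -- t) and 0.
  abs-shift-≥ : ∀ x t → abs x + t * sgn x ≤ abs (x + t)
  abs-shift-≥ x t = bound (0# <? x) (x <? 0#)
    where
    open ≤-Reasoning
    bound : (p : Dec (0# < x)) (q : Dec (x < 0#)) → abs x + t * decSign p q ≤ abs (x + t)
    bound (yes 0<x) _ = begin
      abs x + t * 1#   ≈⟨ +-cong (0≤x⇒abs≈x (proj₁ 0<x)) (*-identityʳ t) ⟩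
      x + t            ≤⟨ x≤abs (x + t) ⟩
      abs (x + t)      ∎
    bound (no _) (yes x<0) = begin
      abs x + t * - 1# ≈⟨ +-congʳ (x≤0⇒abs≈-x (proj₁ x<0)) ⟩
      - x + t * - 1#   ≈⟨ solve 2 (λ x t → :- x :+ t :* :- :1 := :- (x :+ t)) refl x t ⟩
      - (x + t)        ≤⟨ -x≤abs (x + t) ⟩
      abs (x + t)      ∎
    bound (no 0≮x) (no x≮0) = begin
      abs x + t * 0#   ≈⟨ +-cong (0≤x⇒abs≈x (≮⇒≥ x≮0)) (zeroʳ t) ⟩
      x + 0#           ≈⟨ +-identityʳ x ⟩
      x                ≤⟨ ≮⇒≥ 0≮x ⟩
      0#               ≤⟨ abs-nonNegative (x + t) ⟩
      abs (x + t)      ∎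

  -- A shift by at most |x| does not carry x across 0, and the absolute value is linear on either
  -- side of 0.
  abs-shift-≈ : ∀ x m → ¬ (0# ≈ x) → m ≤ abs x → 0# ≤ m → abs (x + - m) ≈ abs x + - m * sgn x
  abs-shift-≈ x m 0≉x m≤∣x∣ 0≤m = equal (0# <? x) (x <? 0#)
    where
    open ≈-Reasoning
    equal : (p : Dec (0# < x)) (q : Dec (x < 0#)) → abs (x + - m) ≈ abs x + - m * decSign p q
    equal (yes (0≤x , _)) _ = begin
      abs (x + - m)      ≈⟨ 0≤x⇒abs≈x (x≤y⇒0≤y-x (DTO.trans m≤∣x∣ (DTO.reflexive (0≤x⇒abs≈x 0≤x)))) ⟩
      x + - m            ≈⟨ +-cong (0≤x⇒abs≈x 0≤x) (*-identityʳ (- m)) ⟨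
      abs x + - m * 1#   ∎
    equal (no _) (yes (x≤0 , _)) = begin
      abs (x + - m)         ≈⟨ x≤0⇒abs≈-x (0≤-x⇒x≤0 (DTO.trans (+-nonNegative (x≤0⇒0≤-x x≤0) 0≤m)
                                 (DTO.reflexive (solve 2 (λ x m → :- x :+ m := :- (x :+ :- m)) refl x m)))) ⟩
      - (x + - m)           ≈⟨ solve 2 (λ x m → :- (x :+ :- m) := :- x :+ :- m :* :- :1) refl x m ⟩
      - x + - m * - 1#      ≈⟨ +-congʳ (x≤0⇒abs≈-x x≤0) ⟨
      abs x + - m * - 1#    ∎
    equal (no 0≮x) (no x≮0) = contradiction (DTO.antisym (≮⇒≥ x≮0) (≮⇒≥ 0≮x)) 0≉x

  count≡0 : ∀ {n} {P : Carrier → Set} (P? : ∀ x → Dec (P x)) (d : Vector Carrier n) →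
            count P? (toVec d) ≡ 0 → ∀ i → ¬ P (d i)
  count≡0 {suc n} P? d eq i with P? (d zero)
  count≡0 {suc n} P? d ()      i | yes _
  count≡0 {suc n} P? d eq zero    | no ¬p = ¬p
  count≡0 {suc n} P? d eq (suc i) | no ¬p = count≡0 P? (d ∘ suc) eq i

  abs-lowerBound : ∀ {n} (d : Vector Carrier n) → (∀ i → ¬ (0# ≈ d i)) → ∃ λ m → 0# < m × (∀ i → m ≤ abs (d i))
  abs-lowerBound {zero}  d d≉0 = 1# , 0<1 , λ ()
  abs-lowerBound {suc n} d d≉0 = case abs-lowerBound (d ∘ suc) (d≉0 ∘ suc) of λ where
      (m , 0<m , m≤) → case DTO.total m a of λ where
        (inj₁ m≤a) → m , 0<m , λ { zero → m≤a ; (suc i) → m≤ i }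
        (inj₂ a≤m) → a , 0<a , λ { zero → ≤-refl ; (suc i) → DTO.trans a≤m (m≤ i) }
    where
    a = abs (d zero)
    0<a : 0# < a
    0<a = abs-nonNegative (d zero) , λ 0≈a → d≉0 zero (sym (x²≈0⇒x≈0
      (trans (sym (abs-square (d zero))) (trans (*-congʳ (sym 0≈a)) (zeroˡ a)))))

  module _ {n} {Q : Matrix n} {d A} (Q-orthogonal : Orthogonal Q) (Q-diag : Diagonalizes Q d A) where

    diagonalizes-shift : ∀ t → Diagonalizes Q (λ k → d k + t) (A +ᴹ t • identity)
    diagonalizes-shift t = entry-diagonalizes λ i j → begin
      A i j + t * identity i j                         ≈⟨ solve 2 (λ a b → a :+ b := b :+ :1 :* a) refl (A i j) (t * identity i j) ⟩
      t * identity i j + 1# * A i j                    ≈⟨ diagonalizes-entry (diagonalizes-affine Q-orthogonal Q-diag t 1#) i j ⟩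
      sum (λ k → (t + 1# * d k) * (Q i k * Q j k))     ≈⟨ (sum-cong-≋ λ k → solve 3 (λ t d q → (t :+ :1 :* d) :* q := (d :+ t) :* q) refl t (d k) (Q i k * Q j k)) ⟩
      sum (λ k → (d k + t) * (Q i k * Q j k))          ∎
      where open ≈-Reasoning

    private
      norm : TraceNorm A (sum (λ i → abs (d i)))
      norm = diagonalizes-traceNorm Q-orthogonal Q-diag

      shiftedNorm : ∀ t → TraceNorm (A +ᴹ t • identity) (sum (λ i → abs (d i + t)))
      shiftedNorm t = diagonalizes-traceNorm Q-orthogonal (diagonalizes-shift t)

      σ : Carrier
      σ = sum (λ i → sgn (d i))

      sum-shift : ∀ t → sum (λ i → abs (d i) + t * sgn (d i)) ≈ sum (λ i → abs (d i)) + t * σ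
      sum-shift t = trans (∑-distrib-+ (λ i → abs (d i)) (λ i → t * sgn (d i))) (+-congˡ (sym (*-distribˡ-sum t (λ i → sgn (d i)))))

    -- Sum the subgradient inequality over the eigenvalues: the linear term is t times the sum of
    -- the signs, which vanishes when the counts agree.
    balanced⇒orthogonal : ∀ {b ξ} → Signature d b ξ b → BirkhoffJamesOrthogonal A identity
    balanced⇒orthogonal {b} (π≡ , _ , ν≡) t = _ , _ , norm , shiftedNorm t , (begin
      sum (λ i → abs (d i))                      ≈⟨ solve 2 (λ s t → s := s :+ t :* :0) refl _ t ⟩
      sum (λ i → abs (d i)) + t * 0#             ≈⟨ +-congˡ (*-congˡ σ≈0) ⟨
      sum (λ i → abs (d i)) + t * σ              ≈⟨ sum-shift t ⟨
      sum (λ i → abs (d i) + t * sgn (d i))      ≤⟨ (sum-mono-≤ λ i → abs-shift-≥ (d i) t) ⟩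
      sum (λ i → abs (d i + t))                  ∎)
      where
      open ≤-Reasoning
      σ≈0 : σ ≈ 0#
      σ≈0 = begin-equality
        σ                                        ≈⟨ solve 2 (λ s q → s := s :+ q :- q) refl σ (fromℕ b) ⟩
        σ + fromℕ b - fromℕ b                    ≡⟨ ≡.cong (λ k → σ + fromℕ k - fromℕ b) ν≡ ⟨
        σ + fromℕ (count (_<? 0#) (toVec d)) - fromℕ b
          ≈⟨ +-congʳ (sum-decSign (0# <?_) (_<? 0#) (λ 0<x x<0 → <⇒≱ 0<x (proj₁ x<0)) d) ⟩
        fromℕ (count (0# <?_) (toVec d)) - fromℕ b ≡⟨ ≡.cong (λ k → fromℕ k - fromℕ b) π≡ ⟩
        fromℕ b - fromℕ b                        ≈⟨ -‿inverseʳ (fromℕ b) ⟩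
        0#                                       ∎

    -- Take t = -m with 0 < m ≤ |d i| for all i. In this range the norm is linear in t, and it drops
    -- by exactly m because the signs add up to 1. The hypothesis supplies arbitrary values of the
    -- norm relation, which `traceNorm-unique` identifies with the computed ones.
    unbalanced⇒¬orthogonal : ∀ {b} → Signature d (suc b) 0 b → ¬ BirkhoffJamesOrthogonal A identity
    unbalanced⇒¬orthogonal {b} (π≡ , ξ≡ , ν≡) orthogonal =
      let m , 0<m , m≤ = abs-lowerBound d (count≡0 (0# ≟_) d ξ≡)
          s , t , s-norm , t-norm , s≤t = orthogonal (- m)
      in <⇒≱ (S-m<S m 0<m) (begin
        S                                          ≈⟨ traceNorm-unique norm s-norm ⟩
        s                                          ≤⟨ s≤t ⟩
        t                                          ≈⟨ traceNorm-unique t-norm (shiftedNorm (- m)) ⟩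
        sum (λ i → abs (d i + - m))                ≈⟨ (sum-cong-≋ λ i → abs-shift-≈ (d i) m (count≡0 (0# ≟_) d ξ≡ i) (m≤ i) (proj₁ 0<m)) ⟩
        sum (λ i → abs (d i) + - m * sgn (d i))    ≈⟨ sum-shift (- m) ⟩
        S + - m * σ                                ≈⟨ +-congˡ (trans (*-congˡ σ≈1) (*-identityʳ (- m))) ⟩
        S - m                                      ∎)
      where
      open ≤-Reasoning
      S = sum (λ i → abs (d i))

      S-m<S : ∀ m → 0# < m → S - m < S
      S-m<S m 0<m = 0<y-x⇒x<y (<-respʳ-≈ (solve 2 (λ s m → m := s :- (s :- m)) refl S m) 0<m)

      σ≈1 : σ ≈ 1#
      σ≈1 = begin-equality
        σ                                        ≈⟨ solve 2 (λ s q → s := s :+ q :- q) refl σ (fromℕ b) ⟩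
        σ + fromℕ b - fromℕ b                    ≡⟨ ≡.cong (λ k → σ + fromℕ k - fromℕ b) ν≡ ⟨
        σ + fromℕ (count (_<? 0#) (toVec d)) - fromℕ b
          ≈⟨ +-congʳ (sum-decSign (0# <?_) (_<? 0#) (λ 0<x x<0 → <⇒≱ 0<x (proj₁ x<0)) d) ⟩
        fromℕ (count (0# <?_) (toVec d)) - fromℕ b ≡⟨ ≡.cong (λ k → fromℕ k - fromℕ b) π≡ ⟩
        fromℕ (suc b) - fromℕ b                  ≈⟨ solve 1 (λ q → :1 :+ q :- q := :1) refl (fromℕ b) ⟩
        1#                                       ∎

  -- Parity and conclusion

  parity : ∀ n → ∃ λ b → n ≡ b ℕ.+ b ⊎ n ≡ suc b ℕ.+ b
  parity zero    = zero , inj₁ ≡.refl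
  parity (suc n) = case parity n of λ where
    (b , inj₁ ≡.refl) → b , inj₂ ≡.refl
    (b , inj₂ ≡.refl) → suc b , inj₁ (≡.cong suc (≡.sym (ℕ.+-suc b b)))

  double≡*2 : ∀ b → b ℕ.+ b ≡ b ℕ.* 2
  double≡*2 b = ≡.trans (≡.cong (b ℕ.+_) (≡.sym (ℕ.+-identityʳ b))) (ℕ.*-comm 2 b)

  2∣double : ∀ b → 2 ∣ b ℕ.+ b
  2∣double b = divides b (double≡*2 b)

  2∤suc-double : ∀ b → ¬ (2 ∣ suc b ℕ.+ b)
  2∤suc-double b 2∣ = case ∣1⇒≡1 (∣m+n∣m⇒∣n (≡.subst (2 ∣_) (≡.sym (ℕ.+-comm (b ℕ.+ b) 1)) 2∣) (2∣double b)) of λ ()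

  double/2 : ∀ b → (b ℕ.+ b) / 2 ≡ b
  double/2 b = ≡.trans (≡.cong (_/ 2) (double≡*2 b)) (m*n/n≡m b 2)

  pascal⁻¹-even : ∀ b → let n = b ℕ.+ b in
    HasInertia (pascal⁻¹ n) (b , 0 , b) × BirkhoffJamesOrthogonal (pascal⁻¹ n) identity
  pascal⁻¹-even b =
    let Q , d , Q-orthogonal , Q-diag = diagonalize (pascal⁻¹ n) (pascal⁻¹-symmetric n)
        signature = pascal⁻¹-signature Q-orthogonal Q-diag
          (λ j<b → ℕ.+-mono-< j<b j<b) (λ {j} j<b → ≡.subst (ℕ._≤ n) (≡.cong suc (ℕ.+-suc j j)) (ℕ.+-mono-≤ j<b j<b))
    in (d , diagonalizes-eigenvalues Q-orthogonal Q-diag , signature) , balanced⇒orthogonal Q-orthogonal Q-diag signature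
    where n = b ℕ.+ b

  pascal⁻¹-odd : ∀ b → let n = suc b ℕ.+ b in
    HasInertia (pascal⁻¹ n) (suc b , 0 , b) × ¬ BirkhoffJamesOrthogonal (pascal⁻¹ n) identity
  pascal⁻¹-odd b =
    let Q , d , Q-orthogonal , Q-diag = diagonalize (pascal⁻¹ n) (pascal⁻¹-symmetric n)
        signature = pascal⁻¹-signature {suc b} {b} Q-orthogonal Q-diag
          (λ j<1+b → ℕ.s≤s (ℕ.+-mono-≤ (ℕ.s≤s⁻¹ j<1+b) (ℕ.s≤s⁻¹ j<1+b)))
          (λ j<b → ℕ.s≤s (ℕ.+-mono-< j<b j<b))
    in (d , diagonalizes-eigenvalues Q-orthogonal Q-diag , signature) , unbalanced⇒¬orthogonal Q-orthogonal Q-diag signature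
    where n = suc b ℕ.+ b

  pascal⁻¹-theorem : ∀ n →
    ((2 ∣ n → HasInertia (pascal⁻¹ n) (n / 2 , 0 , n / 2))
    × (¬ (2 ∣ n) → HasInertia (pascal⁻¹ n) ((n ℕ.+ 1) / 2 , 0 , (n ℕ.∸ 1) / 2)))
    × (BirkhoffJamesOrthogonal (pascal⁻¹ n) identity ⇔ 2 ∣ n)
  pascal⁻¹-theorem n = case parity n of λ where
      (b , inj₁ ≡.refl) → even b
      (b , inj₂ ≡.refl) → odd b
    where
    Claim : ℕ → Set
    Claim n =
      ((2 ∣ n → HasInertia (pascal⁻¹ n) (n / 2 , 0 , n / 2))
      × (¬ (2 ∣ n) → HasInertia (pascal⁻¹ n) ((n ℕ.+ 1) / 2 , 0 , (n ℕ.∸ 1) / 2)))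
      × (BirkhoffJamesOrthogonal (pascal⁻¹ n) identity ⇔ 2 ∣ n)

    even : ∀ b → Claim (b ℕ.+ b)
    even b =
      let inertia , orthogonal = pascal⁻¹-even b
      in ((λ _ → ≡.subst (λ k → HasInertia (pascal⁻¹ (b ℕ.+ b)) (k , 0 , k)) (≡.sym (double/2 b)) inertia) ,
          contradiction (2∣double b)) ,
         mk⇔ (λ _ → 2∣double b) (λ _ → orthogonal)

    odd : ∀ b → Claim (suc b ℕ.+ b)
    odd b =
      let inertia , ¬orthogonal = pascal⁻¹-odd b
      in ((λ 2∣n → contradiction 2∣n (2∤suc-double b)) ,
          λ _ → ≡.subst₂ (λ k l → HasInertia (pascal⁻¹ (suc b ℕ.+ b)) (k , 0 , l))
            -- For n = 2 b + 1, n + 1 is rewritten as the double of b + 1, while n ∸ 1 reduces to b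
            -- + b by computation.
            (≡.sym (≡.trans (≡.cong (_/ 2) (ℕ.+-comm (suc b ℕ.+ b) 1)) (≡.trans (≡.cong (λ k → suc k / 2) (≡.sym (ℕ.+-suc b b))) (double/2 (suc b)))))
            (≡.sym (double/2 b)) inertia) ,
         mk⇔ (λ orthogonal → contradiction orthogonal ¬orthogonal) (λ 2∣n → contradiction 2∣n (2∤suc-double b))

open import Data.Nat.Base using (_+_; _∸_; _≤_)

mainTheorem6 : (ℝ : CompleteOrderedField) → let open RealMatrices ℝ in
    (n : ℕ) → 1 ≤ n →
    ((2 ∣ n → HasInertia (hadamardInverse (pascal n)) (n / 2 , 0 , n / 2))
    × (¬ (2 ∣ n) → HasInertia (hadamardInverse (pascal n)) ((n + 1) / 2 , 0 , (n ∸ 1) / 2)))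
    × (BirkhoffJamesOrthogonal (hadamardInverse (pascal n)) identity ⇔ 2 ∣ n)
mainTheorem6 ℝ n _ = pascal⁻¹-theorem ℝ n
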